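{- Let $t\ge2$, $\omega$ a primitive $t$-th root of unity, and $\lambda\in\mathcal P_t$. Let $(\lambda^{(0)},\dots,\lambda^{(t-1)})$, $n_i(\lambda)$, $\sigma_\lambda$ be the $t$-quotient, residue counts and sorting permutation computed from $\beta(\lambda,t)$. Then $\mathfrak{sp}_\lambda(1,\omega,\dots,\omega^{t-1})$ is nonzero if and only if the $t$-core of $\lambda$ is symplectic and $\ell(\lambda^{(i)})+\ell(\lambda^{(t-2-i)})\le1$ for all $0\le i\le\lfloor(t-3)/2\rfloor$. In that case, if the $t$-core has rank $r$, \[ \mathfrak{sp}_\lambda(1,\omega,\dots,\omega^{t-1})=(-1)^{\epsilon}\operatorname{sgn}(\sigma_\lambda)\times\begin{cases}2 & t\text{ even and }\lambda^{(t/2-1)}\ne\emptyset,\\ 1 & t\text{ even and }\lambda^{(t/2-1)}=\emptyset,\\ 1 & t\text{ odd},\end{cases} \] where $\epsilon=-\sum_{i=\lfloor t/2\rfloor}^{t-2}\binom{n_i(\lambda)+1}{2}+\begin{cases}1+r & t\text{ even},\\0 & t\text{ odd}.\end{cases}$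
   Context: Partitions $\lambda=(\lambda_1\ge\dots\ge0)$, $\ell$ = number of nonzero parts, $\mathcal P_m$ = partitions with $\ell\le m$, $\emptyset$ the empty partition. Beta-set $\beta(\lambda,m)=(\lambda_j+m-j)_{1\le j\le m}$; $n_i(\lambda)$ = number of its entries congruent to $i$ mod $t$. $t$-core: list the integers $tj+i$ ($0\le i\le t-1$, $0\le j\le n_i-1$) decreasingly as $b_1>\dots>b_m$; the $t$-core has parts $b_j-m+j$. $t$-quotient: writing entries congruent to $i$ decreasingly as $tc^{(i)}_1+i>\dots>tc^{(i)}_{n_i}+i$, $\lambda^{(i)}$ has parts $c^{(i)}_j-n_i+j$. $\sigma_\lambda\in S_m$: $(\beta_{\sigma_\lambda(1)},\dots,\beta_{\sigma_\lambda(m)})$ lists entries $\equiv0$ mod $t$ decreasingly, then $\equiv1$, ..., then $\equiv t-1$. Rank of $\nu$: largest $k$ with $\nu_k\ge k$; $\nu$ of rank $r$ is symplectic if $\nu'_i-i=\nu_i-i+1$ for $1\le i\le r$. $h_k$ complete homogeneous symmetric polynomial ($h_0=1$, $h_k=0$ for $k<0$). Universal symplectic character in a finite list of variables $Z$: $\mathfrak{sp}_\lambda(Z)=\tfrac12\det(h_{\lambda_i-i+j}(Z)+h_{\lambda_i-i-j+2}(Z))_{1\le i,j\le N}$, $N\ge\ell(\lambda)$. -}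

module Defs where

open import Level using (Level)
open import Data.Nat as ℕ using (_+_; _*_)
open import Data.Bool using (Bool; true; false; if_then_else_; not; _∧_)
open import Data.Nat using (ℕ; zero; suc; _∸_; _≤_; _<ᵇ_; _≡ᵇ_; _%_; _/_; NonZero; _⊔_)
open import Data.Nat.Combinatorics using (_C_)
open import Data.Integer as ℤ using (ℤ; +_; ∣_∣)
open import Data.Product using (_×_)
open import Data.List using (List; []; _∷_; length; map; concat; upTo; foldr; filterᵇ)
open import Data.Nat.ListAction using (sum)
open import Data.Fin using (Fin; toℕ; punchIn)
import Data.Fin as Fin
open import Algebra.Bundles using (CommutativeRing)
open import Relation.Binary.PropositionalEquality using (_≡_)

-- Combinatorics of partitions (a partition is a weakly decreasing list
-- of naturals; trailing zeros allowed)

at : List ℕ → ℕ → ℕ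
at []       _       = 0
at (x ∷ xs) zero    = x
at (x ∷ xs) (suc k) = at xs k

-- 1-indexed part ν_i (i ≥ 1)
part : List ℕ → ℕ → ℕ
part ν i = at ν (i ∸ 1)

countᵇ : (ℕ → Bool) → List ℕ → ℕ
countᵇ p xs = length (filterᵇ p xs)

len : List ℕ → ℕ
len ν = countᵇ (λ x → 0 <ᵇ x) ν

conj : List ℕ → ℕ → ℕ
conj ν i = countᵇ (λ x → not (x <ᵇ i)) ν

-- rank: largest k with ν_k ≥ k (0 if none); only k ≤ length ν can qualify
rank : List ℕ → ℕ
rank ν = foldr _⊔_ 0
  (map (λ k0 → if part ν (suc k0) <ᵇ suc k0 then 0 else suc k0) (upTo (length ν)))

Symplectic : List ℕ → Set
Symplectic ν = ∀ i → 1 ≤ i → i ≤ rank ν →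
  (+ conj ν i) ℤ.- (+ i) ≡ ((+ part ν i) ℤ.- (+ i)) ℤ.+ ℤ.1ℤ

insertD : ℕ → List ℕ → List ℕ
insertD x []       = x ∷ []
insertD x (y ∷ ys) = if y <ᵇ x then x ∷ y ∷ ys else y ∷ insertD x ys

sortD : List ℕ → List ℕ
sortD = foldr insertD []

beta : List ℕ → ℕ → List ℕ
beta lam m = map (λ j0 → part lam (suc j0) + (m ∸ suc j0)) (upTo m)

module _ (t : ℕ) .{{_ : NonZero t}} where

  resEntries : List ℕ → ℕ → List ℕ
  resEntries bs i = filterᵇ (λ x → x % t ≡ᵇ i) bs

  nRes : List ℕ → ℕ → ℕ
  nRes lam i = length (resEntries (beta lam t) i)

  core : List ℕ → List ℕ
  core lam =
    let m  = t
        bs = sortD (concat (map (λ i → map (λ j → t * j + i) (upTo (nRes lam i))) (upTo t)))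
    in map (λ j0 → (at bs j0 + suc j0) ∸ m) (upTo (length bs))

  quot : List ℕ → ℕ → List ℕ
  quot lam i =
    let es = sortD (resEntries (beta lam t) i)
        cs = map (λ x → x / t) es
        n  = length cs
    in map (λ j0 → (at cs j0 + suc j0) ∸ n) (upTo n)

  indexOf : List ℕ → ℕ → ℕ
  indexOf []       x = 0
  indexOf (y ∷ ys) x = if y ≡ᵇ x then 0 else suc (indexOf ys x)

  -- σ_λ in one-line notation (0-indexed):
  -- (β_{σ(1)},…,β_{σ(m)}) = entries ≡ 0 decreasing, then ≡ 1, …, then ≡ t-1
  sigma : List ℕ → List ℕ
  sigma lam =
    let bs = beta lam t
    in map (indexOf bs) (concat (map (λ i → sortD (resEntries bs i)) (upTo t)))

inversions : List ℕ → ℕ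
inversions []       = 0
inversions (x ∷ xs) = countᵇ (λ y → y <ᵇ x) xs + inversions xs

isEven : ℕ → Bool
isEven n = n % 2 ≡ᵇ 0

module RingDefs {c ℓ : Level} (R : CommutativeRing c ℓ) where
  open CommutativeRing R hiding (_+_; _*_)
  open CommutativeRing R using () renaming (_+_ to _+ᴿ_; _*_ to _*ᴿ_)

  pow : Carrier → ℕ → Carrier
  pow x zero    = 1#
  pow x (suc n) = x *ᴿ pow x n

  natR : ℕ → Carrier
  natR zero    = 0#
  natR (suc n) = 1# +ᴿ natR n

  signN : ℕ → Carrier
  signN n = if isEven n then 1# else - 1#

  signZ : ℤ → Carrier
  signZ e = signN ∣ e ∣

  sumℕ : ℕ → (ℕ → Carrier) → Carrier
  sumℕ zero    f = 0#
  sumℕ (suc n) f = f 0 +ᴿ sumℕ n (λ k → f (suc k))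

  sumFin : ∀ {n} → (Fin n → Carrier) → Carrier
  sumFin {zero}  f = 0#
  sumFin {suc n} f = f Fin.zero +ᴿ sumFin (λ k → f (Fin.suc k))

  det : ∀ {n} → (Fin n → Fin n → Carrier) → Carrier
  det {zero}  M = 1#
  det {suc n} M = sumFin (λ j → signN (toℕ j) *ᴿ (M Fin.zero j *ᴿ
                    det (λ a b → M (Fin.suc a) (punchIn j b))))

  hList : List Carrier → ℕ → Carrier
  hList []      zero    = 1#
  hList []      (suc k) = 0#
  hList (z ∷ Z) k       = sumℕ (suc k) (λ a → pow z a *ᴿ hList Z (k ∸ a))

  h : List Carrier → ℤ → Carrier
  h Z (+ k)       = hList Z k
  h Z ℤ.-[1+ _ ]  = 0#

  sp : (half : Carrier) → List Carrier → (lam : List ℕ) → (N : ℕ) → Carrier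
  sp half Z lam N = half *ᴿ det {N} (λ i j →
    let I = + suc (toℕ i)
        J = + suc (toℕ j)
        L = + part lam (suc (toℕ i))
    in h Z (L ℤ.- I ℤ.+ J) +ᴿ h Z (L ℤ.- I ℤ.- J ℤ.+ + 2))

  roots : Carrier → ℕ → List Carrier
  roots ω t = map (pow ω) (upTo t)

module _ (t : ℕ) .{{_ : NonZero t}} where

  Cond : List ℕ → Set
  Cond lam = Symplectic (core t lam) ×
    (∀ i → 2 * i + 3 ≤ t → len (quot t lam i) + len (quot t lam (t ∸ 2 ∸ i)) ≤ 1)

  epsilon : List ℕ → ℤ
  epsilon lam =
    ℤ.- (+ sum (map (λ i → (nRes t lam i + 1) C 2)
                 (filterᵇ (λ i → not (i <ᵇ t / 2) ∧ not (t <ᵇ i + 2)) (upTo t))))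
    ℤ.+ (if isEven t then + (1 + rank (core t lam)) else + 0)

module _ {c ℓ : Level} (R : CommutativeRing c ℓ) (t : ℕ) .{{_ : NonZero t}} where
  open CommutativeRing R hiding (_+_; _*_)
  open CommutativeRing R using () renaming (_+_ to _+ᴿ_; _*_ to _*ᴿ_)
  open RingDefs R

  factor : List ℕ → Carrier
  factor lam = if isEven t
    then (if len (quot t lam (t / 2 ∸ 1)) ≡ᵇ 0 then 1# else 1# +ᴿ 1#)
    else 1#

  value : List ℕ → Carrier
  value lam = signZ (epsilon t lam) *ᴿ signN (inversions (sigma t lam)) *ᴿ factor lam

{-# OPTIONS --safe #-}
module Submission where

-- Since ∏ (1 − ω^i q) = 1 − q^t, one has h_k(1, ω, …, ω^{t−1}) = 1 if t divides k ≥ 0, and 0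
-- otherwise.  Number the columns by c = t − j and write r for the residue of the bead b = β_i.  The
-- row of b is then twice the unit vector e_r if r = t − 1; otherwise it is e_r if b < t (a small
-- bead), and e_r + e_{t−2−r} if b ≥ t (a big bead).  So the columns fall into the classes
-- {c, t − 2 − c} and {t − 1}, and a nonzero determinant forces every class to contain as many beads
-- as columns, with at most one big bead in each two-element class.
--
-- In that case every big bead whose row has two entries shares its class with a small bead, whose
-- row is a unit vector, so only one of the two entries matters: the determinant is a power of 2
-- times the sign of the permutation sending each bead to its column.  That permutation differs from
-- the sequence of residues only where a residue occurs twice, and changing one class at a time
-- flips a computable number of inversions.  Finally, the gaps and the beads ≥ t of the core are
-- exchanged by x ↦ 2t − 2 − x precisely when the class sizes are right, which is the symplectic
-- condition.


open import Defs
open import Level using (Level)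
open import Data.Nat using (ℕ; _≤_; _<_; NonZero)
open import Data.List using (List; length)
open import Data.List.Relation.Unary.Linked using (Linked)
open import Data.Nat using (_≥_)
open import Data.Product using (_×_)
open import Data.Sum using (_⊎_)
open import Function.Bundles using (_⇔_)
open import Relation.Nullary using (¬_)
open import Relation.Binary.PropositionalEquality using (_≡_)
open import Algebra.Bundles using (CommutativeRing)

-- Both parities of `t` are handled together: `s = t − 1` is written as `e + (u + u)` with `e ≤ 1`,
-- so `e = 1` exactly for even `t`. The two-element classes are `{c, dual c}` with `c < u`, and for
-- `e = 1` the residue `u = t/2 − 1` is its own dual. Its row is doubled when its bead is big, which
-- is the factor 2 of the even case; the doubled row of residue `t − 1` cancels the ½ in the
-- definition. Equality in the ring need not be decidable, so "nonzero implies the conditions" is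
-- obtained by deciding combinatorial conditions and showing that the determinant vanishes when one
-- fails: wrong class sizes leave no permutation inside the support, and two big beads in a class
-- make two columns equal. The shape of ε comes from the sign. A big bead exchanged for its dual
-- column passes the values strictly between, whose number has the parity of `e`; this yields the
-- rank of the core for even `t`. Whether the move goes up or down is recorded by `n (dual c)`,
-- through the binomial coefficients 0, 1, 3 for 0, 1, 2 beads.

module Development where
  import Algebra.Properties.Ring as RingProperties
  import Algebra.Solver.Ring.NaturalCoefficients.Default as SemiringSolver
  open import Data.Bool using (Bool; T; _xor_; _∧_; _∨_; false; if_then_else_; not; true)
  open import Data.Bool.Properties using (T?; not-distribˡ-xor; not-involutive; xor-annihilates-not; xor-comm; xor-identityʳ; xor-same; ∧-identityʳ; ∧-zeroʳ)
  open import Data.Bool.Solver using (module xor-∧-Solver)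
  open import Data.Empty using (⊥; ⊥-elim)
  import Data.Fin as Fin
  open import Data.Fin using (Fin; punchIn; toℕ)
  open import Data.Fin.Properties using (toℕ<n)
  open import Data.Integer as ℤ using (_⊖_; ∣_∣)
  import Data.Integer.Properties as ℤ
  import Data.Integer.Solver as ℤ
  open import Data.List using ([]; _++_; _∷_; _∷ʳ_; applyUpTo; concat; filterᵇ; foldr; map; upTo)
  open import Data.List.Membership.Propositional using (_∈_)
  open import Data.List.Membership.Propositional.Properties using (∈-++⁺ʳ; ∈-++⁺ˡ; ∈-++⁻; ∈-map⁺; ∈-∃++)
  open import Data.List.Properties using (++-assoc; applyUpTo-∷ʳ; length-applyUpTo; length-map; map-++; map-applyUpTo; map-upTo; map-∘)
  open import Data.List.Relation.Unary.All as All using (All; []; _∷_)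
  open import Data.List.Relation.Unary.AllPairs using (AllPairs; []; _∷_)
  open import Data.List.Relation.Unary.AllPairs.Properties using (applyUpTo⁺₁) renaming (filter⁺ to AllPairs-filter⁺)
  open import Data.List.Relation.Unary.Any using (here; there)
  open import Data.List.Relation.Unary.Linked.Properties using (Linked⇒AllPairs)
  open import Data.Nat using (_%_; _*_; _+_; _/_; _<?_; _<ᵇ_; _>_; _∸_; _≟_; _≡ᵇ_; _≤?_; _≤′_; _⊔_; suc; s≤s; zero; z≤n; ≤′-refl; ≤′-step)
  open import Data.Nat.Combinatorics using (_C_)
  open import Data.Nat.DivMod using (+-distrib-/-∣ʳ; [m+kn]%n≡m%n; [m+n]%n≡m%n; m%n<n; m*n%n≡0; m*n/n≡m; m<n⇒m%n≡m; m<n⇒m/n≡0; m≡m%n+[m/n]*n; m≥n⇒m/n>0)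
  open import Data.Nat.Divisibility using (divides)
  open import Data.Nat.ListAction using (sum)
  open import Data.Nat.Properties
  open import Data.Nat.Solver using (module +-*-Solver)
  open import Data.Product using (_,_; proj₁; proj₂; ∃; ∃₂)
  open import Data.Sum using (inj₁; inj₂)
  open import Data.Unit using (tt)
  open import Function using (_∘_; id)
  open import Function.Bundles using (mk⇔)
  open import Relation.Binary.Definitions using (tri<; tri>; tri≈)
  open import Relation.Binary.PropositionalEquality using (_≢_; refl; sym; trans; cong; cong₂; subst; subst₂; module ≡-Reasoning)
  open import Relation.Nullary using (Dec; contradiction; no; yes)

  -- Sums and counting

  -- The definitions branch on `_<ᵇ_`, so the order fact is paired with the value of the test: a
  -- `rewrite` by the second component makes them compute.
  lt-case : ∀ m n → (m < n × (m <ᵇ n) ≡ true) ⊎ (n ≤ m × (m <ᵇ n) ≡ false)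
  lt-case m n with m <ᵇ n in eq
  ... | true  = inj₁ (<ᵇ⇒< m n (subst T (sym eq) tt) , refl)
  ... | false = inj₂ (≮⇒≥ (λ m<n → subst T eq (<⇒<ᵇ m<n)) , refl)

  eq-case : ∀ m n → (m ≡ n × (m ≡ᵇ n) ≡ true) ⊎ (m ≢ n × (m ≡ᵇ n) ≡ false)
  eq-case m n with m ≡ᵇ n in eq
  ... | true  = inj₁ (≡ᵇ⇒≡ m n (subst T (sym eq) tt) , refl)
  ... | false = inj₂ ((λ m≡n → subst T eq (≡⇒≡ᵇ m n m≡n)) , refl)

  <ᵇ-true : ∀ {m n} → m < n → (m <ᵇ n) ≡ true
  <ᵇ-true {m} {n} m<n with lt-case m n
  ... | inj₁ (_ , eq)   = eq
  ... | inj₂ (n≤m , eq) = ⊥-elim (<-irrefl refl (<-≤-trans m<n n≤m))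

  <ᵇ-false : ∀ {m n} → n ≤ m → (m <ᵇ n) ≡ false
  <ᵇ-false {m} {n} n≤m with lt-case m n
  ... | inj₁ (m<n , eq) = ⊥-elim (<-irrefl refl (<-≤-trans m<n n≤m))
  ... | inj₂ (_ , eq)   = eq

  ≡ᵇ-refl : ∀ m → (m ≡ᵇ m) ≡ true
  ≡ᵇ-refl zero    = refl
  ≡ᵇ-refl (suc m) = ≡ᵇ-refl m

  ≡ᵇ-true : ∀ {m n} → m ≡ n → (m ≡ᵇ n) ≡ true
  ≡ᵇ-true {m} refl = ≡ᵇ-refl m

  ≡ᵇ-false : ∀ {m n} → m ≢ n → (m ≡ᵇ n) ≡ false
  ≡ᵇ-false {m} {n} m≢n with eq-case m n
  ... | inj₁ (m≡n , _) = ⊥-elim (m≢n m≡n)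
  ... | inj₂ (_ , eq)  = eq

  ≡ᵇ-true⁻¹ : ∀ {m n} → (m ≡ᵇ n) ≡ true → m ≡ n
  ≡ᵇ-true⁻¹ {m} {n} eq = ≡ᵇ⇒≡ m n (subst T (sym eq) tt)

  bool-iff : ∀ {p q : Bool} → (p ≡ true → q ≡ true) → (q ≡ true → p ≡ true) → p ≡ q
  bool-iff {true}  {q}     f g = sym (f refl)
  bool-iff {false} {true}  f g = g refl
  bool-iff {false} {false} f g = refl

  ind : Bool → ℕ
  ind true  = 1
  ind false = 0

  ind≤1 : ∀ p → ind p ≤ 1
  ind≤1 true  = ≤-refl
  ind≤1 false = z≤n

  ∑ : ℕ → (ℕ → ℕ) → ℕ
  ∑ zero    f = 0
  ∑ (suc n) f = f 0 + ∑ n (f ∘ suc)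

  ∑-cong : ∀ n {f g} → (∀ i → i < n → f i ≡ g i) → ∑ n f ≡ ∑ n g
  ∑-cong zero    h = refl
  ∑-cong (suc n) h = cong₂ _+_ (h 0 (s≤s z≤n)) (∑-cong n (λ i i<n → h (suc i) (s≤s i<n)))

  ∑-zero : ∀ n {f} → (∀ i → i < n → f i ≡ 0) → ∑ n f ≡ 0
  ∑-zero zero    h = refl
  ∑-zero (suc n) h = cong₂ _+_ (h 0 (s≤s z≤n)) (∑-zero n (λ i i<n → h (suc i) (s≤s i<n)))

  ∑-last : ∀ n f → ∑ (suc n) f ≡ ∑ n f + f n
  ∑-last zero    f = +-comm (f 0) 0
  ∑-last (suc n) f = trans (cong (f 0 +_) (∑-last n (f ∘ suc))) (sym (+-assoc (f 0) _ _))

  ∑-+ : ∀ n f g → ∑ n (λ i → f i + g i) ≡ ∑ n f + ∑ n g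
  ∑-+ zero    f g = refl
  ∑-+ (suc n) f g rewrite ∑-+ n (f ∘ suc) (g ∘ suc) =
    solve 4 (λ a b c d → (a :+ b) :+ (c :+ d) := (a :+ c) :+ (b :+ d)) refl (f 0) (g 0) _ _
    where open +-*-Solver

  ∑-mono : ∀ n {f g} → (∀ i → i < n → f i ≤ g i) → ∑ n f ≤ ∑ n g
  ∑-mono zero    h = z≤n
  ∑-mono (suc n) h = +-mono-≤ (h 0 (s≤s z≤n)) (∑-mono n (λ i i<n → h (suc i) (s≤s i<n)))

  ∑-const : ∀ n k → ∑ n (λ _ → k) ≡ n * k
  ∑-const zero    k = refl
  ∑-const (suc n) k = cong (k +_) (∑-const n k)

  +-squeeze : ∀ {a b c d} → a ≤ b → c ≤ d → a + c ≡ b + d → a ≡ b × c ≡ d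
  +-squeeze {a} {b} {c} {d} a≤b c≤d eq = a≡b , +-cancelˡ-≡ b c d (trans (cong (_+ c) (sym a≡b)) eq)
    where
    a≡b : a ≡ b
    a≡b = ≤-antisym a≤b (+-cancelʳ-≤ c b a (≤-trans (+-monoʳ-≤ b c≤d) (≤-reflexive (sym eq))))

  -- The pigeonhole principle in the form used throughout. It upgrades "at most" to "exactly" for
  -- the class sizes, and surjectivity to bijectivity for the assignment of columns.
  ∑-squeeze : ∀ n {f g} → (∀ i → i < n → f i ≤ g i) → ∑ n f ≡ ∑ n g → ∀ i → i < n → f i ≡ g i
  ∑-squeeze (suc n) {f} {g} f≤g eq =
    λ { zero    _         → proj₁ both
      ; (suc i) (s≤s i<n) → ∑-squeeze n f≤g′ (proj₂ both) i i<n }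
    where
    f≤g′ : ∀ i → i < n → f (suc i) ≤ g (suc i)
    f≤g′ i i<n = f≤g (suc i) (s≤s i<n)
    both = +-squeeze (f≤g 0 (s≤s z≤n)) (∑-mono n f≤g′) eq

  -- The reflection of the summation range has a fixed point, `u`, exactly for `e = 1`; the factor
  -- `e` lets both parities share one formula.
  ∑-fold : ∀ e u F → e ≤ 1 →
    ∑ (e + (u + u)) F ≡ ∑ u (λ c → F c + F (e + (u + u) ∸ suc c)) + e * F u
  ∑-fold zero          zero    F _         = refl
  ∑-fold (suc zero)    zero    F _         = refl
  ∑-fold (suc (suc _)) zero    F (s≤s ())
  ∑-fold e             (suc u) F e≤1 = begin
    ∑ (e + (suc u + suc u)) F
      ≡⟨ cong (λ k → ∑ k F) m+2 ⟩
    F 0 + ∑ (suc m) (F ∘ suc)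
      ≡⟨ cong (F 0 +_) (∑-last m (F ∘ suc)) ⟩
    F 0 + (∑ m (F ∘ suc) + F (suc m))
      ≡⟨ cong (λ k → F 0 + (k + F (suc m))) (∑-fold e u (F ∘ suc) e≤1) ⟩
    F 0 + (∑ u (λ c → F (suc c) + F (suc (m ∸ suc c))) + e * F (suc u) + F (suc m))
      ≡⟨ cong (λ k → F 0 + (k + e * F (suc u) + F (suc m))) (∑-cong u inner) ⟩
    F 0 + (∑ u (λ c → F (suc c) + F (M ∸ suc (suc c))) + e * F (suc u) + F (suc m))
      ≡⟨ solve 4 (λ a b c d → a :+ (b :+ c :+ d) := (a :+ d) :+ b :+ c) refl (F 0) _ _ _ ⟩
    F 0 + F (suc m) + ∑ u (λ c → F (suc c) + F (M ∸ suc (suc c))) + e * F (suc u)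
      ≡⟨ cong (λ k → F 0 + F k + ∑ u (λ c → F (suc c) + F (M ∸ suc (suc c))) + e * F (suc u)) (cong (_∸ 1) (sym m+2)) ⟩
    F 0 + F (M ∸ 1) + ∑ u (λ c → F (suc c) + F (M ∸ suc (suc c))) + e * F (suc u) ∎
    where
    open ≡-Reasoning
    open +-*-Solver
    m = e + (u + u)
    M = e + (suc u + suc u)
    m+2 : M ≡ suc (suc m)
    m+2 = trans (cong (e +_) (cong suc (+-suc u u))) (trans (+-suc e _) (cong suc (+-suc e _)))
    inner : ∀ c → c < u → F (suc c) + F (suc (m ∸ suc c)) ≡ F (suc c) + F (M ∸ suc (suc c))
    inner c c<u = cong (λ k → F (suc c) + F k)
      (trans (sym (+-∸-assoc 1 (≤-trans c<u (≤-trans (m≤m+n u u) (m≤n+m (u + u) e)))))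
             (cong (_∸ suc (suc c)) (sym m+2)))

  count-∷ : ∀ p x xs → countᵇ p (x ∷ xs) ≡ ind (p x) + countᵇ p xs
  count-∷ p x xs with p x
  ... | true  = refl
  ... | false = refl

  count-cong : ∀ {p q} xs → (∀ {x} → x ∈ xs → p x ≡ q x) → countᵇ p xs ≡ countᵇ q xs
  count-cong         []       h = refl
  count-cong {p} {q} (x ∷ xs) h
    rewrite count-∷ p x xs | count-∷ q x xs | h (here refl) = cong (ind (q x) +_) (count-cong xs (h ∘ there))

  count-+ : ∀ {p q r} xs → (∀ {x} → x ∈ xs → ind (p x) ≡ ind (q x) + ind (r x)) →
    countᵇ p xs ≡ countᵇ q xs + countᵇ r xs
  count-+             []       h = refl
  count-+ {p} {q} {r} (x ∷ xs) h
    rewrite count-∷ p x xs | count-∷ q x xs | count-∷ r x xs | h (here refl) | count-+ {p} {q} {r} xs (h ∘ there) =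
    solve 4 (λ a b c d → (a :+ b) :+ (c :+ d) := (a :+ c) :+ (b :+ d)) refl (ind (q x)) _ _ _
    where open +-*-Solver

  count-zero : ∀ {p} xs → (∀ {x} → x ∈ xs → p x ≡ false) → countᵇ p xs ≡ 0
  count-zero     []       h = refl
  count-zero {p} (x ∷ xs) h rewrite count-∷ p x xs | h (here refl) = count-zero xs (h ∘ there)

  count-all : ∀ {p} xs → (∀ {x} → x ∈ xs → p x ≡ true) → countᵇ p xs ≡ length xs
  count-all     []       h = refl
  count-all {p} (x ∷ xs) h rewrite count-∷ p x xs | h (here refl) = cong suc (count-all xs (h ∘ there))

  count≤length : ∀ p xs → countᵇ p xs ≤ length xs
  count≤length p []       = z≤n
  count≤length p (x ∷ xs) rewrite count-∷ p x xs = +-mono-≤ (ind≤1 (p x)) (count≤length p xs)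

  count-map : ∀ p (f : ℕ → ℕ) xs → countᵇ p (map f xs) ≡ countᵇ (p ∘ f) xs
  count-map p f []       = refl
  count-map p f (x ∷ xs)
    rewrite count-∷ p (f x) (map f xs) | count-∷ (p ∘ f) x xs = cong (ind (p (f x)) +_) (count-map p f xs)

  count-++ : ∀ p xs ys → countᵇ p (xs ++ ys) ≡ countᵇ p xs + countᵇ p ys
  count-++ p []       ys = refl
  count-++ p (x ∷ xs) ys
    rewrite count-∷ p x (xs ++ ys) | count-∷ p x xs | count-++ p xs ys = sym (+-assoc (ind (p x)) _ _)

  count-∃ : ∀ {p} xs → 1 ≤ countᵇ p xs → ∃ λ x → x ∈ xs × p x ≡ true
  count-∃ {p} (x ∷ xs) h with p x in eq
  ... | true  = x , here refl , eq
  ... | false with count-∃ xs h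
  ...   | y , y∈ , py = y , there y∈ , py

  ∃-count : ∀ {p x} xs → x ∈ xs → p x ≡ true → 1 ≤ countᵇ p xs
  ∃-count {p} (x ∷ xs) (here refl) px rewrite count-∷ p x xs | px = s≤s z≤n
  ∃-count {p} (x ∷ xs) (there i)   px rewrite count-∷ p x xs = ≤-trans (∃-count xs i px) (m≤n+m _ _)

  ∃₂-count : ∀ {p x y} xs → x ∈ xs → y ∈ xs → x ≢ y → p x ≡ true → p y ≡ true → 2 ≤ countᵇ p xs
  ∃₂-count     (z ∷ xs) (here refl) (here refl) x≢y px py = ⊥-elim (x≢y refl)
  ∃₂-count {p} (z ∷ xs) (here refl) (there j)   x≢y px py rewrite count-∷ p z xs | px = s≤s (∃-count xs j py)
  ∃₂-count {p} (z ∷ xs) (there i)   (here refl) x≢y px py rewrite count-∷ p z xs | py = s≤s (∃-count xs i px)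
  ∃₂-count {p} (z ∷ xs) (there i)   (there j)   x≢y px py rewrite count-∷ p z xs =
    ≤-trans (∃₂-count xs i j x≢y px py) (m≤n+m _ _)

  count-<-∑ : ∀ (f : ℕ → ℕ) n xs →
    countᵇ (λ x → f x <ᵇ n) xs ≡ ∑ n (λ c → countᵇ (λ x → f x ≡ᵇ c) xs)
  count-<-∑ f zero    xs = count-zero xs (λ _ → refl)
  count-<-∑ f (suc n) xs = begin
    countᵇ (λ x → f x <ᵇ suc n) xs
      ≡⟨ count-+ xs (λ {x} _ → split (f x)) ⟩
    countᵇ (λ x → f x <ᵇ n) xs + countᵇ (λ x → f x ≡ᵇ n) xs
      ≡⟨ cong (_+ countᵇ (λ x → f x ≡ᵇ n) xs) (count-<-∑ f n xs) ⟩
    ∑ n (λ c → countᵇ (λ x → f x ≡ᵇ c) xs) + countᵇ (λ x → f x ≡ᵇ n) xs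
      ≡⟨ sym (∑-last n _) ⟩
    ∑ (suc n) (λ c → countᵇ (λ x → f x ≡ᵇ c) xs) ∎
    where
    open ≡-Reasoning
    split : ∀ y → ind (y <ᵇ suc n) ≡ ind (y <ᵇ n) + ind (y ≡ᵇ n)
    split y with lt-case y n
    ... | inj₁ (y<n , eq) rewrite eq | <ᵇ-true (m<n⇒m<1+n y<n) | ≡ᵇ-false (<⇒≢ y<n) = refl
    ... | inj₂ (n≤y , eq) with eq-case y n
    ...   | inj₁ (refl , eq′) rewrite eq | eq′ | <ᵇ-true (n<1+n y) = refl
    ...   | inj₂ (y≢n , eq′) rewrite eq | eq′ | <ᵇ-false (≤∧≢⇒< n≤y (y≢n ∘ sym)) = refl

  -- Strictly decreasing lists and insertion sort

  Desc : List ℕ → Set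
  Desc = AllPairs _>_

  Desc⇒count-≡≤1 : ∀ {xs} → Desc xs → ∀ y → countᵇ (_≡ᵇ y) xs ≤ 1
  Desc⇒count-≡≤1 []                _ = z≤n
  Desc⇒count-≡≤1 {x ∷ xs} (x> ∷ d) y rewrite count-∷ (_≡ᵇ y) x xs with eq-case x y
  ... | inj₂ (_ , eq)    rewrite eq = Desc⇒count-≡≤1 d y
  ... | inj₁ (refl , eq) rewrite eq
    | count-zero {_≡ᵇ x} xs (λ z∈ → ≡ᵇ-false (<⇒≢ (All.lookup x> z∈))) = ≤-refl

  insertD-count : ∀ p x xs → countᵇ p (insertD x xs) ≡ ind (p x) + countᵇ p xs
  insertD-count p x []       = count-∷ p x []
  insertD-count p x (y ∷ ys) with y <ᵇ x
  ... | true  = count-∷ p x (y ∷ ys)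
  ... | false rewrite count-∷ p y (insertD x ys) | count-∷ p y ys | insertD-count p x ys =
    solve 3 (λ a b c → a :+ (b :+ c) := b :+ (a :+ c)) refl (ind (p y)) (ind (p x)) _
    where open +-*-Solver

  sortD-count : ∀ p xs → countᵇ p (sortD xs) ≡ countᵇ p xs
  sortD-count p []       = refl
  sortD-count p (x ∷ xs) rewrite insertD-count p x (sortD xs) | count-∷ p x xs = cong (ind (p x) +_) (sortD-count p xs)

  insertD-≥ : ∀ {y} x xs → y ≥ x → All (y ≥_) xs → All (y ≥_) (insertD x xs)
  insertD-≥ x []       y≥x []         = y≥x ∷ []
  insertD-≥ x (z ∷ zs) y≥x (y≥z ∷ y≥) with z <ᵇ x
  ... | true  = y≥x ∷ y≥z ∷ y≥
  ... | false = y≥z ∷ insertD-≥ x zs y≥x y≥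

  insertD-sorted : ∀ x {xs} → AllPairs _≥_ xs → AllPairs _≥_ (insertD x xs)
  insertD-sorted x {[]}     []       = [] ∷ []
  insertD-sorted x {y ∷ ys} (y≥ ∷ d) with lt-case y x
  ... | inj₁ (y<x , eq) rewrite eq = (<⇒≤ y<x ∷ All.map (λ z≤y → ≤-trans z≤y (<⇒≤ y<x)) y≥) ∷ (y≥ ∷ d)
  ... | inj₂ (x≤y , eq) rewrite eq = insertD-≥ x ys x≤y y≥ ∷ insertD-sorted x d

  sortD-sorted : ∀ xs → AllPairs _≥_ (sortD xs)
  sortD-sorted []       = []
  sortD-sorted (x ∷ xs) = insertD-sorted x (sortD-sorted xs)

  sorted⇒Desc : ∀ {xs} → AllPairs _≥_ xs → (∀ y → countᵇ (_≡ᵇ y) xs ≤ 1) → Desc xs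
  sorted⇒Desc []                h = []
  sorted⇒Desc {x ∷ xs} (x≥ ∷ d) h = All.tabulate strict ∷ sorted⇒Desc d (λ y → ≤-trans (weaken y) (h y))
    where
    weaken : ∀ y → countᵇ (_≡ᵇ y) xs ≤ countᵇ (_≡ᵇ y) (x ∷ xs)
    weaken y rewrite count-∷ (_≡ᵇ y) x xs = m≤n+m _ _
    strict : ∀ {y} → y ∈ xs → x > y
    strict {y} y∈ = ≤∧≢⇒< (All.lookup x≥ y∈) λ y≡x → <-irrefl refl (≤-trans (two y≡x) (h x))
      where
      two : y ≡ x → 2 ≤ countᵇ (_≡ᵇ x) (x ∷ xs)
      two y≡x rewrite count-∷ (_≡ᵇ x) x xs | ≡ᵇ-refl x = s≤s (∃-count xs y∈ (≡ᵇ-true y≡x))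

  insertD-max : ∀ x {xs} → All (x >_) xs → insertD x xs ≡ x ∷ xs
  insertD-max x []         = refl
  insertD-max x (x>y ∷ _) rewrite <ᵇ-true x>y = refl

  sortD-Desc : ∀ {xs} → Desc xs → sortD xs ≡ xs
  sortD-Desc []       = refl
  sortD-Desc {x ∷ xs} (x> ∷ d) rewrite sortD-Desc d = insertD-max x x>

  at-∈ : ∀ xs {k} → k < length xs → at xs k ∈ xs
  at-∈ (x ∷ xs) {zero}  _         = here refl
  at-∈ (x ∷ xs) {suc k} (s≤s k<n) = there (at-∈ xs k<n)

  ∈-at : ∀ {x xs} → x ∈ xs → ∃ λ k → k < length xs × at xs k ≡ x
  ∈-at (here refl) = 0 , s≤s z≤n , refl
  ∈-at (there i) with ∈-at i
  ... | k , k<n , eq = suc k , s≤s k<n , eq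

  at-map : ∀ (f : ℕ → ℕ) xs {k} → k < length xs → at (map f xs) k ≡ f (at xs k)
  at-map f (x ∷ xs) {zero}  _         = refl
  at-map f (x ∷ xs) {suc k} (s≤s k<n) = at-map f xs k<n

  at-applyUpTo : ∀ (f : ℕ → ℕ) n {k} → k < n → at (applyUpTo f n) k ≡ f k
  at-applyUpTo f (suc n) {zero}  _         = refl
  at-applyUpTo f (suc n) {suc k} (s≤s k<n) = at-applyUpTo (f ∘ suc) n k<n

  at-map-upTo : ∀ (f : ℕ → ℕ) n {k} → k < n → at (map f (upTo n)) k ≡ f k
  at-map-upTo f n k<n = trans (cong (λ l → at l _) (map-upTo f n)) (at-applyUpTo f n k<n)

  length-map-upTo : ∀ (f : ℕ → ℕ) n → length (map f (upTo n)) ≡ n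
  length-map-upTo f n = trans (cong length (map-upTo f n)) (length-applyUpTo f n)

  Desc-at : ∀ {xs} → Desc xs → ∀ {i j} → i < j → j < length xs → at xs j < at xs i
  Desc-at {x ∷ xs} (x> ∷ d) {zero}  {suc j} _         (s≤s j<n) = All.lookup x> (at-∈ xs j<n)
  Desc-at {x ∷ xs} (x> ∷ d) {suc i} {suc j} (s≤s i<j) (s≤s j<n) = Desc-at d i<j j<n

  -- Determinants

  par : ℕ → Bool
  par zero    = false
  par (suc n) = not (par n)

  par-+ : ∀ m n → par (m + n) ≡ par m xor par n
  par-+ zero    n = refl
  par-+ (suc m) n = trans (cong not (par-+ m n)) (not-distribˡ-xor (par m) (par n))

  par-double : ∀ e u → par (e + (u + u)) ≡ par e
  par-double e u = trans (par-+ e (u + u)) (trans (cong (par e xor_) (trans (par-+ u u) (xor-same (par u)))) (xor-identityʳ (par e)))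

  isEven-par : ∀ n → isEven n ≡ not (par n)
  isEven-par zero          = refl
  isEven-par (suc zero)    = refl
  isEven-par (suc (suc n)) = trans (isEven-par n) (cong not (sym (not-involutive (par n))))

  -- ℕ-indexed versions of Fin.punchIn and Fin.punchOut; punchDown j j is junk.
  punch : ℕ → ℕ → ℕ
  punch zero    b       = suc b
  punch (suc j) zero    = zero
  punch (suc j) (suc b) = suc (punch j b)

  punchDown : ℕ → ℕ → ℕ
  punchDown zero    zero    = zero
  punchDown zero    (suc c) = c
  punchDown (suc j) zero    = zero
  punchDown (suc j) (suc c) = suc (punchDown j c)

  toℕ-punchIn : ∀ {n} (j : Fin (suc n)) b → toℕ (punchIn j b) ≡ punch (toℕ j) (toℕ b)
  toℕ-punchIn Fin.zero    b           = refl
  toℕ-punchIn (Fin.suc j) Fin.zero    = refl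
  toℕ-punchIn (Fin.suc j) (Fin.suc b) = cong suc (toℕ-punchIn j b)

  punch-≢ : ∀ j b → j ≢ punch j b
  punch-≢ zero    b       ()
  punch-≢ (suc j) zero    ()
  punch-≢ (suc j) (suc b) eq = punch-≢ j b (suc-injective eq)

  punch-injective : ∀ j {a b} → punch j a ≡ punch j b → a ≡ b
  punch-injective zero                    eq = suc-injective eq
  punch-injective (suc j) {zero}  {zero}  eq = refl
  punch-injective (suc j) {suc a} {suc b} eq = cong suc (punch-injective j (suc-injective eq))

  punch-< : ∀ j {b n} → b < n → punch j b < suc n
  punch-< zero              b<n       = s≤s b<n
  punch-< (suc j) {zero}    b<n       = s≤s z≤n
  punch-< (suc j) {suc b} {suc n} (s≤s b<n) = s≤s (punch-< j b<n)

  punchDown-≡ᵇ : ∀ j c b → j ≢ c → (c ≡ᵇ punch j b) ≡ (punchDown j c ≡ᵇ b)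
  punchDown-≡ᵇ zero    zero    b       j≢c = ⊥-elim (j≢c refl)
  punchDown-≡ᵇ zero    (suc c) b       j≢c = refl
  punchDown-≡ᵇ (suc j) zero    zero    j≢c = refl
  punchDown-≡ᵇ (suc j) zero    (suc b) j≢c = refl
  punchDown-≡ᵇ (suc j) (suc c) zero    j≢c = refl
  punchDown-≡ᵇ (suc j) (suc c) (suc b) j≢c = punchDown-≡ᵇ j c b (j≢c ∘ cong suc)

  punchDown-<ᵇ : ∀ j c d → j ≢ c → j ≢ d → (punchDown j c <ᵇ punchDown j d) ≡ (c <ᵇ d)
  punchDown-<ᵇ zero    zero    d       j≢c j≢d = ⊥-elim (j≢c refl)
  punchDown-<ᵇ zero    (suc c) zero    j≢c j≢d = ⊥-elim (j≢d refl)
  punchDown-<ᵇ zero    (suc c) (suc d) j≢c j≢d = refl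
  punchDown-<ᵇ (suc j) zero    zero    j≢c j≢d = refl
  punchDown-<ᵇ (suc j) zero    (suc d) j≢c j≢d = refl
  punchDown-<ᵇ (suc j) (suc c) zero    j≢c j≢d = refl
  punchDown-<ᵇ (suc j) (suc c) (suc d) j≢c j≢d = punchDown-<ᵇ j c d (j≢c ∘ cong suc) (j≢d ∘ cong suc)

  -- Permutations as lists, and adjacent transpositions

  inversions-map : ∀ (f : ℕ → ℕ) xs → (∀ {x y} → x ∈ xs → y ∈ xs → (f y <ᵇ f x) ≡ (y <ᵇ x)) →
    inversions (map f xs) ≡ inversions xs
  inversions-map f []       h = refl
  inversions-map f (x ∷ xs) h = cong₂ _+_
    (trans (count-map (_<ᵇ f x) f xs) (count-cong xs (λ y∈ → h (here refl) (there y∈))))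
    (inversions-map f xs (λ x∈ y∈ → h (there x∈) (there y∈)))

  IsPerm : ℕ → List ℕ → Set
  IsPerm n xs = length xs ≡ n × (∀ c → c < n → countᵇ (_≡ᵇ c) xs ≡ 1)

  -- The values below `n` already account for `n` entries, which is the whole length; a larger entry
  -- would be one too many.
  IsPerm-< : ∀ {n xs} → IsPerm n xs → ∀ {x} → x ∈ xs → x < n
  IsPerm-< {n} {xs} (len≡ , cnt) {x} x∈ with lt-case x n
  ... | inj₁ (x<n , _) = x<n
  ... | inj₂ (n≤x , eq) = ⊥-elim (<-irrefl total bound)
    where
    open ≡-Reasoning
    total : countᵇ (_<ᵇ n) xs ≡ n
    total = begin
      countᵇ (_<ᵇ n) xs  ≡⟨ count-<-∑ id n xs ⟩
      ∑ n (λ c → countᵇ (_≡ᵇ c) xs)     ≡⟨ ∑-cong n cnt ⟩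
      ∑ n (λ _ → 1)  ≡⟨ ∑-const n 1 ⟩
      n * 1  ≡⟨ *-identityʳ n ⟩
      n ∎
    split : length xs ≡ countᵇ (_<ᵇ n) xs + countᵇ (λ y → not (y <ᵇ n)) xs
    split = trans (sym (count-all {λ _ → true} xs (λ _ → refl))) (count-+ xs (λ {y} _ → two (y <ᵇ n)))
      where
      two : ∀ p → 1 ≡ ind p + ind (not p)
      two true  = refl
      two false = refl
    bound : suc (countᵇ (_<ᵇ n) xs) ≤ n
    bound = ≤-trans (≤-reflexive (+-comm 1 _))
      (≤-trans (+-monoʳ-≤ _ (∃-count {λ y → not (y <ᵇ n)} xs x∈ (cong not eq))) (≤-reflexive (trans (sym split) len≡)))

  -- The transposition of `c` and `c + 1`, defined by recursion instead of comparison so that it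
  -- commutes with `punch` clause by clause.
  swap : ℕ → ℕ → ℕ
  swap zero    zero          = 1
  swap zero    (suc zero)    = 0
  swap zero    (suc (suc j)) = suc (suc j)
  swap (suc c) zero          = zero
  swap (suc c) (suc j)       = suc (swap c j)

  swap-left : ∀ c → swap c c ≡ suc c
  swap-left zero    = refl
  swap-left (suc c) = cong suc (swap-left c)

  swap-right : ∀ c → swap c (suc c) ≡ c
  swap-right zero    = refl
  swap-right (suc c) = cong suc (swap-right c)

  swap-below : ∀ c {j} → j < c → swap c j ≡ j
  swap-below (suc c) {zero}  _         = refl
  swap-below (suc c) {suc j} (s≤s j<c) = cong suc (swap-below c j<c)

  swap-above : ∀ c {j} → suc c < j → swap c j ≡ j
  swap-above zero    {suc (suc j)} _         = refl
  swap-above zero    {suc zero}    (s≤s ())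
  swap-above (suc c) {suc j}       (s≤s c<j) = cong suc (swap-above c c<j)

  -- This and the next three facts describe the minors after two columns are exchanged: the minors
  -- at `c` and `c + 1` trade places, and for any other deleted column the exchange survives in the
  -- minor, one place lower if that column was to the left.
  swap-punch-left : ∀ c b → swap c (punch c b) ≡ punch (suc c) b
  swap-punch-left zero    zero    = refl
  swap-punch-left zero    (suc b) = refl
  swap-punch-left (suc c) zero    = refl
  swap-punch-left (suc c) (suc b) = cong suc (swap-punch-left c b)

  swap-punch-right : ∀ c b → swap c (punch (suc c) b) ≡ punch c b
  swap-punch-right zero    zero    = refl
  swap-punch-right zero    (suc b) = refl
  swap-punch-right (suc c) zero    = refl
  swap-punch-right (suc c) (suc b) = cong suc (swap-punch-right c b)

  swap-punch-above : ∀ c {j} b → suc c < j → swap c (punch j b) ≡ punch j (swap c b)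
  swap-punch-above zero    {suc (suc j)} zero          _         = refl
  swap-punch-above zero    {suc (suc j)} (suc zero)    _         = refl
  swap-punch-above zero    {suc (suc j)} (suc (suc b)) _         = refl
  swap-punch-above zero    {suc zero}    b             (s≤s ())
  swap-punch-above (suc c) {suc j}       zero          _         = refl
  swap-punch-above (suc c) {suc j}       (suc b)       (s≤s c<j) = cong suc (swap-punch-above c b c<j)

  swap-punch-below : ∀ c {j} b → j ≤ c → swap (suc c) (punch j b) ≡ punch j (swap c b)
  swap-punch-below c       {zero}  b       _         = refl
  swap-punch-below (suc c) {suc j} zero    _         = refl
  swap-punch-below (suc c) {suc j} (suc b) (s≤s j≤c) = cong suc (swap-punch-below c b j≤c)

  module RingNames {c ℓ : Level} (R : CommutativeRing c ℓ) where
    open CommutativeRing R public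
      using (Carrier; _≈_; 0#; 1#; -_; setoid; ring; zeroˡ; zeroʳ; distribˡ; distribʳ; -‿cong; -‿inverseˡ; -‿inverseʳ; reflexive)
      renaming ( _+_ to _+ᴿ_; _*_ to _*ᴿ_; refl to ≈-refl; sym to ≈-sym; trans to ≈-trans
               ; +-assoc to +-assocᴿ; +-comm to +-commᴿ; +-identityˡ to +-identityˡᴿ; +-identityʳ to +-identityʳᴿ; +-cong to +-congᴿ
               ; *-assoc to *-assocᴿ; *-comm to *-commᴿ; *-identityˡ to *-identityˡᴿ; *-identityʳ to *-identityʳᴿ; *-cong to *-congᴿ )
    open RingProperties ring public using (-‿distribˡ-*; -‿distribʳ-*; -‿involutive; -0#≈0#; -‿+-comm)

  module Determinant {c ℓ : Level} (R : CommutativeRing c ℓ) where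
    open RingNames R
    open RingDefs R
    open import Relation.Binary.Reasoning.Setoid setoid

    infixr 8 _⟨*⟩_
    infixr 7 _⟨+⟩_

    _⟨*⟩_ : ∀ {a b x y} → a ≈ b → x ≈ y → a *ᴿ x ≈ b *ᴿ y
    _⟨*⟩_ = *-congᴿ

    _⟨+⟩_ : ∀ {a b x y} → a ≈ b → x ≈ y → a +ᴿ x ≈ b +ᴿ y
    _⟨+⟩_ = +-congᴿ

    sg : Bool → Carrier
    sg false = 1#
    sg true  = - 1#

    signN-sg : ∀ n → signN n ≡ sg (par n)
    signN-sg n rewrite isEven-par n with par n
    ... | true  = refl
    ... | false = refl

    sg-not : ∀ p → sg (not p) ≈ - sg p
    sg-not true  = ≈-sym (-‿involutive 1#)
    sg-not false = ≈-refl

    sg-xor : ∀ p q → sg (p xor q) ≈ sg p *ᴿ sg q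
    sg-xor false q = ≈-sym (*-identityˡᴿ _)
    sg-xor true  q = begin
      sg (not q)        ≈⟨ sg-not q ⟩
      - sg q  ≈⟨ -‿cong (≈-sym (*-identityˡᴿ _)) ⟩
      - (1# *ᴿ sg q)    ≈⟨ -‿distribˡ-* 1# (sg q) ⟩
      - 1# *ᴿ sg q      ∎

    sum-cong : ∀ n {f g : ℕ → Carrier} → (∀ i → i < n → f i ≈ g i) → sumℕ n f ≈ sumℕ n g
    sum-cong zero    h = ≈-refl
    sum-cong (suc n) h = h 0 (s≤s z≤n) ⟨+⟩ sum-cong n (λ i i<n → h (suc i) (s≤s i<n))

    sum-zero : ∀ n {f : ℕ → Carrier} → (∀ i → i < n → f i ≈ 0#) → sumℕ n f ≈ 0#
    sum-zero zero    h = ≈-refl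
    sum-zero (suc n) h = ≈-trans (h 0 (s≤s z≤n) ⟨+⟩ sum-zero n (λ i i<n → h (suc i) (s≤s i<n))) (+-identityˡᴿ 0#)

    interchange : ∀ a b x y → (a +ᴿ b) +ᴿ (x +ᴿ y) ≈ (a +ᴿ x) +ᴿ (b +ᴿ y)
    interchange a b x y = begin
      (a +ᴿ b) +ᴿ (x +ᴿ y)   ≈⟨ +-assocᴿ a b _ ⟩
      a +ᴿ (b +ᴿ (x +ᴿ y))   ≈⟨ ≈-refl ⟨+⟩ ≈-sym (+-assocᴿ b x y) ⟩
      a +ᴿ ((b +ᴿ x) +ᴿ y)   ≈⟨ ≈-refl ⟨+⟩ (+-commᴿ b x ⟨+⟩ ≈-refl) ⟩
      a +ᴿ ((x +ᴿ b) +ᴿ y)   ≈⟨ ≈-refl ⟨+⟩ +-assocᴿ x b y ⟩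
      a +ᴿ (x +ᴿ (b +ᴿ y))   ≈⟨ ≈-sym (+-assocᴿ a x _) ⟩
      (a +ᴿ x) +ᴿ (b +ᴿ y)   ∎

    sum-linear : ∀ n a b (f g : ℕ → Carrier) →
      sumℕ n (λ i → a *ᴿ f i +ᴿ b *ᴿ g i) ≈ a *ᴿ sumℕ n f +ᴿ b *ᴿ sumℕ n g
    sum-linear zero    a b f g = ≈-sym (≈-trans (zeroʳ a ⟨+⟩ zeroʳ b) (+-identityˡᴿ 0#))
    sum-linear (suc n) a b f g = begin
      (a *ᴿ f 0 +ᴿ b *ᴿ g 0) +ᴿ sumℕ n (λ i → a *ᴿ f (suc i) +ᴿ b *ᴿ g (suc i))
        ≈⟨ ≈-refl ⟨+⟩ sum-linear n a b (f ∘ suc) (g ∘ suc) ⟩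
      (a *ᴿ f 0 +ᴿ b *ᴿ g 0) +ᴿ (a *ᴿ sumℕ n (f ∘ suc) +ᴿ b *ᴿ sumℕ n (g ∘ suc))
        ≈⟨ interchange _ _ _ _ ⟩
      (a *ᴿ f 0 +ᴿ a *ᴿ sumℕ n (f ∘ suc)) +ᴿ (b *ᴿ g 0 +ᴿ b *ᴿ sumℕ n (g ∘ suc))
        ≈⟨ ≈-sym (distribˡ a _ _) ⟨+⟩ ≈-sym (distribˡ b _ _) ⟩
      a *ᴿ (f 0 +ᴿ sumℕ n (f ∘ suc)) +ᴿ b *ᴿ (g 0 +ᴿ sumℕ n (g ∘ suc)) ∎

    sum-neg : ∀ n (f : ℕ → Carrier) → sumℕ n (λ i → - f i) ≈ - sumℕ n f
    sum-neg zero    f = ≈-sym -0#≈0#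
    sum-neg (suc n) f = ≈-trans (≈-refl ⟨+⟩ sum-neg n (f ∘ suc)) (-‿+-comm _ _)

    sum-only : ∀ n {f : ℕ → Carrier} k → k < n → (∀ i → i < n → i ≢ k → f i ≈ 0#) → sumℕ n f ≈ f k
    sum-only (suc n) zero    _         h =
      ≈-trans (≈-refl ⟨+⟩ sum-zero n (λ i i<n → h (suc i) (s≤s i<n) λ ())) (+-identityʳᴿ _)
    sum-only (suc n) (suc k) (s≤s k<n) h =
      ≈-trans (h 0 (s≤s z≤n) (λ ()) ⟨+⟩ sum-only n k k<n (λ i i<n i≢k → h (suc i) (s≤s i<n) (i≢k ∘ suc-injective)))
              (+-identityˡᴿ _)

    sum-swap : ∀ c n (f : ℕ → Carrier) → suc c < n → sumℕ n (f ∘ swap c) ≈ sumℕ n f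
    sum-swap zero    (suc (suc n)) f _ = begin
      f 1 +ᴿ (f 0 +ᴿ rest)    ≈⟨ ≈-sym (+-assocᴿ _ _ _) ⟩
      (f 1 +ᴿ f 0) +ᴿ rest    ≈⟨ +-commᴿ _ _ ⟨+⟩ ≈-refl ⟩
      (f 0 +ᴿ f 1) +ᴿ rest    ≈⟨ +-assocᴿ _ _ _ ⟩
      f 0 +ᴿ (f 1 +ᴿ rest)    ∎
      where rest = sumℕ n (λ k → f (suc (suc k)))
    sum-swap zero    (suc zero)    f (s≤s ())
    sum-swap (suc c) (suc n)       f (s≤s c<n) = ≈-refl ⟨+⟩ sum-swap c n (f ∘ suc) c<n

    Matrix : Set c
    Matrix = ℕ → ℕ → Carrier

    minor : ℕ → Matrix → Matrix
    minor j M a b = M (suc a) (punch j b)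

    -- A copy of `det` for matrices indexed by all naturals, so that minors and row replacements
    -- involve no `Fin`. Entries outside the leading block do not matter, by `D-cong`.
    D : ℕ → Matrix → Carrier
    laplace : ℕ → Matrix → ℕ → Carrier
    D zero    M = 1#
    D (suc n) M = sumℕ (suc n) (laplace n M)
    laplace n M j = sg (par j) *ᴿ (M 0 j *ᴿ D n (minor j M))

    sumFin-sumℕ : ∀ n {f : Fin n → Carrier} {g : ℕ → Carrier} → (∀ i → f i ≈ g (toℕ i)) → sumFin f ≈ sumℕ n g
    sumFin-sumℕ zero    h = ≈-refl
    sumFin-sumℕ (suc n) h = h Fin.zero ⟨+⟩ sumFin-sumℕ n (λ i → h (Fin.suc i))

    det-D : ∀ n {M : Fin n → Fin n → Carrier} {M′ : Matrix} →
      (∀ i j → M i j ≈ M′ (toℕ i) (toℕ j)) → det M ≈ D n M′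
    det-D zero             h = ≈-refl
    det-D (suc n) {M} {M′} h = sumFin-sumℕ (suc n) {g = laplace n M′} λ j →
      reflexive (signN-sg (toℕ j)) ⟨*⟩ h Fin.zero j ⟨*⟩
      det-D n {M′ = minor (toℕ j) M′} (λ a b → ≈-trans (h (Fin.suc a) (punchIn j b)) (reflexive (cong (M′ (suc (toℕ a))) (toℕ-punchIn j b))))

    D-cong : ∀ n {M M′ : Matrix} → (∀ i j → i < n → j < n → M i j ≈ M′ i j) → D n M ≈ D n M′
    D-cong zero    h = ≈-refl
    D-cong (suc n) {M} {M′} h = sum-cong (suc n) {laplace n M} {laplace n M′} λ j j<n →
      ≈-refl ⟨*⟩ h 0 j (s≤s z≤n) j<n ⟨*⟩ D-cong n (λ a b a<n b<n → h (suc a) (punch j b) (s≤s a<n) (punch-< j b<n))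

    times-zero : ∀ s {x} m → x ≈ 0# → s *ᴿ (m *ᴿ x) ≈ 0#
    times-zero s m x≈0 = ≈-trans (≈-refl ⟨*⟩ ≈-trans (≈-refl ⟨*⟩ x≈0) (zeroʳ m)) (zeroʳ s)

    times-zeroˡ : ∀ s {m} x → m ≈ 0# → s *ᴿ (m *ᴿ x) ≈ 0#
    times-zeroˡ s x m≈0 = ≈-trans (≈-refl ⟨*⟩ ≈-trans (m≈0 ⟨*⟩ ≈-refl) (zeroˡ x)) (zeroʳ s)

    exchange : ∀ a b x → a *ᴿ (b *ᴿ x) ≈ b *ᴿ (a *ᴿ x)
    exchange a b x = ≈-trans (≈-sym (*-assocᴿ a b x)) (≈-trans (*-commᴿ a b ⟨*⟩ ≈-refl) (*-assocᴿ b a x))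

    -- For `i = 0` the expansion along the top row is visibly linear, since its minors omit that
    -- row; for larger `i` the minors themselves split by induction.
    D-row : ∀ n i (M M′ M″ : Matrix) a b → i < n →
      (∀ k j → k < n → j < n → k ≢ i → M k j ≈ M′ k j) →
      (∀ k j → k < n → j < n → k ≢ i → M k j ≈ M″ k j) →
      (∀ j → j < n → M i j ≈ a *ᴿ M′ i j +ᴿ b *ᴿ M″ i j) →
      D n M ≈ a *ᴿ D n M′ +ᴿ b *ᴿ D n M″
    D-row (suc n) i M M′ M″ a b i<n h′ h″ hi = ≈-trans (sum-cong (suc n) {Term M} (term i i<n h′ h″ hi)) (sum-linear (suc n) a b (Term M′) (Term M″))
      where
      Term = laplace n
      spread : ∀ s m x y z → m ≈ a *ᴿ y +ᴿ b *ᴿ z →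
        s *ᴿ (m *ᴿ x) ≈ a *ᴿ (s *ᴿ (y *ᴿ x)) +ᴿ b *ᴿ (s *ᴿ (z *ᴿ x))
      spread s m x y z eq = begin
        s *ᴿ (m *ᴿ x)  ≈⟨ ≈-refl ⟨*⟩ eq ⟨*⟩ ≈-refl ⟩
        s *ᴿ ((a *ᴿ y +ᴿ b *ᴿ z) *ᴿ x)  ≈⟨ ≈-refl ⟨*⟩ distribʳ x _ _ ⟩
        s *ᴿ ((a *ᴿ y) *ᴿ x +ᴿ (b *ᴿ z) *ᴿ x)  ≈⟨ distribˡ s _ _ ⟩
        s *ᴿ ((a *ᴿ y) *ᴿ x) +ᴿ s *ᴿ ((b *ᴿ z) *ᴿ x)  ≈⟨ (≈-refl ⟨*⟩ *-assocᴿ a y x) ⟨+⟩ (≈-refl ⟨*⟩ *-assocᴿ b z x) ⟩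
        s *ᴿ (a *ᴿ (y *ᴿ x)) +ᴿ s *ᴿ (b *ᴿ (z *ᴿ x))  ≈⟨ exchange s a _ ⟨+⟩ exchange s b _ ⟩
        a *ᴿ (s *ᴿ (y *ᴿ x)) +ᴿ b *ᴿ (s *ᴿ (z *ᴿ x))  ∎
      term : ∀ i → i < suc n →
        (∀ k j → k < suc n → j < suc n → k ≢ i → M k j ≈ M′ k j) →
        (∀ k j → k < suc n → j < suc n → k ≢ i → M k j ≈ M″ k j) →
        (∀ j → j < suc n → M i j ≈ a *ᴿ M′ i j +ᴿ b *ᴿ M″ i j) →
        ∀ j → j < suc n → Term M j ≈ a *ᴿ Term M′ j +ᴿ b *ᴿ Term M″ j
      term zero i<n h′ h″ hi j j<n = ≈-trans (spread (sg (par j)) _ (D n (minor j M)) _ _ (hi j j<n))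
        ((≈-refl ⟨*⟩ ≈-refl ⟨*⟩ ≈-refl ⟨*⟩ same {M′} h′) ⟨+⟩ (≈-refl ⟨*⟩ ≈-refl ⟨*⟩ ≈-refl ⟨*⟩ same {M″} h″))
        where
        same : ∀ {N} → (∀ k j → k < suc n → j < suc n → k ≢ 0 → M k j ≈ N k j) → D n (minor j M) ≈ D n (minor j N)
        same h = D-cong n (λ x y x<n y<n → h (suc x) (punch j y) (s≤s x<n) (punch-< j y<n) λ ())
      -- Here the factor that splits is the minor; once it is commuted in front of the entry,
      -- `spread` applies as in the other case.
      term (suc i) (s≤s i<n) h′ h″ hi j j<n = begin
        sg (par j) *ᴿ (M 0 j *ᴿ D n (minor j M))
          ≈⟨ ≈-refl ⟨*⟩ *-commᴿ _ _ ⟩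
        sg (par j) *ᴿ (D n (minor j M) *ᴿ M 0 j)
          ≈⟨ spread (sg (par j)) _ (M 0 j) _ _
               (D-row n i (minor j M) (minor j M′) (minor j M″) a b i<n (lower {M′} h′) (lower {M″} h″)
                 (λ y y<n → hi (punch j y) (punch-< j y<n))) ⟩
        a *ᴿ (sg (par j) *ᴿ (D n (minor j M′) *ᴿ M 0 j)) +ᴿ b *ᴿ (sg (par j) *ᴿ (D n (minor j M″) *ᴿ M 0 j))
          ≈⟨ (≈-refl ⟨*⟩ ≈-refl ⟨*⟩ ≈-trans (*-commᴿ _ _) (top {M′} h′ ⟨*⟩ ≈-refl)) ⟨+⟩
             (≈-refl ⟨*⟩ ≈-refl ⟨*⟩ ≈-trans (*-commᴿ _ _) (top {M″} h″ ⟨*⟩ ≈-refl)) ⟩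
        a *ᴿ Term M′ j +ᴿ b *ᴿ Term M″ j ∎
        where
        lower : ∀ {N} → (∀ k j → k < suc n → j < suc n → k ≢ suc i → M k j ≈ N k j) →
          ∀ k y → k < n → y < n → k ≢ i → minor j M k y ≈ minor j N k y
        lower h k y k<n y<n k≢i = h (suc k) (punch j y) (s≤s k<n) (punch-< j y<n) (k≢i ∘ suc-injective)
        top : ∀ {N} → (∀ k j → k < suc n → j < suc n → k ≢ suc i → M k j ≈ N k j) → M 0 j ≈ N 0 j
        top h = h 0 j (s≤s z≤n) j<n λ ()

    D-zero-row : ∀ n i (M : Matrix) → i < n → (∀ j → j < n → M i j ≈ 0#) → D n M ≈ 0#
    D-zero-row n i M i<n h = ≈-trans
      (D-row n i M M M 0# 0# i<n (λ _ _ _ _ _ → ≈-refl) (λ _ _ _ _ _ → ≈-refl)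
        (λ j j<n → ≈-trans (h j j<n) (≈-sym (≈-trans (zeroˡ _ ⟨+⟩ zeroˡ _) (+-identityˡᴿ 0#)))))
      (≈-trans (zeroˡ _ ⟨+⟩ zeroˡ _) (+-identityˡᴿ 0#))

    δ : ℕ → ℕ → Carrier
    δ x y = if x ≡ᵇ y then 1# else 0#

    δ-≡ : ∀ x → δ x x ≈ 1#
    δ-≡ x rewrite ≡ᵇ-refl x = ≈-refl

    δ-≢ : ∀ {x y} → x ≢ y → δ x y ≈ 0#
    δ-≢ x≢y rewrite ≡ᵇ-false x≢y = ≈-refl

    δ-punch : ∀ j c b → j ≢ c → δ c (punch j b) ≈ δ (punchDown j c) b
    δ-punch j c b j≢c rewrite punchDown-≡ᵇ j c b j≢c = ≈-refl

    -- Deleting column `c` leaves a zero row, and deleting any other column leaves either a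
    -- vanishing coefficient or two equal unit rows again. For unit vectors this replaces the
    -- alternating property of rows and involves no division by 2.
    D-two-units : ∀ n i k c (M : Matrix) → i < n → k < n → i ≢ k →
      (∀ j → j < n → M i j ≈ δ c j) → (∀ j → j < n → M k j ≈ δ c j) → D n M ≈ 0#
    D-two-units (suc n) i k c M i<n k<n i≢k hi hk = sum-zero (suc n) {laplace n M} (term i k i<n k<n i≢k hi hk)
      where
      vanish : ∀ i j → i < n → (∀ j → j < suc n → M (suc i) j ≈ δ c j) → j ≡ c → D n (minor j M) ≈ 0#
      vanish i j i<n h refl = D-zero-row n i (minor j M) i<n
        (λ b b<n → ≈-trans (h (punch j b) (punch-< j b<n)) (δ-≢ (punch-≢ j b)))
      term : ∀ i k → i < suc n → k < suc n → i ≢ k →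
        (∀ j → j < suc n → M i j ≈ δ c j) → (∀ j → j < suc n → M k j ≈ δ c j) →
        ∀ j → j < suc n → sg (par j) *ᴿ (M 0 j *ᴿ D n (minor j M)) ≈ 0#
      term zero    zero    i<n       k<n       i≢k hi hk j j<n = ⊥-elim (i≢k refl)
      term zero    (suc k) i<n       (s≤s k<n) i≢k hi hk j j<n with j ≟ c
      ... | yes j≡c = times-zero _ _ (vanish k j k<n hk j≡c)
      ... | no  j≢c = times-zeroˡ _ _ (≈-trans (hi j j<n) (δ-≢ (j≢c ∘ sym)))
      term (suc i) zero    (s≤s i<n) k<n       i≢k hi hk j j<n with j ≟ c
      ... | yes j≡c = times-zero _ _ (vanish i j i<n hi j≡c)
      ... | no  j≢c = times-zeroˡ _ _ (≈-trans (hk j j<n) (δ-≢ (j≢c ∘ sym)))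
      term (suc i) (suc k) (s≤s i<n) (s≤s k<n) i≢k hi hk j j<n with j ≟ c
      ... | yes j≡c = times-zero _ _ (vanish i j i<n hi j≡c)
      ... | no  j≢c = times-zero _ _ (D-two-units n i k (punchDown j c) (minor j M) i<n k<n (i≢k ∘ cong suc)
        (λ b b<n → ≈-trans (hi (punch j b) (punch-< j b<n)) (δ-punch j c b j≢c))
        (λ b b<n → ≈-trans (hk (punch j b) (punch-< j b<n)) (δ-punch j c b j≢c)))

    -- Only column `x` survives in the top row. Its sign is right because every value below `x`
    -- occurs exactly once in `xs`, so `x` is also the number of inversions that the first entry
    -- starts.
    D-perm : ∀ n xs → IsPerm n xs → D n (λ k j → δ (at xs k) j) ≈ sg (par (inversions xs))
    D-perm zero    []       _ = ≈-refl
    D-perm (suc n) (x ∷ xs) perm@(len≡ , cnt) = begin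
      D (suc n) (λ k j → δ (at (x ∷ xs) k) j)
        ≈⟨ sum-only (suc n) {laplace n (λ k j → δ (at (x ∷ xs) k) j)} x x<n (λ j _ j≢x → times-zeroˡ (sg (par j)) _ (δ-≢ (j≢x ∘ sym))) ⟩
      sg (par x) *ᴿ (δ x x *ᴿ D n (λ a b → δ (at xs a) (punch x b)))
        ≈⟨ ≈-refl ⟨*⟩ ≈-trans (δ-≡ x ⟨*⟩ ≈-refl) (*-identityˡᴿ _) ⟩
      sg (par x) *ᴿ D n (λ a b → δ (at xs a) (punch x b))
        ≈⟨ ≈-refl ⟨*⟩ D-cong n (λ a b a<n b<n → ≈-trans (δ-punch x _ b (x∉ (at-∈ xs (a<len a<n))))
             (reflexive (cong (λ y → δ y b) (sym (at-map (punchDown x) xs (a<len a<n)))))) ⟩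
      sg (par x) *ᴿ D n (λ a b → δ (at xs′ a) b)
        ≈⟨ ≈-refl ⟨*⟩ D-perm n xs′ perm′ ⟩
      sg (par x) *ᴿ sg (par (inversions xs′))
        ≈⟨ ≈-sym (sg-xor (par x) _) ⟩
      sg (par x xor par (inversions xs′))
        ≡⟨ cong sg (sym (par-+ x _)) ⟩
      sg (par (x + inversions xs′))
        ≡⟨ cong (sg ∘ par) (cong₂ _+_ (sym below) (inversions-map (punchDown x) xs
             (λ {y} {z} y∈ z∈ → punchDown-<ᵇ x z y (x∉ z∈) (x∉ y∈)))) ⟩
      sg (par (inversions (x ∷ xs))) ∎
      where
      xs′ = map (punchDown x) xs
      x<n : x < suc n
      x<n = IsPerm-< perm (here refl)
      a<len : ∀ {a} → a < n → a < length xs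
      a<len a<n = subst (_ <_) (sym (suc-injective len≡)) a<n
      cnt-other : ∀ c → c < suc n → x ≢ c → countᵇ (_≡ᵇ c) xs ≡ 1
      cnt-other c c<n x≢c = trans (cong (λ p → ind p + countᵇ (_≡ᵇ c) xs) (sym (≡ᵇ-false x≢c)))
        (trans (sym (count-∷ (_≡ᵇ c) x xs)) (cnt c c<n))
      cnt-x : countᵇ (_≡ᵇ x) xs ≡ 0
      cnt-x = suc-injective (trans (cong (λ p → ind p + countᵇ (_≡ᵇ x) xs) (sym (≡ᵇ-refl x)))
        (trans (sym (count-∷ (_≡ᵇ x) x xs)) (cnt x x<n)))
      x∉ : ∀ {y} → y ∈ xs → x ≢ y
      x∉ y∈ x≡y = <-irrefl (sym cnt-x) (∃-count xs y∈ (≡ᵇ-true (sym x≡y)))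
      below : countᵇ (_<ᵇ x) xs ≡ x
      below = trans (count-<-∑ id x xs)
        (trans (∑-cong x (λ c c<x → cnt-other c (<-trans c<x x<n) (<⇒≢ c<x ∘ sym)))
          (trans (∑-const x 1) (*-identityʳ x)))
      perm′ : IsPerm n xs′
      perm′ = trans (length-map _ xs) (suc-injective len≡) , λ c c<n →
        trans (count-map (_≡ᵇ c) (punchDown x) xs)
          (trans (count-cong xs (λ {y} y∈ → sym (punchDown-≡ᵇ x y c (x∉ y∈))))
            (cnt-other (punch x c) (punch-< x c<n) (punch-≢ x c)))

    -- The contrapositive of the Leibniz formula: a surviving term would be an injective assignment
    -- inside the support. The support is a Boolean bound `S`, because whether an entry is zero may
    -- be undecidable.
    D-support : ∀ n (S : ℕ → ℕ → Bool) (M : Matrix) →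
      (∀ i j → i < n → j < n → S i j ≡ false → M i j ≈ 0#) →
      (∀ (φ : ℕ → ℕ) → (∀ i → i < n → φ i < n) → (∀ i k → i < n → k < n → φ i ≡ φ k → i ≡ k) →
        (∀ i → i < n → S i (φ i) ≡ true) → ⊥) →
      D n M ≈ 0#
    -- The empty assignment always exists, so the hypothesis is absurd here.
    D-support zero    S M hS none = ⊥-elim (none id (λ _ ()) (λ _ _ ()) (λ _ ()))
    D-support (suc n) S M hS none = sum-zero (suc n) {laplace n M} term
      where
      term : ∀ j → j < suc n → sg (par j) *ᴿ (M 0 j *ᴿ D n (minor j M)) ≈ 0#
      term j j<n with S 0 j in eq
      ... | false = times-zeroˡ _ _ (hS 0 j (s≤s z≤n) j<n eq)
      ... | true  = times-zero _ _ (D-support n (λ a b → S (suc a) (punch j b)) (minor j M)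
        (λ a b a<n b<n → hS (suc a) (punch j b) (s≤s a<n) (punch-< j b<n))
        λ φ φ< inj supp → none (extend φ)
          (λ { zero _ → j<n ; (suc i) (s≤s i<n) → punch-< j (φ< i i<n) })
          (λ { zero    zero    _         _         _  → refl
             ; zero    (suc k) _         _         eq → ⊥-elim (punch-≢ j _ eq)
             ; (suc i) zero    _         _         eq → ⊥-elim (punch-≢ j _ (sym eq))
             ; (suc i) (suc k) (s≤s i<n) (s≤s k<n) eq → cong suc (inj i k i<n k<n (punch-injective j eq)) })
          (λ { zero _ → eq ; (suc i) (s≤s i<n) → supp i i<n }))
        where
        extend : (ℕ → ℕ) → ℕ → ℕ
        extend φ zero    = j
        extend φ (suc i) = punch j (φ i)

    -- The terms for `c` and `c + 1` trade places and change sign through the parity of the column;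
    -- every other term changes sign through its minor, by induction.
    D-swap : ∀ n c (M : Matrix) → suc c < n → D n (λ i j → M i (swap c j)) ≈ - D n M
    D-swap (suc n) c M (s≤s c<n) = begin
      sumℕ (suc n) (λ j → sg (par j) *ᴿ (M 0 (swap c j) *ᴿ D n (λ a b → M (suc a) (swap c (punch j b)))))
        ≈⟨ sum-cong (suc n) term ⟩
      sumℕ (suc n) (λ j → - Term (swap c j))   ≈⟨ sum-neg (suc n) (Term ∘ swap c) ⟩
      - sumℕ (suc n) (Term ∘ swap c)  ≈⟨ -‿cong (sum-swap c (suc n) Term (s≤s c<n)) ⟩
      - sumℕ (suc n) Term  ∎
      where
      Term = laplace n M
      neg-sign : ∀ p q x → sg p ≈ - sg q → sg p *ᴿ x ≈ - (sg q *ᴿ x)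
      neg-sign p q x eq = ≈-trans (eq ⟨*⟩ ≈-refl) (≈-sym (-‿distribˡ-* _ _))
      neg-minor : ∀ s m {x y} → x ≈ - y → s *ᴿ (m *ᴿ x) ≈ - (s *ᴿ (m *ᴿ y))
      neg-minor s m eq = ≈-trans (≈-refl ⟨*⟩ ≈-trans (≈-refl ⟨*⟩ eq) (≈-sym (-‿distribʳ-* _ _))) (≈-sym (-‿distribʳ-* _ _))
      fixed : ∀ j → swap c j ≡ j → D n (λ a b → M (suc a) (swap c (punch j b))) ≈ - D n (minor j M) →
        sg (par j) *ᴿ (M 0 (swap c j) *ᴿ D n (λ a b → M (suc a) (swap c (punch j b)))) ≈ - Term (swap c j)
      fixed j eq h rewrite eq = neg-minor _ _ h
      below : ∀ c j → j < c → c < n → D n (λ a b → M (suc a) (swap c (punch j b))) ≈ - D n (minor j M)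
      below (suc c) j (s≤s j≤c) c<n = ≈-trans
        (D-cong n (λ a b _ _ → reflexive (cong (M (suc a)) (swap-punch-below c b j≤c))))
        (D-swap n c (minor j M) c<n)
      term : ∀ j → j < suc n →
        sg (par j) *ᴿ (M 0 (swap c j) *ᴿ D n (λ a b → M (suc a) (swap c (punch j b)))) ≈ - Term (swap c j)
      term j j<n with <-cmp j c
      ... | tri< j<c _ _ = fixed j (swap-below c j<c) (below c j j<c c<n)
      ... | tri≈ _ refl _ rewrite swap-left c = ≈-trans
        (≈-refl ⟨*⟩ ≈-refl ⟨*⟩ D-cong n (λ a b _ _ → reflexive (cong (M (suc a)) (swap-punch-left c b))))
        (neg-sign (par c) (par (suc c)) _ (≈-sym (≈-trans (-‿cong (sg-not (par c))) (-‿involutive _))))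
      ... | tri> _ _ c<j with j ≟ suc c
      ...   | yes refl rewrite swap-right c = ≈-trans
        (≈-refl ⟨*⟩ ≈-refl ⟨*⟩ D-cong n (λ a b _ _ → reflexive (cong (M (suc a)) (swap-punch-right c b))))
        (neg-sign (par (suc c)) (par c) _ (sg-not (par c)))
      ...   | no j≢1+c = fixed j (swap-above c 1+c<j) (≈-trans
        (D-cong n (λ a b _ _ → reflexive (cong (M (suc a)) (swap-punch-above c b 1+c<j))))
        (D-swap n c (minor j M) (<-≤-trans 1+c<j (≤-pred j<n))))
        where
        1+c<j : suc c < j
        1+c<j = ≤∧≢⇒< c<j (j≢1+c ∘ sym)

    -- The right-hand column is moved left by adjacent exchanges. Once the two are neighbours,
    -- exchanging them changes nothing, so the determinant is its own negative; hence the assumption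
    -- that 2 is not a zero divisor.
    D-equal-columns : (∀ x → x +ᴿ x ≈ 0# → x ≈ 0#) → ∀ n x y (M : Matrix) → x < y → y < n →
      (∀ i → i < n → M i x ≈ M i y) → D n M ≈ 0#
    D-equal-columns halve n x (suc y) M (s≤s x≤y) y<n h with x ≟ y
    ... | yes refl = halve _ (≈-trans (≈-refl ⟨+⟩ ≈-trans (D-cong n same) (D-swap n x M y<n)) (-‿inverseʳ _))
      where
      same : ∀ i j → i < n → j < n → M i j ≈ M i (swap x j)
      same i j i<n j<n with <-cmp j x
      ... | tri< j<x _ _ rewrite swap-below x j<x = ≈-refl
      ... | tri≈ _ refl _ rewrite swap-left x = h i i<n
      ... | tri> _ _ x<j with j ≟ suc x
      ...   | yes refl rewrite swap-right x = ≈-sym (h i i<n)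
      ...   | no j≢ rewrite swap-above x (≤∧≢⇒< x<j (j≢ ∘ sym)) = ≈-refl
    ... | no x≢y = begin
      D n M  ≈⟨ ≈-sym (-‿involutive _) ⟩
      - (- D n M)  ≈⟨ -‿cong (≈-sym (D-swap n y M y<n)) ⟩
      - D n (λ i j → M i (swap y j))      ≈⟨ -‿cong (D-equal-columns halve n x y _ x<y (<-trans (n<1+n y) y<n) same) ⟩
      - 0#  ≈⟨ -0#≈0# ⟩
      0#  ∎
      where
      x<y : x < y
      x<y = ≤∧≢⇒< x≤y x≢y
      same : ∀ i → i < n → M i (swap y x) ≈ M i (swap y y)
      same i i<n rewrite swap-below y x<y | swap-left y = h i i<n

  -- Complete homogeneous polynomials of the roots of unity

  module Homogeneous {c ℓ : Level} (R : CommutativeRing c ℓ) where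
    open RingNames R
    open RingDefs R
    open Determinant R
    open import Relation.Binary.Reasoning.Setoid setoid
    open SemiringSolver (CommutativeRing.commutativeSemiring R) using (solve; _:=_; _:+_; _:*_; con)

    -- Multiplication of the power series f by 1 + w q.
    step : Carrier → (ℕ → Carrier) → ℕ → Carrier
    step w f zero    = f 0
    step w f (suc k) = f (suc k) +ᴿ w *ᴿ f k

    step-cong : ∀ {w w′} {f g : ℕ → Carrier} → w ≈ w′ → (∀ k → f k ≈ g k) → ∀ k → step w f k ≈ step w′ g k
    step-cong w≈ f≈ zero    = f≈ 0
    step-cong w≈ f≈ (suc k) = f≈ (suc k) ⟨+⟩ w≈ ⟨*⟩ f≈ k

    step-comm : ∀ v w f k → step v (step w f) k ≈ step w (step v f) k
    step-comm v w f zero          = ≈-refl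
    step-comm v w f (suc zero)    =
      solve 4 (λ v w a b → (a :+ w :* b) :+ v :* b := (a :+ v :* b) :+ w :* b) ≈-refl v w (f 1) (f 0)
    step-comm v w f (suc (suc k)) =
      solve 5 (λ v w a b c → (a :+ w :* b) :+ v :* (b :+ w :* c) := (a :+ v :* b) :+ w :* (b :+ v :* c)) ≈-refl
        v w (f (suc (suc k))) (f (suc k)) (f k)

    -- Coefficients of ∏ (1 − z q) over z in Z.
    elem : List Carrier → ℕ → Carrier
    elem []      = δ 0
    elem (z ∷ Z) = step (- z) (elem Z)

    elem-∷ʳ : ∀ Z z k → elem (Z ∷ʳ z) k ≈ elem (z ∷ Z) k
    elem-∷ʳ []      z k = ≈-refl
    elem-∷ʳ (y ∷ Z) z k = ≈-trans (step-cong ≈-refl (elem-∷ʳ Z z) k) (step-comm (- y) (- z) (elem Z) k)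

    -- Scaling every `z` in `∏ (1 − z q)` is the substitution of `ω q` for `q`.
    elem-scale : ∀ ω Z k → elem (map (ω *ᴿ_) Z) k ≈ pow ω k *ᴿ elem Z k
    elem-scale ω []      zero    = ≈-sym (*-identityˡᴿ _)
    elem-scale ω []      (suc k) = ≈-sym (zeroʳ _)
    elem-scale ω (z ∷ Z) zero    = elem-scale ω Z 0
    elem-scale ω (z ∷ Z) (suc k) = begin
      elem (map (ω *ᴿ_) Z) (suc k) +ᴿ (- (ω *ᴿ z)) *ᴿ elem (map (ω *ᴿ_) Z) k
        ≈⟨ elem-scale ω Z (suc k) ⟨+⟩ -‿distribʳ-* ω z ⟨*⟩ elem-scale ω Z k ⟩
      (ω *ᴿ pow ω k) *ᴿ elem Z (suc k) +ᴿ (ω *ᴿ (- z)) *ᴿ (pow ω k *ᴿ elem Z k)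
        ≈⟨ solve 5 (λ ω p a w b → (ω :* p) :* a :+ (ω :* w) :* (p :* b) := (ω :* p) :* (a :+ w :* b)) ≈-refl
             ω (pow ω k) (elem Z (suc k)) (- z) (elem Z k) ⟩
      (ω *ᴿ pow ω k) *ᴿ (elem Z (suc k) +ᴿ (- z) *ᴿ elem Z k) ∎

    elem-degree : ∀ Z k → length Z < k → elem Z k ≈ 0#
    elem-degree []      (suc k) _         = ≈-refl
    elem-degree (z ∷ Z) (suc k) (s≤s Z<k) = ≈-trans
      (elem-degree Z (suc k) (m<n⇒m<1+n Z<k) ⟨+⟩ ≈-trans (≈-refl ⟨*⟩ elem-degree Z k Z<k) (zeroʳ _)) (+-identityˡᴿ 0#)

    elem-0 : ∀ Z → elem Z 0 ≈ 1#
    elem-0 []      = ≈-refl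
    elem-0 (z ∷ Z) = elem-0 Z

    -- Partial sums of the coefficients of `(1 − q) f` are the coefficients of `f`. For `m` above
    -- the degree of `f` this says that `(1 − q) f` vanishes at `q = 1`.
    telescope : ∀ m (f : ℕ → Carrier) → sumℕ m (step (- 1#) f ∘ suc) +ᴿ f 0 ≈ f m
    telescope zero    f = +-identityˡᴿ _
    telescope (suc m) f = begin
      ((f 1 +ᴿ (- 1#) *ᴿ f 0) +ᴿ rest) +ᴿ f 0
        ≈⟨ solve 4 (λ a w b r → ((a :+ w :* b) :+ r) :+ b := (r :+ a) :+ (con 1 :+ w) :* b) ≈-refl (f 1) (- 1#) (f 0) rest ⟩
      (rest +ᴿ f 1) +ᴿ (1# +ᴿ (- 1#)) *ᴿ f 0
        ≈⟨ telescope m (f ∘ suc) ⟨+⟩ ≈-trans (-‿inverseʳ 1# ⟨*⟩ ≈-refl) (zeroˡ _) ⟩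
      f (suc m) +ᴿ 0#
        ≈⟨ +-identityʳᴿ _ ⟩
      f (suc m) ∎
      where rest = sumℕ m (step (- 1#) (f ∘ suc) ∘ suc)

    conv : (ℕ → Carrier) → (ℕ → Carrier) → ℕ → Carrier
    conv f g k = sumℕ (suc k) (λ a → f a *ᴿ g (k ∸ a))

    conv-stepˡ : ∀ w f g k → conv (step w f) g (suc k) ≈ conv f g (suc k) +ᴿ w *ᴿ conv f g k
    conv-stepˡ w f g k = begin
      f 0 *ᴿ g (suc k) +ᴿ sumℕ (suc k) (λ a → (f (suc a) +ᴿ w *ᴿ f a) *ᴿ g (k ∸ a))
        ≈⟨ ≈-refl ⟨+⟩ sum-cong (suc k) {g = λ a → 1# *ᴿ F a +ᴿ w *ᴿ G a} (λ a _ →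
             ≈-trans (distribʳ _ _ _) (≈-sym (*-identityˡᴿ _) ⟨+⟩ *-assocᴿ w _ _)) ⟩
      f 0 *ᴿ g (suc k) +ᴿ sumℕ (suc k) (λ a → 1# *ᴿ F a +ᴿ w *ᴿ G a)
        ≈⟨ ≈-refl ⟨+⟩ sum-linear (suc k) 1# w F G ⟩
      f 0 *ᴿ g (suc k) +ᴿ (1# *ᴿ sumℕ (suc k) F +ᴿ w *ᴿ sumℕ (suc k) G)
        ≈⟨ ≈-refl ⟨+⟩ *-identityˡᴿ _ ⟨+⟩ ≈-refl ⟩
      f 0 *ᴿ g (suc k) +ᴿ (sumℕ (suc k) F +ᴿ w *ᴿ sumℕ (suc k) G)
        ≈⟨ ≈-sym (+-assocᴿ _ _ _) ⟩
      conv f g (suc k) +ᴿ w *ᴿ conv f g k ∎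
      where
      F G : ℕ → Carrier
      F a = f (suc a) *ᴿ g (k ∸ a)
      G a = f a *ᴿ g (k ∸ a)

    conv-stepʳ : ∀ w f g k → conv f (step w g) (suc k) ≈ conv f g (suc k) +ᴿ w *ᴿ conv f g k
    conv-stepʳ w f g zero = solve 5 (λ w a b x y → a :* (x :+ w :* y) :+ (b :* y :+ con 0)
        := (a :* x :+ (b :* y :+ con 0)) :+ w :* (a :* y :+ con 0)) ≈-refl w (f 0) (f 1) (g 1) (g 0)
    conv-stepʳ w f g (suc k) = ≈-trans (≈-refl ⟨+⟩ conv-stepʳ w (f ∘ suc) g k)
      (solve 6 (λ w a x y p q → a :* (x :+ w :* y) :+ (p :+ w :* q) := (a :* x :+ p) :+ w :* (a :* y :+ q)) ≈-refl
        w (f 0) (g (suc (suc k))) (g (suc k)) (conv (f ∘ suc) g (suc k)) (conv (f ∘ suc) g k))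

    -- A linear factor may be moved from one series of a product to the other. In this way each
    -- factor `1 − z q` of `elem` is brought next to the geometric series in `hList` that it
    -- cancels.
    conv-step : ∀ w f g k → conv (step w f) g k ≈ conv f (step w g) k
    conv-step w f g zero    = ≈-refl
    conv-step w f g (suc k) = ≈-trans (conv-stepˡ w f g k) (≈-sym (conv-stepʳ w f g k))

    conv-cong : ∀ {f g g′} → (∀ k → g k ≈ g′ k) → ∀ k → conv f g k ≈ conv f g′ k
    conv-cong {f} {g} {g′} h k =
      sum-cong (suc k) {λ a → f a *ᴿ g (k ∸ a)} {λ a → f a *ᴿ g′ (k ∸ a)} (λ a _ → ≈-refl ⟨*⟩ h (k ∸ a))

    step-hList : ∀ z Z k → step (- z) (hList (z ∷ Z)) k ≈ hList Z k
    step-hList z Z zero    = ≈-trans (+-identityʳᴿ _) (*-identityˡᴿ _)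
    step-hList z Z (suc k) = begin
      (1# *ᴿ hList Z (suc k) +ᴿ sumℕ (suc k) (λ a → (z *ᴿ pow z a) *ᴿ hList Z (k ∸ a))) +ᴿ (- z) *ᴿ hList (z ∷ Z) k
        ≈⟨ (*-identityˡᴿ _ ⟨+⟩ shifted) ⟨+⟩ ≈-refl ⟩
      (hList Z (suc k) +ᴿ z *ᴿ H) +ᴿ (- z) *ᴿ H
        ≈⟨ +-assocᴿ _ _ _ ⟩
      hList Z (suc k) +ᴿ (z *ᴿ H +ᴿ (- z) *ᴿ H)
        ≈⟨ ≈-refl ⟨+⟩ ≈-trans (≈-sym (distribʳ H z (- z))) (≈-trans (-‿inverseʳ z ⟨*⟩ ≈-refl) (zeroˡ H)) ⟩
      hList Z (suc k) +ᴿ 0#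
        ≈⟨ +-identityʳᴿ _ ⟩
      hList Z (suc k) ∎
      where
      H = hList (z ∷ Z) k
      F : ℕ → Carrier
      F a = pow z a *ᴿ hList Z (k ∸ a)
      shifted : sumℕ (suc k) (λ a → (z *ᴿ pow z a) *ᴿ hList Z (k ∸ a)) ≈ z *ᴿ H
      shifted = ≈-trans
        (sum-cong (suc k) {g = λ a → z *ᴿ F a +ᴿ 0# *ᴿ F a}
          (λ a _ → ≈-trans (*-assocᴿ z _ _) (≈-sym (≈-trans (≈-refl ⟨+⟩ zeroˡ _) (+-identityʳᴿ _)))))
        (≈-trans (sum-linear (suc k) z 0# F F) (≈-trans (≈-refl ⟨+⟩ zeroˡ _) (+-identityʳᴿ _)))

    conv-elem-hList : ∀ Z k → conv (elem Z) (hList Z) k ≈ δ 0 k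
    conv-elem-hList [] zero    = ≈-trans (+-identityʳᴿ _) (*-identityˡᴿ _)
    conv-elem-hList [] (suc k) = ≈-trans (sum-zero (suc (suc k)) {λ a → δ 0 a *ᴿ hList [] (suc k ∸ a)}
      (λ { zero _ → zeroʳ _ ; (suc a) _ → zeroˡ _ })) ≈-refl
    conv-elem-hList (z ∷ Z) k = begin
      conv (step (- z) (elem Z)) (hList (z ∷ Z)) k   ≈⟨ conv-step (- z) (elem Z) (hList (z ∷ Z)) k ⟩
      conv (elem Z) (step (- z) (hList (z ∷ Z))) k   ≈⟨ conv-cong {elem Z} (step-hList z Z) k ⟩
      conv (elem Z) (hList Z) k  ≈⟨ conv-elem-hList Z k ⟩
      δ 0 k  ∎

    module Roots
      (domain : ∀ x y → x *ᴿ y ≈ 0# → x ≈ 0# ⊎ y ≈ 0#)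
      (s : ℕ) (ω : Carrier) (ω^t≈1 : pow ω (suc s) ≈ 1#) (prim : ∀ k → 1 ≤ k → k < suc s → ¬ pow ω k ≈ 1#) where

      private
        t = suc s
        tail = map (pow ω) (applyUpTo suc s)
        E = elem (roots ω t)
        H = hList (roots ω t)

      rotate : map (ω *ᴿ_) (roots ω t) ≡ tail ∷ʳ pow ω t
      rotate = trans (sym (map-∘ (upTo t))) (trans (map-∘ {g = pow ω} {f = suc} (upTo t))
        (trans (cong (map (pow ω)) (trans (map-applyUpTo id suc t) (sym (applyUpTo-∷ʳ suc s))))
          (map-++ (pow ω) (applyUpTo suc s) _)))

      -- Multiplication by `ω` permutes the roots cyclically, so the product `∏ (1 − ω^i q)` does
      -- not change when `q` becomes `ω q`.
      invariant : ∀ k → pow ω k *ᴿ E k ≈ E k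
      invariant k = begin
        pow ω k *ᴿ E k  ≈⟨ ≈-sym (elem-scale ω (roots ω t) k) ⟩
        elem (map (ω *ᴿ_) (roots ω t)) k ≡⟨ cong (λ Z → elem Z k) rotate ⟩
        elem (tail ∷ʳ pow ω t) k  ≈⟨ elem-∷ʳ tail (pow ω t) k ⟩
        elem (pow ω t ∷ tail) k  ≈⟨ step-cong (-‿cong ω^t≈1) (λ _ → ≈-refl) k ⟩
        E k  ∎

      -- By `invariant`, `ω^k − 1` annihilates `E k`; it is nonzero by primitivity, and the ring has
      -- no zero divisors.
      E-middle : ∀ k → 1 ≤ k → k < t → E k ≈ 0#
      E-middle k 1≤k k<t with domain (pow ω k +ᴿ (- 1#)) (E k)
        (≈-trans (distribʳ _ _ _) (≈-trans (invariant k ⟨+⟩ ≈-trans (≈-sym (-‿distribˡ-* 1# (E k))) (-‿cong (*-identityˡᴿ _))) (-‿inverseʳ _)))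
      ... | inj₂ E≈0 = E≈0
      ... | inj₁ eq  = ⊥-elim (prim k 1≤k k<t (begin
        pow ω k  ≈⟨ ≈-sym (+-identityʳᴿ _) ⟩
        pow ω k +ᴿ 0#  ≈⟨ ≈-refl ⟨+⟩ ≈-sym (-‿inverseˡ 1#) ⟩
        pow ω k +ᴿ ((- 1#) +ᴿ 1#)       ≈⟨ ≈-sym (+-assocᴿ _ _ _) ⟩
        (pow ω k +ᴿ (- 1#)) +ᴿ 1#       ≈⟨ eq ⟨+⟩ ≈-refl ⟩
        0# +ᴿ 1#  ≈⟨ +-identityˡᴿ _ ⟩
        1#  ∎))

      length-tail : length tail ≡ s
      length-tail = trans (length-map (pow ω) (applyUpTo suc s)) (length-applyUpTo suc s)

      -- The factor 1 − q of the product makes it vanish at q = 1.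
      1+E-top : 1# +ᴿ E t ≈ 0#
      1+E-top = begin
        1# +ᴿ E t  ≈⟨ +-commᴿ _ _ ⟩
        E t +ᴿ 1#  ≈⟨ ≈-sym (sum-only t {E ∘ suc} s (n<1+n s)
                                                    (λ i i<t i≢s → E-middle (suc i) (s≤s z≤n) (s≤s (≤∧≢⇒< (≤-pred i<t) i≢s))))
                                                  ⟨+⟩ ≈-sym (elem-0 tail) ⟩
        sumℕ t (E ∘ suc) +ᴿ elem tail 0        ≈⟨ telescope t (elem tail) ⟩
        elem tail t  ≈⟨ elem-degree tail t (subst (_< t) (sym length-tail) (n<1+n s)) ⟩
        0#  ∎

      H-0 : H 0 ≈ 1#
      H-0 = begin
        H 0  ≈⟨ ≈-sym (*-identityˡᴿ _) ⟩
        1# *ᴿ H 0  ≈⟨ ≈-sym (elem-0 (roots ω t)) ⟨*⟩ ≈-refl ⟩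
        E 0 *ᴿ H 0  ≈⟨ ≈-sym (+-identityʳᴿ _) ⟩
        conv E H 0  ≈⟨ conv-elem-hList (roots ω t) 0 ⟩
        1#  ∎

      head-term : ∀ k → E 0 *ᴿ H k ≈ H k
      head-term k = ≈-trans (elem-0 (roots ω t) ⟨*⟩ ≈-refl) (*-identityˡᴿ _)

      H-middle : ∀ k → suc k < t → H (suc k) ≈ 0#
      H-middle k k<t = begin
        H (suc k)  ≈⟨ ≈-sym (head-term (suc k)) ⟩
        E 0 *ᴿ H (suc k)  ≈⟨ ≈-sym (+-identityʳᴿ _) ⟩
        E 0 *ᴿ H (suc k) +ᴿ 0#  ≈⟨ ≈-refl ⟨+⟩ ≈-sym (sum-zero (suc k) {λ a → E (suc a) *ᴿ H (k ∸ a)}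
          (λ a a<k → ≈-trans (E-middle (suc a) (s≤s z≤n) (≤-<-trans a<k k<t) ⟨*⟩ ≈-refl) (zeroˡ _))) ⟩
        conv E H (suc k)  ≈⟨ conv-elem-hList (roots ω t) (suc k) ⟩
        0#  ∎

      -- The coefficients of `E` other than the first and the one at `t` vanish, so the relation
      -- `E · H = 1` reads `H (t + k) + E t · H k = 0`, where `E t = −1`.
      H-period : ∀ k → H (t + k) ≈ H k
      H-period k = begin
        H (t + k)  ≈⟨ ≈-sym (+-identityʳᴿ _) ⟩
        H (t + k) +ᴿ 0#  ≈⟨ ≈-refl ⟨+⟩ ≈-sym (zeroˡ (H k)) ⟩
        H (t + k) +ᴿ 0# *ᴿ H k  ≈⟨ ≈-refl ⟨+⟩ ≈-sym 1+E-top ⟨*⟩ ≈-refl ⟩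
        H (t + k) +ᴿ (1# +ᴿ E t) *ᴿ H k  ≈⟨ solve 3 (λ a e b → a :+ (con 1 :+ e) :* b := b :+ (a :+ e :* b)) ≈-refl (H (t + k)) (E t) (H k) ⟩
        H k +ᴿ (H (t + k) +ᴿ E t *ᴿ H k)  ≈⟨ ≈-refl ⟨+⟩ two-terms ⟩
        H k +ᴿ 0#  ≈⟨ +-identityʳᴿ _ ⟩
        H k  ∎
        where
        F : ℕ → Carrier
        F a = E (suc a) *ᴿ H (s + k ∸ a)
        others : ∀ i → i < suc (s + k) → i ≢ s → F i ≈ 0#
        others i i<n i≢s with i <? s
        ... | yes i<s = ≈-trans (E-middle (suc i) (s≤s z≤n) (s≤s i<s) ⟨*⟩ ≈-refl) (zeroˡ _)
        ... | no  i≮s = ≈-trans (elem-degree (roots ω t) (suc i)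
          (subst (_< suc i) (sym (cong suc length-tail)) (s≤s (≤∧≢⇒< (≮⇒≥ i≮s) (i≢s ∘ sym)))) ⟨*⟩ ≈-refl) (zeroˡ _)
        two-terms : H (t + k) +ᴿ E t *ᴿ H k ≈ 0#
        two-terms = begin
          H (t + k) +ᴿ E t *ᴿ H k  ≡⟨ cong (λ m → H (t + k) +ᴿ E t *ᴿ H m) (sym (m+n∸m≡n s k)) ⟩
          H (t + k) +ᴿ F s  ≈⟨ ≈-sym (head-term (t + k)) ⟨+⟩ ≈-sym (sum-only (suc (s + k)) {F} s (s≤s (m≤m+n s k)) others) ⟩
          conv E H (t + k)  ≈⟨ conv-elem-hList (roots ω t) (t + k) ⟩
          0#  ∎

      H-residue : ∀ q r → r < t → H (r + q * t) ≈ δ r 0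
      H-residue zero    zero    r<t = H-0
      H-residue zero    (suc r) r<t = ≈-trans (reflexive (cong H (+-identityʳ (suc r)))) (H-middle r r<t)
      H-residue (suc q) r       r<t = ≈-trans (reflexive (cong H (trans (sym (+-assoc r t _)) (trans (cong (_+ q * t) (+-comm r t)) (+-assoc t r _)))))
        (≈-trans (H-period (r + q * t)) (H-residue q r r<t))

      hList-roots : ∀ k → hList (roots ω t) k ≈ δ (k % t) 0
      hList-roots k = ≈-trans (reflexive (cong H (m≡m%n+[m/n]*n k t))) (H-residue (k / t) (k % t) (m%n<n k t))

  -- Beads

  count-filter : ∀ p q xs → countᵇ p (filterᵇ q xs) ≡ countᵇ (λ x → p x ∧ q x) xs
  count-filter p q []       = refl
  count-filter p q (x ∷ xs) rewrite count-∷ (λ x → p x ∧ q x) x xs with q x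
  ... | false rewrite ∧-zeroʳ (p x) = count-filter p q xs
  ... | true  rewrite ∧-identityʳ (p x) | count-∷ p x (filterᵇ q xs) = cong (ind (p x) +_) (count-filter p q xs)

  -- The possible contents of a pair of dual residues: numbers of small and big beads of one, then of the other.
  data State : ℕ → ℕ → ℕ → ℕ → Set where
    small-small : State 1 0 1 0
    double-left : State 1 1 0 0
    small-big   : State 1 0 0 1
    big-small   : State 0 1 1 0
    double-right : State 0 0 1 1

  -- At most one of the two beads is big, so at least one is small, and no residue has two small
  -- beads; five configurations remain.
  state : ∀ {a b c d} → a ≤ 1 → c ≤ 1 → b + d ≤ 1 → (a + b) + (c + d) ≡ 2 → State a b c d
  state {zero}        {zero}        {zero}        {zero}        _ _ _ ()
  state {zero}        {zero}        {zero}        {suc d}       _ _ (s≤s z≤n) ()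
  state {zero}        {zero}        {suc zero}    {zero}        _ _ _ ()
  state {zero}        {zero}        {suc zero}    {suc zero}    _ _ _ refl = double-right
  state {zero}        {zero}        {suc zero}    {suc (suc d)} _ _ (s≤s ()) _
  state {zero}        {zero}        {suc (suc c)} {d}           _ (s≤s ()) _ _
  state {zero}        {suc zero}    {zero}        {zero}        _ _ _ ()
  state {zero}        {suc zero}    {suc zero}    {zero}        _ _ _ refl = big-small
  state {zero}        {suc zero}    {suc (suc c)} {d}           _ (s≤s ()) _ _
  state {zero}        {suc zero}    {c}           {suc d}       _ _ (s≤s ()) _
  state {zero}        {suc (suc b)} {c}           {d}           _ _ (s≤s ()) _
  state {suc zero}    {zero}        {zero}        {zero}        _ _ _ ()
  state {suc zero}    {zero}        {zero}        {suc zero}    _ _ _ refl = small-big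
  state {suc zero}    {zero}        {zero}        {suc (suc d)} _ _ (s≤s ()) _
  state {suc zero}    {zero}        {suc zero}    {zero}        _ _ _ refl = small-small
  state {suc zero}    {zero}        {suc zero}    {suc d}       _ _ _ ()
  state {suc zero}    {zero}        {suc (suc c)} {d}           _ (s≤s ()) _ _
  state {suc zero}    {suc zero}    {zero}        {zero}        _ _ _ refl = double-left
  state {suc zero}    {suc zero}    {suc c}       {zero}        _ _ _ ()
  state {suc zero}    {suc zero}    {c}           {suc d}       _ _ (s≤s ()) _
  state {suc zero}    {suc (suc b)} {c}           {d}           _ _ (s≤s ()) _
  state {suc (suc a)} {b}           {c}           {d}           (s≤s ()) _ _ _

  State-swap : ∀ {a b a′ b′} → State a b a′ b′ → State a′ b′ a b
  State-swap small-small  = small-small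
  State-swap double-left  = double-right
  State-swap small-big    = big-small
  State-swap big-small    = small-big
  State-swap double-right = double-left

  module Beads (e u : ℕ) (e≤1 : e ≤ 1) (s : ℕ) (s≡ : s ≡ e + (u + u))
               (bs : List ℕ) (desc : Desc bs) (len≡ : length bs ≡ suc s) where

    t : ℕ
    t = suc s

    big : ℕ → Bool
    big b = not (b <ᵇ t)

    -- For `c < t` the only possible small bead of residue `c` is `c` itself, so `S` can test
    -- equality instead of residues.
    n S B : ℕ → ℕ
    n c = countᵇ (λ b → b % t ≡ᵇ c) bs
    S c = countᵇ (_≡ᵇ c) bs
    B c = countᵇ (λ b → big b ∧ (b % t ≡ᵇ c)) bs

    -- This is `t − 2 − c`. It is an involution below `s`; at `s` itself truncation gives a
    -- meaningless 0, so the residue `s` is always treated apart.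
    dual : ℕ → ℕ
    dual c = s ∸ suc c

    ≥-big : ∀ {b} → t ≤ b → big b ≡ true
    ≥-big t≤b = cong not (<ᵇ-false t≤b)

    S≤1 : ∀ c → S c ≤ 1
    S≤1 = Desc⇒count-≡≤1 desc

    n-split : ∀ c → c < t → n c ≡ S c + B c
    n-split c c<t = count-+ bs (λ {b} _ → pointwise b)
      where
      pointwise : ∀ b → ind (b % t ≡ᵇ c) ≡ ind (b ≡ᵇ c) + ind (big b ∧ (b % t ≡ᵇ c))
      pointwise b with lt-case b t
      ... | inj₁ (b<t , eq) rewrite eq | m<n⇒m%n≡m b<t = sym (+-identityʳ _)
      ... | inj₂ (t≤b , eq) rewrite eq | ≡ᵇ-false (<⇒≢ (<-≤-trans c<t t≤b) ∘ sym) = refl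

    ∑n≡t : ∑ t n ≡ t
    ∑n≡t = trans (sym (count-<-∑ (_% t) t bs)) (trans (count-all bs (λ {b} _ → <ᵇ-true (m%n<n b t))) len≡)

    ∑-dual : ∀ F → ∑ t F ≡ ∑ u (λ c → F c + F (dual c)) + e * F u + F s
    ∑-dual F = trans (∑-last s F) (cong (_+ F s) (trans (cong (λ k → ∑ k F) s≡)
      (trans (∑-fold e u F e≤1) (cong (_+ e * F u) (∑-cong u (λ c _ → cong (λ k → F c + F (k ∸ suc c)) (sym s≡)))))))

    -- The multiplication by `e` in `mid-count` makes the condition on the self-dual residue vacuous
    -- for odd `t`, where no such residue exists.
    record Counts : Set where
      constructor mkCounts
      field
        last-count : n s ≡ 1
        pair-count : ∀ c → c < u → n c + n (dual c) ≡ 2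
        mid-count  : e * n u ≡ e

      n-mid : e ≡ 1 → n u ≡ 1
      n-mid e≡1 = trans (sym (+-identityʳ (n u))) (subst (λ k → k * n u ≡ k) e≡1 mid-count)

    record Good : Set where
      constructor mkGood
      field
        counts   : Counts
        pair-big : ∀ c → c < u → B c + B (dual c) ≤ 1
      open Counts counts public

    -- There are `t` beads and `t` columns, so if no class is overfull then none is underfull.
    counts-from-≤ : n s ≤ 1 → (∀ c → c < u → n c + n (dual c) ≤ 2) → e * n u ≤ e → Counts
    counts-from-≤ last≤ pair≤ mid≤ = mkCounts (proj₂ outer) (∑-squeeze u pair≤ (proj₁ inner)) (proj₂ inner)
      where
      sums : ∑ u (λ c → n c + n (dual c)) + e * n u + n s ≡ ∑ u (λ _ → 2) + e + 1
      sums = begin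
        ∑ u (λ c → n c + n (dual c)) + e * n u + n s   ≡⟨ sym (∑-dual n) ⟩
        ∑ t n  ≡⟨ ∑n≡t ⟩
        suc s  ≡⟨ cong suc s≡ ⟩
        suc (e + (u + u))  ≡⟨ solve 2 (λ e u → con 1 :+ (e :+ (u :+ u)) := u :* con 2 :+ e :+ con 1) refl e u ⟩
        u * 2 + e + 1  ≡⟨ cong (λ k → k + e + 1) (sym (∑-const u 2)) ⟩
        ∑ u (λ _ → 2) + e + 1  ∎
        where
        open ≡-Reasoning
        open +-*-Solver
      outer = +-squeeze (+-mono-≤ (∑-mono u pair≤) mid≤) last≤ sums
      inner = +-squeeze (∑-mono u pair≤) mid≤ (proj₁ outer)

    u≤s : u ≤ s
    u≤s = subst (u ≤_) (sym s≡) (≤-trans (m≤m+n u u) (m≤n+m (u + u) e))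

    double<s : ∀ {c} → c < u → suc (c + suc c) ≤ s
    double<s {c} c<u = subst (suc (c + suc c) ≤_) (sym s≡) (≤-trans (+-mono-≤ c<u c<u) (m≤n+m (u + u) e))

    dual-involutive : ∀ {c} → c < s → dual (dual c) ≡ c
    dual-involutive {c} c<s = trans (cong (s ∸_) (trans (sym (+-∸-assoc 1 c<s)) refl)) (m∸[m∸n]≡n (<⇒≤ c<s))

    dual<s : ∀ {c} → c < s → dual c < s
    dual<s {c} c<s = ∸-monoʳ-< {s} {suc c} {0} (s≤s z≤n) c<s

    dual-sum : ∀ {c} → c < s → suc (c + dual c) ≡ s
    dual-sum c<s = m+[n∸m]≡n c<s

    <dual : ∀ {c} → c < u → c < dual c
    <dual {c} c<u = +-cancelˡ-≤ (suc c) (suc c) (dual c) (subst (suc c + suc c ≤_) (sym (dual-sum (<-≤-trans c<u u≤s))) (double<s c<u))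

    u<s : e ≡ 1 → u < s
    u<s refl = subst (u <_) (sym s≡) (s≤s (m≤m+n u u))

    dual-mid : e ≡ 1 → dual u ≡ u
    dual-mid refl = trans (cong (_∸ suc u) s≡) (m+n∸m≡n u u)

    data Residue (r : ℕ) : Set where
      last  : r ≡ s → Residue r
      lower : r < u → Residue r
      mid   : r ≡ u → e ≡ 1 → Residue r
      upper : r < s → dual r < u → Residue r

    residue : ∀ r → r < t → Residue r
    residue r (s≤s r≤s) with r ≟ s
    ... | yes r≡s = last r≡s
    ... | no r≢s with r <? u
    ...   | yes r<u = lower r<u
    ...   | no r≮u = split
      where
      r<s : r < s
      r<s = ≤∧≢⇒< r≤s r≢s
      above : e + u ≤ r → Residue r
      above h = upper r<s (+-cancelˡ-≤ r _ _ (subst (_≤ r + u) (sym (trans (+-suc r _) (dual-sum r<s)))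
        (subst (_≤ r + u) (sym (trans s≡ (sym (+-assoc e u u)))) (+-monoˡ-≤ u h))))
      split : Residue r
      split with r ≟ u
      ... | no r≢u = above (≤-trans (+-monoˡ-≤ u e≤1) (≤∧≢⇒< (≮⇒≥ r≮u) (r≢u ∘ sym)))
      ... | yes r≡u with e ≟ 1
      ...   | yes e≡1 = mid r≡u e≡1
      ...   | no e≢1  = above (subst (λ k → k + u ≤ r) (sym (n<1⇒n≡0 (≤∧≢⇒< e≤1 e≢1))) (≮⇒≥ r≮u))

    -- The column assigned to the bead b in the only nonvanishing term of the determinant.
    f : ℕ → ℕ
    f b = if b <ᵇ t then b else (if S (b % t) ≡ᵇ 0 then b % t else dual (b % t))

    f-small : ∀ {b} → b < t → f b ≡ b
    f-small b<t rewrite <ᵇ-true b<t = refl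

    f-free : ∀ {b} → t ≤ b → S (b % t) ≡ 0 → f b ≡ b % t
    f-free t≤b eq rewrite <ᵇ-false t≤b | eq = refl

    f-taken : ∀ {b} → t ≤ b → S (b % t) ≡ 1 → f b ≡ dual (b % t)
    f-taken t≤b eq rewrite <ᵇ-false t≤b | eq = refl

    small-bead : ∀ {c} → S c ≡ 1 → c ∈ bs
    small-bead {c} eq with count-∃ {_≡ᵇ c} bs (≤-reflexive (sym eq))
    ... | b , b∈ , b≡c = subst (_∈ bs) (≡ᵇ-true⁻¹ b≡c) b∈

    big-bead : ∀ {c} → B c ≡ 1 → ∃ λ b → b ∈ bs × t ≤ b × b % t ≡ c
    big-bead {c} eq with count-∃ bs (≤-reflexive (sym eq))
    ... | b , b∈ , h with lt-case b t
    ...   | inj₁ (_ , eq′) rewrite eq′ = contradiction h λ ()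
    ...   | inj₂ (t≤b , eq′) rewrite eq′ = b , b∈ , t≤b , ≡ᵇ-true⁻¹ h

    small-count : ∀ {c} → c ∈ bs → S c ≡ 1
    small-count {c} c∈ = ≤-antisym (S≤1 c) (∃-count bs c∈ (≡ᵇ-refl c))

    big-count : ∀ {b} → b ∈ bs → t ≤ b → 1 ≤ B (b % t)
    big-count {b} b∈ t≤b = ∃-count bs b∈ (cong₂ _∧_ (≥-big t≤b) (≡ᵇ-refl (b % t)))

    single : ∀ {c} → c < t → n c ≡ 1 → (S c ≡ 1 × B c ≡ 0) ⊎ (S c ≡ 0 × B c ≡ 1)
    single {c} c<t eq = split (S c) (B c) (S≤1 c) (trans (sym (n-split c c<t)) eq)
      where
      split : ∀ a b → a ≤ 1 → a + b ≡ 1 → (a ≡ 1 × b ≡ 0) ⊎ (a ≡ 0 × b ≡ 1)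
      split zero       b _ eq = inj₂ (refl , eq)
      split (suc zero) b _ eq = inj₁ (refl , suc-injective eq)
      split (suc (suc a)) b (s≤s ()) eq

    module _ (good : Good) where
      open Good good

      lower-state : ∀ {c} → c < u → State (S c) (B c) (S (dual c)) (B (dual c))
      lower-state {c} c<u = state (S≤1 c) (S≤1 (dual c)) (pair-big c c<u)
        (trans (sym (cong₂ _+_ (n-split c (m<n⇒m<1+n c<s)) (n-split (dual c) (m<n⇒m<1+n (dual<s c<s))))) (pair-count c c<u))
        where
        c<s : c < s
        c<s = <-≤-trans c<u u≤s

      upper-state : ∀ {c} → c < s → dual c < u → State (S (dual c)) (B (dual c)) (S c) (B c)
      upper-state {c} c<s c′<u = subst (λ k → State (S (dual c)) (B (dual c)) (S k) (B k)) (dual-involutive c<s) (lower-state c′<u)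

      -- A small bead keeps its own column. Without one, column `c` goes to the big bead of residue
      -- `c`, or, if the residue is empty, to the big bead of the doubled dual residue.
      cover : ∀ c → c < t → ∃ λ b → b ∈ bs × f b ≡ c
      cover c c<t = go (residue c c<t)
        where
        from-small : S c ≡ 1 → ∃ λ b → b ∈ bs × f b ≡ c
        from-small eq = c , small-bead eq , f-small c<t
        from-free : S c ≡ 0 → B c ≡ 1 → ∃ λ b → b ∈ bs × f b ≡ c
        from-free S≡0 B≡1 with big-bead B≡1
        ... | b , b∈ , t≤b , refl = b , b∈ , f-free t≤b S≡0
        from-dual : c < s → S (dual c) ≡ 1 → B (dual c) ≡ 1 → ∃ λ b → b ∈ bs × f b ≡ c
        from-dual c<s S≡1 B≡1 with big-bead B≡1
        ... | b , b∈ , t≤b , eq = b , b∈ , trans (f-taken t≤b (trans (cong S eq) S≡1)) (trans (cong dual eq) (dual-involutive c<s))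
        from-single : n c ≡ 1 → ∃ λ b → b ∈ bs × f b ≡ c
        from-single eq with single c<t eq
        ... | inj₁ (S≡1 , _)   = from-small S≡1
        ... | inj₂ (S≡0 , B≡1) = from-free S≡0 B≡1
        from-state : ∀ {a b a′ b′} → c < s → S c ≡ a → B c ≡ b → S (dual c) ≡ a′ → B (dual c) ≡ b′ →
          State a b a′ b′ → ∃ λ b → b ∈ bs × f b ≡ c
        from-state c<s h₁ h₂ h₃ h₄ small-small  = from-small h₁
        from-state c<s h₁ h₂ h₃ h₄ double-left  = from-small h₁
        from-state c<s h₁ h₂ h₃ h₄ small-big    = from-small h₁
        from-state c<s h₁ h₂ h₃ h₄ big-small    = from-free h₁ h₂
        from-state c<s h₁ h₂ h₃ h₄ double-right = from-dual c<s h₃ h₄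
        go : Residue c → ∃ λ b → b ∈ bs × f b ≡ c
        go (last refl)      = from-single last-count
        go (mid refl e≡1)   = from-single (n-mid e≡1)
        go (lower c<u)      = from-state (<-≤-trans c<u u≤s) refl refl refl refl (lower-state c<u)
        go (upper c<s c′<u) = from-state c<s refl refl refl refl (State-swap (upper-state c<s c′<u))

      -- Surjectivity suffices: each of the `t` columns is hit at least once, and the list has only
      -- `t` entries.
      perm : IsPerm t (map f bs)
      perm = len′ , λ c c<t → sym (∑-squeeze t {λ _ → 1} (λ c c<t → covered c c<t) (≤-antisym (∑-mono t covered) total) c c<t)
        where
        len′ : length (map f bs) ≡ t
        len′ = trans (length-map f bs) len≡
        covered : ∀ c → c < t → 1 ≤ countᵇ (_≡ᵇ c) (map f bs)
        covered c c<t with cover c c<t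
        ... | b , b∈ , eq = ∃-count (map f bs) (∈-map⁺ f b∈) (≡ᵇ-true eq)
        total : ∑ t (λ c → countᵇ (_≡ᵇ c) (map f bs)) ≤ ∑ t (λ _ → 1)
        total = subst₂ _≤_ (count-<-∑ id t (map f bs)) (trans len′ (sym (trans (∑-const t 1) (*-identityʳ t))))
          (count≤length (_<ᵇ t) (map f bs))

  -- Lengths of the quotient partitions

  module Quotient (s : ℕ) where
    private t = suc s

    -- The length of a quotient partition as a function of the sorted beads of one residue; by the
    -- class sizes only lists of at most two beads matter.
    quotLen : List ℕ → ℕ
    quotLen es = len (map (λ j → (at (map (_/ t) es) j + suc j) ∸ length (map (_/ t) es)) (upTo (length (map (_/ t) es))))

    bigs : List ℕ → ℕ
    bigs = countᵇ (λ b → not (b <ᵇ t))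

    positive-/ : ∀ x → (0 <ᵇ x / t) ≡ not (x <ᵇ t)
    positive-/ x with lt-case x t
    ... | inj₁ (x<t , eq) rewrite eq | m<n⇒m/n≡0 {x} {t} x<t = refl
    ... | inj₂ (t≤x , eq) rewrite eq = <ᵇ-true (m≥n⇒m/n>0 t≤x)

    quotLen-1 : ∀ x → quotLen (x ∷ []) ≡ bigs (x ∷ [])
    quotLen-1 x rewrite count-∷ (0 <ᵇ_) (x / t + 1 ∸ 1) [] | count-∷ (λ b → not (b <ᵇ t)) x []
      | m+n∸n≡m (x / t) 1 | positive-/ x = refl

    quotient-< : ∀ {x y} → x > y → x % t ≡ y % t → x / t > y / t
    quotient-< {x} {y} x>y eq with y / t <? x / t
    ... | yes q = q
    ... | no ¬q = ⊥-elim (<-irrefl refl (<-≤-trans x>y (subst₂ _≤_ (sym (m≡m%n+[m/n]*n x t)) (sym (m≡m%n+[m/n]*n y t))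
      (+-mono-≤ (≤-reflexive eq) (*-monoˡ-≤ t (≮⇒≥ ¬q))))))

    -- The two parts are `x / t − 1` and `y / t`. For `x / t = 1` and small `y` the partition is
    -- empty although `x` is big, so the two numbers can differ; they agree only on whether they
    -- exceed 1. If both beads are big then `x / t ≥ 2`, and both parts are nonzero.
    quotLen-2 : ∀ {x y} → x > y → x % t ≡ y % t →
      (quotLen (x ∷ y ∷ []) ≤ 1 × bigs (x ∷ y ∷ []) ≤ 1) ⊎ (quotLen (x ∷ y ∷ []) ≡ 2 × bigs (x ∷ y ∷ []) ≡ 2)
    quotLen-2 {x} {y} x>y eq
      rewrite count-∷ (0 <ᵇ_) (x / t + 1 ∸ 2) ((y / t + 2 ∸ 2) ∷ []) | count-∷ (0 <ᵇ_) (y / t + 2 ∸ 2) []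
            | count-∷ (λ b → not (b <ᵇ t)) x (y ∷ []) | count-∷ (λ b → not (b <ᵇ t)) y []
            | m+n∸n≡m (y / t) 2 | positive-/ y with lt-case y t
    ... | inj₁ (y<t , eq′) rewrite eq′ = inj₁ (≤-trans (≤-reflexive (+-identityʳ _)) (ind≤1 _) , ≤-trans (≤-reflexive (+-identityʳ _)) (ind≤1 _))
    ... | inj₂ (t≤y , eq′) rewrite eq′ | <ᵇ-false (≤-trans t≤y (<⇒≤ x>y))
      | <ᵇ-true {0} {x / t + 1 ∸ 2} (subst (0 <_) (sym (cong (_∸ 2) (+-comm (x / t) 1))) (m<n⇒0<n∸m (≤-<-trans (m≥n⇒m/n>0 t≤y) (quotient-< x>y eq)))) = inj₂ (refl , refl)

  -- Evaluation of the determinant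

  ∑-at : ∀ p xs → ∑ (length xs) (λ k → ind (p (at xs k))) ≡ countᵇ p xs
  ∑-at p []       = refl
  ∑-at p (x ∷ xs) = trans (cong (ind (p x) +_) (∑-at p xs)) (sym (count-∷ p x xs))

  ∈-filter : ∀ (p : ℕ → Bool) {x} xs → x ∈ filterᵇ p xs → x ∈ xs × p x ≡ true
  ∈-filter p (y ∷ ys) x∈ with p y in eq
  ∈-filter p (y ∷ ys) x∈          | false with ∈-filter p ys x∈
  ... | x∈′ , px = there x∈′ , px
  ∈-filter p (y ∷ ys) (here refl) | true = here refl , eq
  ∈-filter p (y ∷ ys) (there x∈)  | true with ∈-filter p ys x∈
  ... | x∈′ , px = there x∈′ , px

  filter-Desc : ∀ p {xs} → Desc xs → Desc (filterᵇ p xs)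
  filter-Desc p = AllPairs-filter⁺ (T? ∘ p)

  count-∃₂ : ∀ p {xs} → Desc xs → 2 ≤ countᵇ p xs →
    ∃₂ λ x y → (x ∈ xs × p x ≡ true) × (y ∈ xs × p y ≡ true) × x ≢ y
  count-∃₂ p {xs} d = pick (filterᵇ p xs) (∈-filter p xs) (filter-Desc p d)
    where
    pick : ∀ es → (∀ {x} → x ∈ es → x ∈ xs × p x ≡ true) → Desc es → 2 ≤ length es →
      ∃₂ λ x y → (x ∈ xs × p x ≡ true) × (y ∈ xs × p y ≡ true) × x ≢ y
    pick (x ∷ [])    _   _               (s≤s ())
    pick (x ∷ y ∷ _) mem ((x>y ∷ _) ∷ _) _ = x , y , mem (here refl) , mem (there (here refl)) , <⇒≢ x>y ∘ sym

  count-∃₃ : ∀ p {xs} → Desc xs → 3 ≤ countᵇ p xs →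
    ∃ λ x → ∃₂ λ y z → (x ∈ xs × p x ≡ true) × (y ∈ xs × p y ≡ true) × (z ∈ xs × p z ≡ true) × x ≢ y × x ≢ z × y ≢ z
  count-∃₃ p {xs} d = pick (filterᵇ p xs) (∈-filter p xs) (filter-Desc p d)
    where
    pick : ∀ es → (∀ {x} → x ∈ es → x ∈ xs × p x ≡ true) → Desc es → 3 ≤ length es →
      ∃ λ x → ∃₂ λ y z → (x ∈ xs × p x ≡ true) × (y ∈ xs × p y ≡ true) × (z ∈ xs × p z ≡ true) × x ≢ y × x ≢ z × y ≢ z
    pick (x ∷ [])        _   _ (s≤s ())
    pick (x ∷ y ∷ [])    _   _ (s≤s (s≤s ()))
    pick (x ∷ y ∷ z ∷ _) mem ((x>y ∷ x>z ∷ _) ∷ (y>z ∷ _) ∷ _) _ = x , y , z ,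
      mem (here refl) , mem (there (here refl)) , mem (there (there (here refl))) ,
      <⇒≢ x>y ∘ sym , <⇒≢ x>z ∘ sym , <⇒≢ y>z ∘ sym

  ∸-inj : ∀ {s a b} → a ≤ s → b ≤ s → s ∸ a ≡ s ∸ b → a ≡ b
  ∸-inj {s} a≤s b≤s eq = trans (sym (m∸[m∸n]≡n a≤s)) (trans (cong (s ∸_) eq) (m∸[m∸n]≡n b≤s))

  ∨-true : ∀ p q → p ∨ q ≡ true → p ≡ true ⊎ q ≡ true
  ∨-true true  q _ = inj₁ refl
  ∨-true false q h = inj₂ h

  ∧-true : ∀ p q → p ∧ q ≡ true → p ≡ true × q ≡ true
  ∧-true true q h = refl , h

  module Evaluation {c ℓ : Level} (R : CommutativeRing c ℓ)
    (e u : ℕ) (e≤1 : e ≤ 1) (s : ℕ) (s≡ : s ≡ e + (u + u))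
    (bs : List ℕ) (desc : Desc bs) (len≡ : length bs ≡ suc s) where

    open RingNames R
    open RingDefs R
    open Determinant R
    open Beads e u e≤1 s s≡ bs desc len≡
    open import Relation.Binary.Reasoning.Setoid setoid

    δ-cong : ∀ {x y x′ y′} → (x ≡ y → x′ ≡ y′) → (x′ ≡ y′ → x ≡ y) → δ x y ≈ δ x′ y′
    δ-cong {x} {y} to from = reflexive (cong (λ p → if p then 1# else 0#)
      (bool-iff {x ≡ᵇ y} (≡ᵇ-true ∘ to ∘ ≡ᵇ-true⁻¹) (≡ᵇ-true ∘ from ∘ ≡ᵇ-true⁻¹)))

    -- The second summand of an entry. In column `s` its index equals that of the first summand;
    -- elsewhere the index is negative for a small bead, and for a big one it detects the dual
    -- residue.
    wrapped : ℕ → ℕ → Carrier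
    wrapped b c = if c ≡ᵇ s then δ (b % t) c else (if b <ᵇ t then 0# else δ (b % t) (dual c))

    ent : ℕ → ℕ → Carrier
    ent b c = δ (b % t) c +ᴿ wrapped b c

    Mx : Matrix
    Mx k j = ent (at bs k) (s ∸ j)

    wrapped-last : ∀ b c → c ≡ s → wrapped b c ≈ δ (b % t) s
    wrapped-last b c refl rewrite ≡ᵇ-refl s = ≈-refl

    wrapped-small : ∀ {b} c → c ≢ s → b < t → wrapped b c ≈ 0#
    wrapped-small c c≢s b<t rewrite ≡ᵇ-false c≢s | <ᵇ-true b<t = ≈-refl

    wrapped-big : ∀ {b} c → c ≢ s → t ≤ b → wrapped b c ≈ δ (b % t) (dual c)
    wrapped-big c c≢s t≤b rewrite ≡ᵇ-false c≢s | <ᵇ-false t≤b = ≈-refl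

    at<len : ∀ {k} → k < t → k < length bs
    at<len = subst (_ <_) (sym len≡)

    <s : ∀ {c} → c < t → c ≢ s → c < s
    <s (s≤s c≤s) c≢s = ≤∧≢⇒< c≤s c≢s

    -- The size of the bead is ignored on purpose: this larger support already respects the classes
    -- of columns, and it depends on the residue alone.
    supp : ℕ → ℕ → Bool
    supp b c = (b % t ≡ᵇ c) ∨ (not (c ≡ᵇ s) ∧ (b % t ≡ᵇ dual c))

    supp-false : ∀ b c → supp b c ≡ false → ent b c ≈ 0#
    supp-false b c h with b % t ≡ᵇ c in eq
    ... | false with c ≡ᵇ s
    ...   | true  = +-identityˡᴿ 0#
    ...   | false with b <ᵇ t
    ...     | true  = +-identityˡᴿ 0#
    ...     | false rewrite h = +-identityˡᴿ 0#

    supp-true : ∀ b c → supp b c ≡ true → (b % t ≡ c) ⊎ (c ≢ s × b % t ≡ dual c)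
    supp-true b c h with ∨-true (b % t ≡ᵇ c) _ h
    ... | inj₁ eq = inj₁ (≡ᵇ-true⁻¹ eq)
    ... | inj₂ eq with ∧-true (not (c ≡ᵇ s)) _ eq
    ...   | c≢s , eq′ with eq-case c s
    ...     | inj₂ (neq , _) = inj₂ (neq , ≡ᵇ-true⁻¹ eq′)
    ...     | inj₁ (_ , eq″) = contradiction (trans (sym (cong not eq″)) c≢s) λ ()

    supp-class : ∀ {b c r} → c < t → r < s → supp b c ≡ true → b % t ≡ r ⊎ b % t ≡ dual r → c ≡ r ⊎ c ≡ dual r
    supp-class {b} {c} {r} c<t r<s h cls with supp-true b c h
    ... | inj₁ refl = cls
    ... | inj₂ (c≢s , eq) with cls
    ...   | inj₁ r≡ = inj₂ (trans (sym (dual-involutive (<s c<t c≢s))) (cong dual (trans (sym eq) r≡)))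
    ...   | inj₂ r≡ = inj₁ (trans (sym (dual-involutive (<s c<t c≢s))) (trans (cong dual (trans (sym eq) r≡)) (dual-involutive r<s)))

    supp-last : ∀ {b c} → c < t → supp b c ≡ true → b % t ≡ s → c ≡ s
    supp-last {b} {c} c<t h r≡s with supp-true b c h
    ... | inj₁ eq = trans (sym eq) r≡s
    ... | inj₂ (c≢s , eq) = ⊥-elim (<⇒≢ (dual<s (<s c<t c≢s)) (trans (sym eq) r≡s))

    pair-count-split : ∀ c → c < u → n c + n (dual c) ≡ countᵇ (λ b → (b % t ≡ᵇ c) ∨ (b % t ≡ᵇ dual c)) bs
    pair-count-split c c<u = sym (count-+ bs (λ {b} _ → pointwise b))
      where
      pointwise : ∀ b → ind ((b % t ≡ᵇ c) ∨ (b % t ≡ᵇ dual c)) ≡ ind (b % t ≡ᵇ c) + ind (b % t ≡ᵇ dual c)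
      pointwise b with eq-case (b % t) c
      ... | inj₁ (eq , eq′) rewrite eq′ | ≡ᵇ-false {b % t} {dual c} (λ eq″ → <⇒≢ (<dual c<u) (trans (sym eq) eq″)) = refl
      ... | inj₂ (_ , eq′)  rewrite eq′ = refl

    -- A permutation inside the support would send the beads of each class injectively to the
    -- columns of that class. No class would then be overfull, and `counts-from-≤` would give
    -- `Counts`.
    vanish-counts : ¬ Counts → D t Mx ≈ 0#
    vanish-counts ¬counts = D-support t (λ k j → supp (at bs k) (s ∸ j)) Mx
      (λ k j _ _ → supp-false (at bs k) (s ∸ j))
      λ φ φ< inj sup → ¬counts (counts φ φ< inj sup)
      where
      module _ (φ : ℕ → ℕ) (φ< : ∀ i → i < t → φ i < t) (inj : ∀ i k → i < t → k < t → φ i ≡ φ k → i ≡ k)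
               (sup : ∀ i → i < t → supp (at bs i) (s ∸ φ i) ≡ true) where
        Column : ℕ → ℕ → Set
        Column b col = ∃ λ k → k < t × at bs k ≡ b × col ≡ s ∸ φ k

        column : ∀ {b} → b ∈ bs → ∃ (Column b)
        column b∈ with ∈-at b∈
        ... | k , k<n , eq = _ , k , subst (k <_) len≡ k<n , eq , refl

        column< : ∀ {b col} → Column b col → col < t
        column< (k , _ , _ , refl) = s≤s (m∸n≤m s (φ k))

        column-supp : ∀ {b col} → Column b col → supp b col ≡ true
        column-supp (k , k<t , refl , refl) = sup k k<t

        column-inj : ∀ {x y a b} → Column x a → Column y b → x ≢ y → a ≢ b
        column-inj (k , k<t , refl , refl) (l , l<t , refl , refl) x≢y a≡b =
          x≢y (cong (at bs) (inj k l k<t l<t (∸-inj (≤-pred (φ< k k<t)) (≤-pred (φ< l l<t)) a≡b)))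

        last≤ : n s ≤ 1
        last≤ with n s ≤? 1
        ... | yes h = h
        ... | no h with count-∃₂ (λ b → b % t ≡ᵇ s) desc (≰⇒> h)
        ...   | x , y , (x∈ , px) , (y∈ , py) , x≢y with column x∈ | column y∈
        ...     | a , ca | b , cb = ⊥-elim (column-inj ca cb x≢y
          (trans (supp-last {x} (column< ca) (column-supp ca) (≡ᵇ-true⁻¹ px)) (sym (supp-last {y} (column< cb) (column-supp cb) (≡ᵇ-true⁻¹ py)))))

        mid≤ : e * n u ≤ e
        mid≤ = go e refl e≤1
          where
          go : ∀ e′ → e′ ≡ e → e′ ≤ 1 → e′ * n u ≤ e′
          go zero _ _ = z≤n
          go (suc (suc _)) _ (s≤s ())
          go (suc zero) eq _ with n u ≤? 1
          ... | yes h = ≤-trans (≤-reflexive (+-identityʳ (n u))) h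
          ... | no h with count-∃₂ (λ b → b % t ≡ᵇ u) desc (≰⇒> h)
          ...   | x , y , (x∈ , px) , (y∈ , py) , x≢y with column x∈ | column y∈
          ...     | a , ca | b , cb = ⊥-elim (column-inj ca cb x≢y (trans (only ca px) (sym (only cb py))))
            where
            only : ∀ {x a} → Column x a → (x % t ≡ᵇ u) ≡ true → a ≡ u
            only {x} ca px with supp-class {x} (column< ca) (u<s (sym eq)) (column-supp ca) (inj₁ (≡ᵇ-true⁻¹ px))
            ... | inj₁ a≡u = a≡u
            ... | inj₂ a≡  = trans a≡ (dual-mid (sym eq))

        pair≤ : ∀ c → c < u → n c + n (dual c) ≤ 2
        pair≤ c c<u rewrite pair-count-split c c<u with countᵇ (λ b → (b % t ≡ᵇ c) ∨ (b % t ≡ᵇ dual c)) bs ≤? 2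
        ... | yes h = h
        ... | no h with count-∃₃ (λ b → (b % t ≡ᵇ c) ∨ (b % t ≡ᵇ dual c)) desc (≰⇒> h)
        ...   | x , y , z , (x∈ , px) , (y∈ , py) , (z∈ , pz) , x≢y , x≢z , y≢z with column x∈ | column y∈ | column z∈
        ...     | a , ca | b , cb | d , cd = ⊥-elim (pigeon (only ca px) (only cb py) (only cd pz))
          where
          only : ∀ {x a} → Column x a → (x % t ≡ᵇ c) ∨ (x % t ≡ᵇ dual c) ≡ true → a ≡ c ⊎ a ≡ dual c
          only {x} ca px = supp-class {x} (column< ca) (<-≤-trans c<u u≤s) (column-supp ca) (cls (∨-true _ _ px))
            where
            cls : (x % t ≡ᵇ c) ≡ true ⊎ (x % t ≡ᵇ dual c) ≡ true → x % t ≡ c ⊎ x % t ≡ dual c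
            cls (inj₁ h) = inj₁ (≡ᵇ-true⁻¹ h)
            cls (inj₂ h) = inj₂ (≡ᵇ-true⁻¹ h)
          same : ∀ {a b v : ℕ} → a ≡ v → b ≡ v → a ≡ b
          same p q = trans p (sym q)
          pigeon : a ≡ c ⊎ a ≡ dual c → b ≡ c ⊎ b ≡ dual c → d ≡ c ⊎ d ≡ dual c → ⊥
          pigeon (inj₁ p) (inj₁ q) _        = column-inj ca cb x≢y (same p q)
          pigeon (inj₂ p) (inj₂ q) _        = column-inj ca cb x≢y (same p q)
          pigeon (inj₁ p) (inj₂ q) (inj₁ r) = column-inj ca cd x≢z (same p r)
          pigeon (inj₁ p) (inj₂ q) (inj₂ r) = column-inj cb cd y≢z (same q r)
          pigeon (inj₂ p) (inj₁ q) (inj₁ r) = column-inj cb cd y≢z (same q r)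
          pigeon (inj₂ p) (inj₁ q) (inj₂ r) = column-inj ca cd x≢z (same p r)

        counts : Counts
        counts = counts-from-≤ last≤ pair≤ mid≤

    -- Two big beads exhaust the pair, so neither residue has a small bead. Columns `c` and `dual c`
    -- then agree: small beads have zeros in both, and the entries of a big bead are symmetric under
    -- `dual`.
    vanish-big : (∀ x → x +ᴿ x ≈ 0# → x ≈ 0#) → Counts → ∀ c → c < u → ¬ (B c + B (dual c) ≤ 1) → D t Mx ≈ 0#
    vanish-big halve counts c c<u h =
      D-equal-columns halve t (s ∸ dual c) (s ∸ c) Mx (∸-monoʳ-< (<dual c<u) (<⇒≤ (dual<s c<s))) (s≤s (m∸n≤m s c))
        (λ k k<t → equal (at bs k) (at-∈ bs (at<len k<t)))
      where
      c<s : c < s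
      c<s = <-≤-trans c<u u≤s
      total : (B c + B (dual c)) + (S c + S (dual c)) ≡ 2
      total = trans (solve 4 (λ a b c d → (a :+ b) :+ (c :+ d) := (c :+ a) :+ (d :+ b)) refl (B c) (B (dual c)) (S c) (S (dual c)))
        (trans (sym (cong₂ _+_ (n-split c (m<n⇒m<1+n c<s)) (n-split (dual c) (m<n⇒m<1+n (dual<s c<s))))) (Counts.pair-count counts c c<u))
        where open +-*-Solver
      no-small : S c + S (dual c) ≡ 0
      no-small = n≤0⇒n≡0 (+-cancelˡ-≤ 2 _ _ (≤-trans (+-monoˡ-≤ _ (≰⇒> h)) (≤-reflexive total)))
      absent : ∀ {x b} → S x ≡ 0 → b ∈ bs → b ≢ x
      absent S≡0 b∈ refl = 1+n≢0 (trans (sym (small-count b∈)) S≡0)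
      equal : ∀ b → b ∈ bs → ent b (s ∸ (s ∸ dual c)) ≈ ent b (s ∸ (s ∸ c))
      equal b b∈ rewrite m∸[m∸n]≡n (<⇒≤ (dual<s c<s)) | m∸[m∸n]≡n (<⇒≤ c<s) with b <? t
      ... | yes b<t = ≈-trans
        (≈-trans (δ-≢ (absent (m+n≡0⇒n≡0 (S c) no-small) b∈ ∘ trans (sym (m<n⇒m%n≡m b<t))) ⟨+⟩ wrapped-small (dual c) (<⇒≢ (dual<s c<s)) b<t) (+-identityˡᴿ 0#))
        (≈-sym (≈-trans (δ-≢ (absent (m+n≡0⇒m≡0 (S c) no-small) b∈ ∘ trans (sym (m<n⇒m%n≡m b<t))) ⟨+⟩ wrapped-small c (<⇒≢ c<s) b<t) (+-identityˡᴿ 0#)))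
      ... | no b≮t = begin
        δ (b % t) (dual c) +ᴿ wrapped b (dual c)  ≈⟨ ≈-refl ⟨+⟩ wrapped-big (dual c) (<⇒≢ (dual<s c<s)) (≮⇒≥ b≮t) ⟩
        δ (b % t) (dual c) +ᴿ δ (b % t) (dual (dual c))   ≡⟨ cong (λ k → δ (b % t) (dual c) +ᴿ δ (b % t) k) (dual-involutive c<s) ⟩
        δ (b % t) (dual c) +ᴿ δ (b % t) c  ≈⟨ +-commᴿ _ _ ⟩
        δ (b % t) c +ᴿ δ (b % t) (dual c)  ≈⟨ ≈-refl ⟨+⟩ ≈-sym (wrapped-big c (<⇒≢ c<s) (≮⇒≥ b≮t)) ⟩
        δ (b % t) c +ᴿ wrapped b c  ∎

    ent-small : ∀ {b} c → b < s → ent b c ≈ δ b c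
    ent-small {b} c b<s with c ≟ s
    ... | yes refl = ≈-trans (≈-refl ⟨+⟩ ≈-trans (wrapped-last b s refl) (δ-≢ r≢s))
        (≈-trans (+-identityʳᴿ _) (reflexive (cong (λ r → δ r s) (m<n⇒m%n≡m (m<n⇒m<1+n b<s)))))
      where
      r≢s : b % t ≢ s
      r≢s eq = <⇒≢ b<s (trans (sym (m<n⇒m%n≡m (m<n⇒m<1+n b<s))) eq)
    ... | no c≢s = ≈-trans (≈-refl ⟨+⟩ wrapped-small c c≢s (m<n⇒m<1+n b<s))
        (≈-trans (+-identityʳᴿ _) (reflexive (cong (λ r → δ r c) (m<n⇒m%n≡m (m<n⇒m<1+n b<s)))))

    ent-big : ∀ {b} c → c < t → t ≤ b → b % t < s → ent b c ≈ δ (b % t) c +ᴿ δ (dual (b % t)) c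
    ent-big {b} c c<t t≤b r<s with c ≟ s
    ... | yes refl = ≈-refl ⟨+⟩ ≈-trans (wrapped-last b s refl) (≈-trans (δ-≢ (<⇒≢ r<s)) (≈-sym (δ-≢ (<⇒≢ (dual<s r<s)))))
    ... | no c≢s = ≈-refl ⟨+⟩ ≈-trans (wrapped-big c c≢s t≤b)
      (δ-cong (λ eq → trans (cong dual eq) (dual-involutive (<s c<t c≢s)))
              (λ eq → trans (sym (dual-involutive r<s)) (cong dual eq)))

    two : Carrier
    two = 1# +ᴿ 1#

    doubled : ℕ → Bool
    doubled b = (b % t ≡ᵇ s) ∨ ((e ≡ᵇ 1) ∧ (big b ∧ (b % t ≡ᵇ u)))

    weight : Bool → Carrier
    weight p = pow two (ind p)

    doubling : ∀ x → x +ᴿ x ≈ weight true *ᴿ x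
    doubling x = ≈-sym (≈-trans (*-identityʳᴿ two ⟨*⟩ ≈-refl)
      (≈-trans (distribʳ x 1# 1#) (*-identityˡᴿ x ⟨+⟩ *-identityˡᴿ x)))

    -- In the case `spread` the surplus vector is, for a small bead `g` elsewhere in the list,
    -- exactly the row of `g`. This is what makes the surplus disappear from the determinant.
    data Row (b : ℕ) : Set ℓ where
      scaled : (∀ c → c < t → ent b c ≈ weight (doubled b) *ᴿ δ (f b) c) → Row b
      spread : doubled b ≡ false → ∀ g → g ∈ bs → g < s → g ≢ b →
               (∀ c → c < t → ent b c ≈ δ (f b) c +ᴿ δ g c) → Row b

    module _ (good : Good) where
      open Good good

      f-single : ∀ {b} → b ∈ bs → n (b % t) ≡ 1 → f b ≡ b % t
      f-single {b} b∈ eq with b <? t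
      ... | yes b<t = trans (f-small b<t) (sym (m<n⇒m%n≡m b<t))
      ... | no b≮t with single (m%n<n b t) eq
      ...   | inj₁ (_ , B≡0) = ⊥-elim (1+n≰n (≤-trans (big-count b∈ (≮⇒≥ b≮t)) (≤-reflexive B≡0)))
      ...   | inj₂ (S≡0 , _) = f-free (≮⇒≥ b≮t) S≡0

      unweighted : ∀ {b} → doubled b ≡ false → (∀ c → c < t → ent b c ≈ δ (f b) c) → Row b
      unweighted {b} eq h = scaled λ c c<t → ≈-trans (h c c<t)
        (≈-sym (≈-trans (reflexive (cong (λ p → weight p *ᴿ δ (f b) c) eq)) (*-identityˡᴿ _)))

      double-row : ∀ {b} → doubled b ≡ true → (∀ c → c < t → ent b c ≈ δ (f b) c +ᴿ δ (f b) c) → Row b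
      double-row {b} eq h = scaled λ c c<t → ≈-trans (h c c<t)
        (≈-trans (doubling _) (reflexive (cong (λ p → weight p *ᴿ δ (f b) c) (sym eq))))

      not-doubled : ∀ {b} → b % t ≢ s → b % t ≢ u ⊎ e ≢ 1 ⊎ b < t → doubled b ≡ false
      not-doubled r≢s h rewrite ≡ᵇ-false r≢s = go h
        where
        go : ∀ {b} → b % t ≢ u ⊎ e ≢ 1 ⊎ b < t → (e ≡ᵇ 1) ∧ (big b ∧ (b % t ≡ᵇ u)) ≡ false
        go {b} (inj₁ r≢u) rewrite ≡ᵇ-false r≢u | ∧-zeroʳ (big b) = ∧-zeroʳ (e ≡ᵇ 1)
        go (inj₂ (inj₁ e≢1)) rewrite ≡ᵇ-false e≢1 = refl
        go (inj₂ (inj₂ b<t)) rewrite <ᵇ-true b<t = ∧-zeroʳ (e ≡ᵇ 1)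

      small-row : ∀ {b} → b < t → b % t < s → Row b
      small-row {b} b<t r<s = unweighted {b} (not-doubled {b} (<⇒≢ r<s) (inj₂ (inj₂ b<t)))
        (λ c _ → ≈-trans (ent-small c (subst (_< s) (m<n⇒m%n≡m b<t) r<s)) (reflexive (cong (λ x → δ x c) (sym (f-small b<t)))))

      last-row : ∀ {b} → b ∈ bs → b % t ≡ s → Row b
      last-row {b} b∈ r≡s = double-row {b} is-doubled λ c c<t →
        ≈-trans (entry c c<t) (reflexive (cong (λ x → δ x c +ᴿ δ x c) (sym f≡s)))
        where
        f≡s : f b ≡ s
        f≡s = trans (f-single b∈ (trans (cong n r≡s) last-count)) r≡s
        is-doubled : doubled b ≡ true
        is-doubled rewrite ≡ᵇ-true r≡s = refl
        entry : ∀ c → c < t → ent b c ≈ δ s c +ᴿ δ s c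
        entry c c<t with c ≟ s
        ... | yes refl = reflexive (cong (λ x → δ x s) r≡s) ⟨+⟩ ≈-trans (wrapped-last b s refl) (reflexive (cong (λ x → δ x s) r≡s))
        ... | no c≢s = reflexive (cong (λ x → δ x c) r≡s) ⟨+⟩ ≈-trans (zero′ (b <? t)) (≈-sym (δ-≢ (c≢s ∘ sym)))
          where
          zero′ : Dec (b < t) → wrapped b c ≈ 0#
          zero′ (yes b<t) = wrapped-small c c≢s b<t
          zero′ (no b≮t)  = ≈-trans (wrapped-big c c≢s (≮⇒≥ b≮t))
            (δ-≢ (λ eq → <⇒≢ (dual<s (<s c<t c≢s)) (trans (sym eq) r≡s)))

      mid-row : ∀ {b} → b ∈ bs → b % t ≡ u → e ≡ 1 → Row b
      mid-row {b} b∈ r≡u e≡1 = go (b <? t)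
        where
        r<s : b % t < s
        r<s = subst (_< s) (sym r≡u) (u<s e≡1)
        go : Dec (b < t) → Row b
        go (yes b<t) = small-row b<t r<s
        go (no b≮t) = double-row {b} is-doubled λ c c<t → ≈-trans (ent-big c c<t (≮⇒≥ b≮t) r<s)
          (reflexive (cong₂ (λ x y → δ x c +ᴿ δ y c) (sym f≡) (trans (cong dual r≡u) (trans (dual-mid e≡1) (trans (sym r≡u) (sym f≡))))))
          where
          f≡ : f b ≡ b % t
          f≡ = f-single b∈ (trans (cong n r≡u) (n-mid e≡1))
          is-doubled : doubled b ≡ true
          is-doubled rewrite ≡ᵇ-false (<⇒≢ r<s) | ≡ᵇ-true e≡1 | <ᵇ-false (≮⇒≥ b≮t) | ≡ᵇ-true r≡u = refl

      pair-row : ∀ {b} → b ∈ bs → b % t < s → b % t ≢ u ⊎ e ≢ 1 →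
        State (S (b % t)) (B (b % t)) (S (dual (b % t))) (B (dual (b % t))) → Row b
      pair-row {b} b∈ r<s r≢u st with b <? t
      ... | yes b<t = small-row b<t r<s
      ... | no b≮t = go refl refl refl st
        where
        t≤b = ≮⇒≥ b≮t
        r = b % t
        plain : doubled b ≡ false
        plain = not-doubled {b} (<⇒≢ r<s) (weaken r≢u)
          where
          weaken : b % t ≢ u ⊎ e ≢ 1 → b % t ≢ u ⊎ e ≢ 1 ⊎ b < t
          weaken (inj₁ h) = inj₁ h
          weaken (inj₂ h) = inj₂ (inj₁ h)
        no-big : B r ≡ 0 → ⊥
        no-big eq = 1+n≰n (≤-trans (big-count b∈ t≤b) (≤-reflexive eq))
        small≢ : ∀ {g} → g < s → g ≢ b
        small≢ g<s = <⇒≢ (<-≤-trans (m<n⇒m<1+n g<s) t≤b)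
        go : ∀ {a₁ a₂ a₃ a₄} → S r ≡ a₁ → B r ≡ a₂ → S (dual r) ≡ a₃ → State a₁ a₂ a₃ a₄ → Row b
        go h₁ h₂ h₃ small-small  = ⊥-elim (no-big h₂)
        go h₁ h₂ h₃ small-big    = ⊥-elim (no-big h₂)
        go h₁ h₂ h₃ double-right = ⊥-elim (no-big h₂)
        go h₁ h₂ h₃ double-left  = spread plain r (small-bead h₁) r<s (small≢ r<s) λ c c<t →
          ≈-trans (ent-big c c<t t≤b r<s) (≈-trans (+-commᴿ _ _) (reflexive (cong (λ x → δ x c +ᴿ δ r c) (sym (f-taken t≤b h₁)))))
        go h₁ h₂ h₃ big-small    = spread plain (dual r) (small-bead h₃) (dual<s r<s) (small≢ (dual<s r<s)) λ c c<t →
          ≈-trans (ent-big c c<t t≤b r<s) (reflexive (cong (λ x → δ x c +ᴿ δ (dual r) c) (sym (f-free t≤b h₁))))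

      row : ∀ {b} → b ∈ bs → Row b
      row {b} b∈ = go (residue (b % t) (m%n<n b t))
        where
        go : Residue (b % t) → Row b
        go (last r≡s)       = last-row b∈ r≡s
        go (mid r≡u e≡1)    = mid-row b∈ r≡u e≡1
        go (lower r<u)      = pair-row b∈ (<-≤-trans r<u u≤s) (inj₁ (<⇒≢ r<u)) (lower-state good r<u)
        go (upper r<s r′<u) = pair-row b∈ r<s not-mid (State-swap (upper-state good r<s r′<u))
          where
          not-mid : b % t ≢ u ⊎ e ≢ 1
          not-mid with e ≟ 1
          ... | no e≢1 = inj₂ e≢1
          ... | yes e≡1 = inj₁ λ r≡u → <-irrefl (trans (cong dual r≡u) (dual-mid e≡1)) r′<u

      Fx : Matrix
      Fx k j = δ (f (at bs k)) (s ∸ j)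

      partial : ℕ → Matrix
      partial m k = if k <ᵇ m then Fx k else Mx k

      partial-below : ∀ {m k} j → k < m → partial m k j ≈ Fx k j
      partial-below j k<m rewrite <ᵇ-true k<m = ≈-refl

      partial-above : ∀ {m k} j → m ≤ k → partial m k j ≈ Mx k j
      partial-above j m≤k rewrite <ᵇ-false m≤k = ≈-refl

      partial-other : ∀ m k j → k ≢ m → partial m k j ≈ partial (suc m) k j
      partial-other m k j k≢m with k <? m
      ... | yes k<m = ≈-trans (partial-below {m} j k<m) (≈-sym (partial-below {suc m} j (m<n⇒m<1+n k<m)))
      ... | no k≮m  = ≈-trans (partial-above {m} j (≮⇒≥ k≮m)) (≈-sym (partial-above {suc m} j (≤∧≢⇒< (≮⇒≥ k≮m) (k≢m ∘ sym))))

      δ-reflect : ∀ {g j} → g ≤ s → j ≤ s → δ g (s ∸ j) ≈ δ (s ∸ g) j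
      δ-reflect g≤s j≤s = δ-cong (λ eq → trans (cong (s ∸_) eq) (m∸[m∸n]≡n j≤s))
                                 (λ eq → trans (sym (m∸[m∸n]≡n g≤s)) (cong (s ∸_) eq))

      -- In the case `spread`, linearity leaves a second determinant whose rows `m` and `k` are the
      -- same unit vector. It does not matter whether row `k` has been replaced already, because `f`
      -- fixes the small bead `g`.
      reduce : ∀ m → m < t → D t (partial m) ≈ weight (doubled (at bs m)) *ᴿ D t (partial (suc m))
      reduce m m<t with row (at-∈ bs (at<len m<t))
      ... | scaled h = ≈-trans
        (D-row t m (partial m) (partial (suc m)) (partial (suc m)) w 0# m<t
          (λ k j _ _ k≢m → partial-other m k j k≢m) (λ k j _ _ k≢m → partial-other m k j k≢m)
          (λ j j<t → begin
            partial m m j  ≈⟨ partial-above {m} j ≤-refl ⟩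
            Mx m j  ≈⟨ h (s ∸ j) (s≤s (m∸n≤m s j)) ⟩
            w *ᴿ Fx m j  ≈⟨ ≈-refl ⟨*⟩ ≈-sym (partial-below {suc m} j (n<1+n m)) ⟩
            w *ᴿ partial (suc m) m j  ≈⟨ ≈-sym (≈-trans (≈-refl ⟨+⟩ zeroˡ _) (+-identityʳᴿ _)) ⟩
            w *ᴿ partial (suc m) m j +ᴿ 0# *ᴿ partial (suc m) m j       ∎))
        (≈-trans (≈-refl ⟨+⟩ zeroˡ _) (+-identityʳᴿ _))
        where w = weight (doubled (at bs m))
      ... | spread plain g g∈ g<s g≢b h with ∈-at g∈
      ...   | k , k<n , refl = begin
        D t (partial m)
          ≈⟨ D-row t m (partial m) (partial (suc m)) other 1# 1# m<t
               (λ k j _ _ k≢m → partial-other m k j k≢m) (λ k j _ _ k≢m → ≈-sym (other-off j k≢m))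
               (λ j j<t → ≈-trans (partial-above {m} j ≤-refl) (≈-trans (h (s ∸ j) (s≤s (m∸n≤m s j)))
                 (≈-trans (≈-sym (partial-below {suc m} j (n<1+n m))) (≈-sym (*-identityˡᴿ _)) ⟨+⟩
                  ≈-trans (≈-sym (other-on j)) (≈-sym (*-identityˡᴿ _))))) ⟩
        1# *ᴿ D t (partial (suc m)) +ᴿ 1# *ᴿ D t other
          ≈⟨ ≈-refl ⟨+⟩ ≈-trans (≈-refl ⟨*⟩ D-two-units t m k (s ∸ at bs k) other m<t k<t m≢k
               (λ j j<t → ≈-trans (other-on j) (δ-reflect (<⇒≤ g<s) (≤-pred j<t)))
               (λ j j<t → ≈-trans (≈-trans (other-off j (m≢k ∘ sym)) (unit j (k <? m))) (δ-reflect (<⇒≤ g<s) (≤-pred j<t)))) (zeroʳ 1#) ⟩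
        1# *ᴿ D t (partial (suc m)) +ᴿ 0#
          ≈⟨ +-identityʳᴿ _ ⟩
        1# *ᴿ D t (partial (suc m))
          ≡⟨ cong (λ p → weight p *ᴿ D t (partial (suc m))) (sym plain) ⟩
        weight (doubled (at bs m)) *ᴿ D t (partial (suc m)) ∎
        where
        k<t : k < t
        k<t = subst (k <_) len≡ k<n
        m≢k : m ≢ k
        m≢k refl = g≢b refl
        other : Matrix
        other i j = if i ≡ᵇ m then δ (at bs k) (s ∸ j) else partial m i j
        other-on : ∀ j → other m j ≈ δ (at bs k) (s ∸ j)
        other-on j rewrite ≡ᵇ-refl m = ≈-refl
        other-off : ∀ {i} j → i ≢ m → other i j ≈ partial m i j
        other-off j i≢m rewrite ≡ᵇ-false i≢m = ≈-refl
        unit : ∀ j → Dec (k < m) → partial m k j ≈ δ (at bs k) (s ∸ j)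
        unit j (yes k<m) = ≈-trans (partial-below {m} j k<m) (reflexive (cong (λ x → δ x (s ∸ j)) (f-small (m<n⇒m<1+n g<s))))
        unit j (no k≮m)  = ≈-trans (partial-above {m} j (≮⇒≥ k≮m)) (ent-small (s ∸ j) g<s)

      pow-+ : ∀ x a b → pow x (a + b) ≈ pow x a *ᴿ pow x b
      pow-+ x zero    b = ≈-sym (*-identityˡᴿ _)
      pow-+ x (suc a) b = ≈-trans (≈-refl ⟨*⟩ pow-+ x a b) (≈-sym (*-assocᴿ _ _ _))

      reduce-all : ∀ m → m ≤ t → D t Mx ≈ pow two (∑ m (λ k → ind (doubled (at bs k)))) *ᴿ D t (partial m)
      reduce-all zero    _   = ≈-sym (*-identityˡᴿ _)
      reduce-all (suc m) m<t = begin
        D t Mx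
          ≈⟨ reduce-all m (<⇒≤ m<t) ⟩
        pow two (∑ m w) *ᴿ D t (partial m)
          ≈⟨ ≈-refl ⟨*⟩ reduce m m<t ⟩
        pow two (∑ m w) *ᴿ (pow two (w m) *ᴿ D t (partial (suc m)))
          ≈⟨ ≈-sym (*-assocᴿ _ _ _) ⟩
        (pow two (∑ m w) *ᴿ pow two (w m)) *ᴿ D t (partial (suc m))
          ≈⟨ ≈-trans (≈-sym (pow-+ two (∑ m w) (w m))) (reflexive (cong (pow two) (sym (∑-last m w)))) ⟨*⟩ ≈-refl ⟩
        pow two (∑ (suc m) w) *ᴿ D t (partial (suc m)) ∎
        where
        w : ℕ → ℕ
        w k = ind (doubled (at bs k))

      -- The leading 1 is the unique bead of residue `s`, whose factor 2 will cancel `half`; the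
      -- other term is the possible big bead of the self-dual residue.
      doubled-count : countᵇ doubled bs ≡ suc (e * B u)
      doubled-count = trans (count-+ bs (λ {b} _ → pointwise b)) (cong₂ _+_ last-count (extra e refl e≤1))
        where
        pointwise : ∀ b → ind (doubled b) ≡ ind (b % t ≡ᵇ s) + ind ((e ≡ᵇ 1) ∧ (big b ∧ (b % t ≡ᵇ u)))
        pointwise b with eq-case (b % t) s
        ... | inj₂ (_ , eq) rewrite eq = refl
        ... | inj₁ (r≡s , eq) rewrite eq with e ≟ 1
        ...   | no e≢1 rewrite ≡ᵇ-false e≢1 = refl
        ...   | yes e≡1 rewrite ≡ᵇ-false {b % t} {u} (λ r≡u → <⇒≢ (u<s e≡1) (trans (sym r≡u) r≡s)) | ∧-zeroʳ (big b) | ∧-zeroʳ (e ≡ᵇ 1) = refl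
        extra : ∀ e′ → e′ ≡ e → e′ ≤ 1 → countᵇ (λ b → (e ≡ᵇ 1) ∧ (big b ∧ (b % t ≡ᵇ u))) bs ≡ e′ * B u
        extra zero       refl _ = count-zero bs (λ _ → refl)
        extra (suc zero) refl _ = sym (+-identityʳ (B u))
        extra (suc (suc _)) _ (s≤s ())

      reflect-perm : IsPerm t (map (s ∸_) (map f bs))
      reflect-perm = trans (length-map (s ∸_) (map f bs)) (proj₁ (perm good)) , λ c c<t →
        trans (count-map (_≡ᵇ c) (s ∸_) (map f bs)) (trans (count-cong (map f bs) (λ {x} x∈ →
          bool-iff {s ∸ x ≡ᵇ c} {x ≡ᵇ s ∸ c}
            (λ h → ≡ᵇ-true (trans (sym (m∸[m∸n]≡n (≤-pred (IsPerm-< (perm good) x∈)))) (cong (s ∸_) (≡ᵇ-true⁻¹ {s ∸ x} {c} h))))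
            (λ h → ≡ᵇ-true (trans (cong (s ∸_) (≡ᵇ-true⁻¹ {x} {s ∸ c} h)) (m∸[m∸n]≡n (≤-pred c<t))))))
          (proj₂ (perm good) (s ∸ c) (s≤s (m∸n≤m s c))))

      evaluate : D t Mx ≈ pow two (suc (e * B u)) *ᴿ sg (par (inversions (map (s ∸_) (map f bs))))
      evaluate = begin
        D t Mx
          ≈⟨ reduce-all t ≤-refl ⟩
        pow two (∑ t (λ k → ind (doubled (at bs k)))) *ᴿ D t (partial t)
          ≡⟨ cong (λ k → pow two k *ᴿ D t (partial t)) (trans (cong (λ k → ∑ k (λ k → ind (doubled (at bs k)))) (sym len≡)) (trans (∑-at doubled bs) doubled-count)) ⟩
        pow two (suc (e * B u)) *ᴿ D t (partial t)
          ≈⟨ ≈-refl ⟨*⟩ ≈-trans (D-cong t final) (D-perm t (map (s ∸_) (map f bs)) reflect-perm) ⟩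
        pow two (suc (e * B u)) *ᴿ sg (par (inversions (map (s ∸_) (map f bs)))) ∎
        where
        final : ∀ k j → k < t → j < t → partial t k j ≈ δ (at (map (s ∸_) (map f bs)) k) j
        final k j k<t j<t = begin
          partial t k j  ≈⟨ partial-below {t} j k<t ⟩
          δ (f (at bs k)) (s ∸ j)  ≈⟨ δ-reflect (≤-pred (IsPerm-< (perm good) (∈-map⁺ f (at-∈ bs (at<len k<t))))) (≤-pred j<t) ⟩
          δ (s ∸ f (at bs k)) j  ≡⟨ cong (λ x → δ x j) (sym (trans (at-map (s ∸_) (map f bs) (subst (k <_) (sym (length-map f bs)) (at<len k<t)))
                                                          (cong (s ∸_) (at-map f bs (at<len k<t))))) ⟩
          δ (at (map (s ∸_) (map f bs)) k) j  ∎

    -- Matrix entries from the values of the complete homogeneous polynomials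

    module Entries (Z : List Carrier) (hList≈ : ∀ k → hList Z k ≈ δ (k % t) 0) where

      h-⊖-≥ : ∀ {a m} → m ≤ a → h Z (a ⊖ m) ≈ δ ((a ∸ m) % t) 0
      h-⊖-≥ {a} {m} m≤a = ≈-trans (reflexive (cong (h Z) (ℤ.⊖-≥ m≤a))) (hList≈ (a ∸ m))

      h-⊖-< : ∀ {a m} → a < m → h Z (a ⊖ m) ≈ 0#
      h-⊖-< {a} {m} a<m = ≈-trans (reflexive (cong (h Z) (ℤ.⊖-< a<m))) (negative (m ∸ a) (m<n⇒0<n∸m a<m))
        where
        negative : ∀ k → 0 < k → h Z (ℤ.- (ℤ.+ k)) ≈ 0#
        negative (suc k) _ = ≈-refl

      -- The bound on `m` absorbs the negative indices: for `a < m` the residue of `a` is `a`, hence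
      -- not `m`, and both sides vanish.
      h-⊖ : ∀ a {m} → m < t → h Z (a ⊖ m) ≈ δ (a % t) m
      h-⊖ a {m} m<t with a <? m
      ... | yes a<m = ≈-trans (h-⊖-< a<m) (≈-sym (δ-≢ (λ eq → <⇒≢ a<m (trans (sym (m<n⇒m%n≡m (<-trans a<m m<t))) eq))))
      ... | no a≮m = ≈-trans (h-⊖-≥ m≤a) (δ-cong to from)
        where
        m≤a = ≮⇒≥ a≮m
        to : (a ∸ m) % t ≡ 0 → a % t ≡ m
        to eq = trans (cong (_% t) (trans (sym (m+[n∸m]≡n m≤a)) (cong (m +_) (trans (m≡m%n+[m/n]*n (a ∸ m) t) (cong (_+ q * t) eq)))))
          (trans ([m+kn]%n≡m%n m q t) (m<n⇒m%n≡m m<t))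
          where q = (a ∸ m) / t
        from : a % t ≡ m → (a ∸ m) % t ≡ 0
        from eq = trans (cong (_% t) (trans (cong (_∸ m) (trans (m≡m%n+[m/n]*n a t) (cong (_+ a / t * t) eq))) (m+n∸m≡n m (a / t * t))))
          (m*n%n≡0 (a / t) t)

      entry : ∀ l i j → i ≤ s → j ≤ s →
        h Z (((ℤ.+ l) ℤ.- (ℤ.+ suc i)) ℤ.+ (ℤ.+ suc j)) +ᴿ h Z ((((ℤ.+ l) ℤ.- (ℤ.+ suc i)) ℤ.- (ℤ.+ suc j)) ℤ.+ (ℤ.+ 2))
        ≈ ent (l + (s ∸ i)) (s ∸ j)
      entry l i j i≤s j≤s = ≈-trans (reflexive (cong (h Z) first)) (h-⊖ b (s≤s (m∸n≤m s j))) ⟨+⟩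
        ≈-trans (reflexive (cong (h Z) second)) (wrap j j≤s)
        where
        b = l + (s ∸ i)
        first : ((ℤ.+ l) ℤ.- (ℤ.+ suc i)) ℤ.+ (ℤ.+ suc j) ≡ b ⊖ (s ∸ j)
        first = trans (solve 5 (λ L I J A C → (L :- (con (ℤ.+ 1) :+ I)) :+ (con (ℤ.+ 1) :+ J) := ((L :+ A) :- C) :+ ((J :+ C) :- (I :+ A))) refl (ℤ.+ l) (ℤ.+ i) (ℤ.+ j) A C)
          (trans (cong (λ k → ((ℤ.+ l ℤ.+ A) ℤ.- C) ℤ.+ (k ℤ.- (ℤ.+ i ℤ.+ A))) (sym balance))
            (trans (solve 2 (λ x y → x :+ (y :- y) := x) refl ((ℤ.+ l ℤ.+ A) ℤ.- C) (ℤ.+ i ℤ.+ A)) (ℤ.m-n≡m⊖n b (s ∸ j))))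
          where
          open ℤ.+-*-Solver
          A = ℤ.+ (s ∸ i)
          C = ℤ.+ (s ∸ j)
          balance : ℤ.+ i ℤ.+ A ≡ ℤ.+ j ℤ.+ C
          balance = cong ℤ.+_ (trans (m+[n∸m]≡n i≤s) (sym (m+[n∸m]≡n j≤s)))
        second : (((ℤ.+ l) ℤ.- (ℤ.+ suc i)) ℤ.- (ℤ.+ suc j)) ℤ.+ (ℤ.+ 2) ≡ b ⊖ (s + j)
        second = trans (solve 4 (λ L I J A → ((L :- (con (ℤ.+ 1) :+ I)) :- (con (ℤ.+ 1) :+ J)) :+ con (ℤ.+ 2) := (L :+ A) :- ((I :+ A) :+ J)) refl (ℤ.+ l) (ℤ.+ i) (ℤ.+ j) (ℤ.+ (s ∸ i)))
          (trans (ℤ.m-n≡m⊖n b ((i + (s ∸ i)) + j)) (cong (λ k → b ⊖ (k + j)) (m+[n∸m]≡n i≤s)))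
          where open ℤ.+-*-Solver
        wrap : ∀ j → j ≤ s → h Z (b ⊖ (s + j)) ≈ wrapped b (s ∸ j)
        wrap zero    _   = ≈-trans (reflexive (cong (λ k → h Z (b ⊖ k)) (+-identityʳ s))) (≈-trans (h-⊖ b (n<1+n s)) (≈-sym (wrapped-last b s refl)))
        -- The subtrahend `s + suc j` equals `t + j`: a small bead gets a negative index, and a big
        -- one loses a whole period.
        wrap (suc j) j<s with b <? t
        ... | yes b<t = ≈-trans (h-⊖-< (<-≤-trans b<t (subst (t ≤_) (sym (+-suc s j)) (s≤s (m≤m+n s j))))) (≈-sym (wrapped-small _ (<⇒≢ (dual<s j<s)) b<t))
        ... | no b≮t = begin
          h Z (b ⊖ (s + suc j))  ≡⟨ cong₂ (λ x y → h Z (x ⊖ y)) (sym (m+[n∸m]≡n t≤b)) (+-suc s j) ⟩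
          h Z ((t + (b ∸ t)) ⊖ (t + j))      ≡⟨ cong (h Z) (ℤ.+-cancelˡ-⊖ t (b ∸ t) j) ⟩
          h Z ((b ∸ t) ⊖ j)  ≈⟨ h-⊖ (b ∸ t) (m<n⇒m<1+n j<s) ⟩
          δ ((b ∸ t) % t) j  ≡⟨ cong₂ δ (trans (sym ([m+n]%n≡m%n (b ∸ t) t)) (cong (_% t) (m∸n+n≡m t≤b))) (sym (dual-involutive j<s)) ⟩
          δ (b % t) (dual (dual j))  ≈⟨ ≈-sym (wrapped-big _ (<⇒≢ (dual<s j<s)) t≤b) ⟩
          wrapped b (dual j)  ∎
          where t≤b = ≮⇒≥ b≮t

  -- The sign

  xor-move : ∀ a b c → a xor b ≡ c → a ≡ c xor b
  xor-move true  true  _ refl = refl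
  xor-move true  false _ refl = refl
  xor-move false true  _ refl = refl
  xor-move false false _ refl = refl

  inversions-insert : ∀ xs v ys →
    inversions (xs ++ v ∷ ys) ≡ inversions (xs ++ ys) + (countᵇ (v <ᵇ_) xs + countᵇ (_<ᵇ v) ys)
  inversions-insert []       v ys = +-comm (countᵇ (_<ᵇ v) ys) (inversions ys)
  inversions-insert (x ∷ xs) v ys
    rewrite count-++ (_<ᵇ x) xs (v ∷ ys) | count-++ (_<ᵇ x) xs ys | count-∷ (_<ᵇ x) v ys | count-∷ (v <ᵇ_) x xs
          | inversions-insert xs v ys =
    solve 6 (λ a b c d e f → (a :+ (b :+ c)) :+ (d :+ (e :+ f)) := ((a :+ c) :+ d) :+ ((b :+ e) :+ f)) refl
      (countᵇ (_<ᵇ x) xs) (ind (v <ᵇ x)) (countᵇ (_<ᵇ x) ys) (inversions (xs ++ ys)) (countᵇ (v <ᵇ_) xs) (countᵇ (_<ᵇ v) ys)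
    where open +-*-Solver

  between : ℕ → ℕ → ℕ → Bool
  between v w x = (v <ᵇ x) ∧ (x <ᵇ w)

  split-above : ∀ {v w} → v < w → ∀ x → ind (v <ᵇ x) ≡ ind (between v w x) + (ind (x ≡ᵇ w) + ind (w <ᵇ x))
  split-above {v} {w} v<w x with <-cmp x w
  ... | tri≈ _ refl _ rewrite <ᵇ-true v<w | <ᵇ-false (≤-refl {x}) | ≡ᵇ-refl x = refl
  ... | tri> _ x≢w w<x rewrite <ᵇ-true (<-trans v<w w<x) | <ᵇ-false (<⇒≤ w<x) | ≡ᵇ-false x≢w | <ᵇ-true w<x = refl
  ... | tri< x<w x≢w _ rewrite <ᵇ-true x<w | ≡ᵇ-false x≢w | <ᵇ-false (<⇒≤ x<w) | ∧-identityʳ (v <ᵇ x) = sym (+-identityʳ _)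

  split-below : ∀ {v w} → v < w → ∀ x → ind (x <ᵇ w) ≡ ind (between v w x) + (ind (x ≡ᵇ v) + ind (x <ᵇ v))
  split-below {v} {w} v<w x with <-cmp x v
  ... | tri≈ _ refl _ rewrite <ᵇ-true v<w | <ᵇ-false (≤-refl {x}) | ≡ᵇ-refl x = refl
  ... | tri< x<v x≢v _ rewrite <ᵇ-true (<-trans x<v v<w) | <ᵇ-false (<⇒≤ x<v) | ≡ᵇ-false x≢v | <ᵇ-true x<v = refl
  ... | tri> _ x≢v v<x rewrite <ᵇ-true v<x | ≡ᵇ-false x≢v | <ᵇ-false (<⇒≤ v<x) = sym (+-identityʳ _)

  count-+₃ : ∀ {p q r r′} xs → (∀ x → ind (p x) ≡ ind (q x) + (ind (r x) + ind (r′ x))) →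
    countᵇ p xs ≡ countᵇ q xs + (countᵇ r xs + countᵇ r′ xs)
  count-+₃                  []       h = refl
  count-+₃ {p} {q} {r} {r′} (x ∷ xs) h
    rewrite count-∷ p x xs | count-∷ q x xs | count-∷ r x xs | count-∷ r′ x xs | h x | count-+₃ {p} {q} {r} {r′} xs h =
    solve 6 (λ a b c d e f → (a :+ (b :+ c)) :+ (d :+ (e :+ f)) := (a :+ d) :+ ((b :+ e) :+ (c :+ f))) refl
      (ind (q x)) (ind (r x)) (ind (r′ x)) _ _ _
    where open +-*-Solver

  -- Raising one entry from v to w creates or destroys an inversion with every entry in between.
  inversions-raise : ∀ xs ys {v w} → v < w →
    par (inversions (xs ++ w ∷ ys)) ≡
    par (inversions (xs ++ v ∷ ys)) xor (par (countᵇ (between v w) (xs ++ ys)) xor (par (countᵇ (_≡ᵇ w) xs) xor par (countᵇ (_≡ᵇ v) ys)))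
  inversions-raise xs ys {v} {w} v<w = begin
    par (inversions (xs ++ w ∷ ys))
      ≡⟨ cong par (inversions-insert xs w ys) ⟩
    par (i + (a + countᵇ (_<ᵇ w) ys))
      ≡⟨ cong (λ k → par (i + (a + k))) (count-+₃ {_<ᵇ w} {between v w} {_≡ᵇ v} {_<ᵇ v} ys (split-below v<w)) ⟩
    par (i + (a + (by + (ev + lv))))
      ≡⟨ trans (par-+ i _) (cong (par i xor_) (trans (par-+ a _) (cong (par a xor_) (trans (par-+ by _) (cong (par by xor_) (par-+ ev lv)))))) ⟩
    par i xor (par a xor (par by xor (par ev xor par lv)))
      ≡⟨ solve 7 (λ i a bx by ew ev lv → i :+ (a :+ (by :+ (ev :+ lv))) :=
           (i :+ ((bx :+ (ew :+ a)) :+ lv)) :+ ((bx :+ by) :+ (ew :+ ev))) refl (par i) (par a) (par bx) (par by) (par ew) (par ev) (par lv) ⟩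
    (par i xor ((par bx xor (par ew xor par a)) xor par lv)) xor ((par bx xor par by) xor (par ew xor par ev))
      ≡⟨ cong₂ _xor_ (sym lhs) (cong (_xor (par ew xor par ev)) (sym (trans (cong par (count-++ (between v w) xs ys)) (par-+ bx by)))) ⟩
    par (inversions (xs ++ v ∷ ys)) xor (par (countᵇ (between v w) (xs ++ ys)) xor (par ew xor par ev)) ∎
    where
    open ≡-Reasoning
    open xor-∧-Solver
    i = inversions (xs ++ ys)
    a = countᵇ (w <ᵇ_) xs
    bx = countᵇ (between v w) xs
    by = countᵇ (between v w) ys
    ew = countᵇ (_≡ᵇ w) xs
    ev = countᵇ (_≡ᵇ v) ys
    lv = countᵇ (_<ᵇ v) ys
    lhs : par (inversions (xs ++ v ∷ ys)) ≡ par i xor ((par bx xor (par ew xor par a)) xor par lv)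
    lhs = begin
      par (inversions (xs ++ v ∷ ys))
        ≡⟨ cong par (inversions-insert xs v ys) ⟩
      par (i + (countᵇ (v <ᵇ_) xs + lv))
        ≡⟨ cong (λ k → par (i + (k + lv))) (count-+₃ {v <ᵇ_} {between v w} {_≡ᵇ w} {w <ᵇ_} xs (split-above v<w)) ⟩
      par (i + ((bx + (ew + a)) + lv))
        ≡⟨ trans (par-+ i _) (cong (par i xor_) (trans (par-+ (bx + (ew + a)) lv) (cong (_xor par lv) (trans (par-+ bx _) (cong (par bx xor_) (par-+ ew a)))))) ⟩
      par i xor ((par bx xor (par ew xor par a)) xor par lv) ∎

  -- The number `n (n − 1) / 2` of pairs of positions.
  tri : ℕ → ℕ
  tri zero    = 0
  tri (suc n) = n + tri n

  par-tri : ∀ e u → e ≤ 1 → par (tri (suc (e + (u + u)))) ≡ par u xor par e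
  par-tri zero          zero    _ = refl
  par-tri (suc zero)    zero    _ = refl
  par-tri (suc (suc _)) zero    (s≤s ())
  par-tri e             (suc u) e≤1 = begin
    par (tri (suc (e + (suc u + suc u))))
      ≡⟨ cong (λ k → par (tri (suc k))) (trans (cong (e +_) (cong suc (+-suc u u))) (trans (+-suc e _) (cong suc (+-suc e _)))) ⟩
    par (suc (suc m) + (suc m + tri (suc m)))
      ≡⟨ trans (par-+ (suc (suc m)) _) (cong (par (suc (suc m)) xor_) (par-+ (suc m) _)) ⟩
    not (not (par m)) xor (not (par m) xor par (tri (suc m)))
      ≡⟨ collapse (par m) (par (tri (suc m))) ⟩
    not (par (tri (suc m)))
      ≡⟨ cong not (par-tri e u e≤1) ⟩
    not (par u xor par e)
      ≡⟨ not-distribˡ-xor (par u) (par e) ⟩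
    not (par u) xor par e ∎
    where
    open ≡-Reasoning
    m = e + (u + u)
    collapse : ∀ p q → not (not p) xor (not p xor q) ≡ not q
    collapse true  q = refl
    collapse false q = refl

  -- Reflection reverses the order, so each pair of distinct entries is an inversion of exactly one
  -- of the two lists.
  inversions-reflect : ∀ s xs → (∀ {x} → x ∈ xs → x ≤ s) → (∀ y → countᵇ (_≡ᵇ y) xs ≤ 1) →
    inversions (map (s ∸_) xs) + inversions xs ≡ tri (length xs)
  inversions-reflect s []       _ _ = refl
  inversions-reflect s (x ∷ xs) ≤s h = begin
    (countᵇ (_<ᵇ s ∸ x) (map (s ∸_) xs) + inversions (map (s ∸_) xs)) + (countᵇ (_<ᵇ x) xs + inversions xs)
      ≡⟨ solve 4 (λ a b c d → (a :+ b) :+ (c :+ d) := (a :+ c) :+ (b :+ d)) refl (countᵇ (_<ᵇ s ∸ x) (map (s ∸_) xs)) _ _ _ ⟩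
    (countᵇ (_<ᵇ s ∸ x) (map (s ∸_) xs) + countᵇ (_<ᵇ x) xs) + (inversions (map (s ∸_) xs) + inversions xs)
      ≡⟨ cong₂ _+_ pairs (inversions-reflect s xs (≤s ∘ there) weaken) ⟩
    length xs + tri (length xs) ∎
    where
    open ≡-Reasoning
    open +-*-Solver
    weaken : ∀ y → countᵇ (_≡ᵇ y) xs ≤ 1
    weaken y = ≤-trans (m≤n+m _ _) (≤-trans (≤-reflexive (sym (count-∷ (_≡ᵇ y) x xs))) (h y))
    distinct : ∀ {y} → y ∈ xs → y ≢ x
    distinct y∈ refl = 1+n≰n (≤-trans (s≤s (∃-count xs y∈ (≡ᵇ-refl x)))
      (≤-trans (≤-reflexive (trans (cong (λ p → ind p + countᵇ (_≡ᵇ x) xs) (sym (≡ᵇ-refl x))) (sym (count-∷ (_≡ᵇ x) x xs)))) (h x)))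
    one : ∀ {y} → y ∈ xs → 1 ≡ ind (s ∸ y <ᵇ s ∸ x) + ind (y <ᵇ x)
    one {y} y∈ with <-cmp y x
    ... | tri< y<x _ _ rewrite <ᵇ-true y<x | <ᵇ-false (∸-monoʳ-≤ s (<⇒≤ y<x)) = refl
    ... | tri≈ _ y≡x _ = ⊥-elim (distinct y∈ y≡x)
    ... | tri> _ _ x<y rewrite <ᵇ-false (<⇒≤ x<y) | <ᵇ-true (∸-monoʳ-< x<y (≤s (there y∈))) = refl
    pairs : countᵇ (_<ᵇ s ∸ x) (map (s ∸_) xs) + countᵇ (_<ᵇ x) xs ≡ length xs
    pairs = trans (cong (_+ countᵇ (_<ᵇ x) xs) (count-map (_<ᵇ s ∸ x) (s ∸_) xs))
      (trans (sym (count-+ {λ _ → true} xs one)) (count-all xs (λ _ → refl)))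

  Desc-split : ∀ xs {b ys} → Desc (xs ++ b ∷ ys) → All (_> b) xs × All (b >_) ys
  Desc-split []       (b> ∷ _) = [] , b>
  Desc-split (x ∷ xs) (x> ∷ d) with Desc-split xs d
  ... | xs> , ys< = All.lookup x> (∈-++⁺ʳ xs (here refl)) ∷ xs> , ys<

  map-cong-∈ : ∀ {g h : ℕ → ℕ} xs → (∀ {x} → x ∈ xs → g x ≡ h x) → map g xs ≡ map h xs
  map-cong-∈ []       eq = refl
  map-cong-∈ (x ∷ xs) eq = cong₂ _∷_ (eq (here refl)) (map-cong-∈ xs (eq ∘ there))

  module Parity (e u : ℕ) (e≤1 : e ≤ 1) (s : ℕ) (s≡ : s ≡ e + (u + u))
                (bs : List ℕ) (desc : Desc bs) (len≡ : length bs ≡ suc s) where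

    open Beads e u e≤1 s s≡ bs desc len≡

    -- Interpolates between the residue (k = 0) and f (k = u).
    swapped : ℕ → ℕ → Bool
    swapped k r = (r <ᵇ k) ∨ (dual r <ᵇ k)

    partial : ℕ → ℕ → ℕ
    partial k b = if b <ᵇ t then b else (if S (b % t) ≡ᵇ 0 then b % t else (if swapped k (b % t) then dual (b % t) else b % t))

    partial-0 : ∀ b → partial 0 b ≡ b % t
    partial-0 b with lt-case b t
    ... | inj₁ (b<t , eq) rewrite eq = sym (m<n⇒m%n≡m b<t)
    ... | inj₂ (_ , eq)   rewrite eq with S (b % t) ≡ᵇ 0
    ...   | true  = refl
    ...   | false = refl

    -- The residues from `k` to `dual k` inclusive, a union of whole classes for `k ≤ u`.
    inner : ℕ → ℕ → Bool
    inner k x = not (x <ᵇ k) ∧ (x <ᵇ s ∸ k)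

    s∸k : ∀ {k} → k < u → s ∸ k ≡ suc (dual k)
    s∸k k<u = +-∸-assoc 1 (<-≤-trans k<u u≤s)

    between-inner : ∀ k x → between k (dual k) x ≡ inner (suc k) x
    between-inner k x = cong (_∧ (x <ᵇ dual k)) (lt-flip k x)
      where
      lt-flip : ∀ k x → (k <ᵇ x) ≡ not (x <ᵇ suc k)
      lt-flip k x with lt-case k x
      ... | inj₁ (k<x , eq) rewrite eq | <ᵇ-false k<x = refl
      ... | inj₂ (x≤k , eq) rewrite eq | <ᵇ-true (s≤s x≤k) = refl

    inner-step : ∀ {k} → k < u → ∀ x → ind (inner k x) ≡ ind (inner (suc k) x) + (ind (x ≡ᵇ k) + ind (x ≡ᵇ dual k))
    inner-step {k} k<u x rewrite s∸k k<u with <-cmp x k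
    ... | tri< x<k x≢k _ rewrite <ᵇ-true x<k | <ᵇ-true (m<n⇒m<1+n x<k) | ≡ᵇ-false x≢k
          | ≡ᵇ-false (<⇒≢ (<-trans x<k (<dual k<u))) = refl
    ... | tri≈ _ refl _ rewrite <ᵇ-false (≤-refl {x}) | <ᵇ-true (n<1+n x) | ≡ᵇ-refl x
          | <ᵇ-true (m<n⇒m<1+n (<dual k<u)) | ≡ᵇ-false (<⇒≢ (<dual k<u)) = refl
    ... | tri> _ x≢k k<x rewrite <ᵇ-false (<⇒≤ k<x) | <ᵇ-false k<x | ≡ᵇ-false x≢k with <-cmp x (dual k)
    ...   | tri< x<d x≢d _ rewrite <ᵇ-true x<d | <ᵇ-true (m<n⇒m<1+n x<d) | ≡ᵇ-false x≢d = refl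
    ...   | tri≈ _ refl _ rewrite <ᵇ-false (≤-refl {x}) | <ᵇ-true (n<1+n x) | ≡ᵇ-refl x = refl
    ...   | tri> _ x≢d d<x rewrite <ᵇ-false (<⇒≤ d<x) | <ᵇ-false d<x | ≡ᵇ-false x≢d = refl

    module _ (good : Good) where
      open Good good

      width : ℕ → ℕ
      width k = countᵇ (λ b → inner k (b % t)) bs

      width-0 : width 0 ≡ s
      width-0 = trans (count-<-∑ (_% t) s bs)
        (suc-injective (trans (trans (+-comm 1 _) (cong (∑ s n +_) (sym last-count))) (trans (sym (∑-last s n)) ∑n≡t)))

      width-step : ∀ {k} → k < u → width k ≡ width (suc k) + 2
      width-step {k} k<u = trans (count-+₃′ bs) (cong (width (suc k) +_) (pair-count k k<u))
        where
        count-+₃′ : ∀ xs → countᵇ (λ b → inner k (b % t)) xs ≡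
          countᵇ (λ b → inner (suc k) (b % t)) xs + (countᵇ (λ b → b % t ≡ᵇ k) xs + countᵇ (λ b → b % t ≡ᵇ dual k) xs)
        count-+₃′ xs = count-+₃ xs (λ b → inner-step k<u (b % t))

      -- Each step inwards removes a class with exactly two beads, so the parity stays that of
      -- `s = e + 2u`, the number of beads of residue other than `s`.
      par-width : ∀ k → k ≤ u → par (width k) ≡ par e
      par-width zero    _   = trans (cong par width-0) (trans (cong par s≡) (par-double e u))
      par-width (suc k) k<u = trans (sym (trans (cong par (width-step k<u))
        (trans (cong par (+-comm (width (suc k)) 2)) (not-involutive _)))) (par-width k (<⇒≤ k<u))

      single-big⇒free : ∀ {b} → b ∈ bs → t ≤ b → n (b % t) ≡ 1 → S (b % t) ≡ 0
      single-big⇒free {b} b∈ t≤b eq with single (m%n<n b t) eq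
      ... | inj₁ (_ , B≡0) = ⊥-elim (1+n≰n (≤-trans (big-count b∈ t≤b) (≤-reflexive B≡0)))
      ... | inj₂ (S≡0 , _) = S≡0

      data Stage (k b : ℕ) : Set where
        kept   : partial k b ≡ b % t → (b < t ⊎ S (b % t) ≡ 0) → Stage k b
        paired : ∀ c → c < u → (b % t ≡ c ⊎ b % t ≡ dual c) → t ≤ b → S (b % t) ≡ 1 → Stage k b

      stage : ∀ k {b} → b ∈ bs → Stage k b
      stage k {b} b∈ with lt-case b t
      ... | inj₁ (b<t , eq) = kept (trans (partial-small b<t) (sym (m<n⇒m%n≡m b<t))) (inj₁ b<t)
        where
        partial-small : b < t → partial k b ≡ b
        partial-small b<t rewrite <ᵇ-true b<t = refl
      ... | inj₂ (t≤b , eq) = go (S (b % t)) refl (S≤1 (b % t)) (residue (b % t) (m%n<n b t))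
        where
        free : S (b % t) ≡ 0 → Stage k b
        free S≡0 = kept image (inj₂ S≡0)
          where
          image : partial k b ≡ b % t
          image rewrite eq | S≡0 = refl
        go : ∀ m → S (b % t) ≡ m → m ≤ 1 → Residue (b % t) → Stage k b
        go zero          S≡0 _ _ = free S≡0
        go (suc (suc _)) _ (s≤s ()) _
        go (suc zero) S≡1 _ (last r≡s)       = free (single-big⇒free b∈ t≤b (trans (cong n r≡s) last-count))
        go (suc zero) S≡1 _ (mid r≡u e≡1)    = free (single-big⇒free b∈ t≤b (trans (cong n r≡u) (n-mid e≡1)))
        go (suc zero) S≡1 _ (lower r<u)      = paired (b % t) r<u (inj₁ refl) t≤b S≡1
        go (suc zero) S≡1 _ (upper r<s r′<u) = paired (dual (b % t)) r′<u (inj₂ (sym (dual-involutive r<s))) t≤b S≡1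

      swapped-lower : ∀ k {c} → c < u → swapped k c ≡ (c <ᵇ k)
      swapped-lower k {c} c<u with lt-case c k
      ... | inj₁ (_ , eq) rewrite eq = refl
      ... | inj₂ (k≤c , eq) rewrite eq = <ᵇ-false (≤-trans k≤c (<⇒≤ (<dual c<u)))

      swapped-upper : ∀ k {c} → c < u → swapped k (dual c) ≡ (c <ᵇ k)
      swapped-upper k {c} c<u rewrite dual-involutive (<-≤-trans c<u u≤s) with lt-case c k
      ... | inj₂ (k≤c , eq) rewrite eq | <ᵇ-false (≤-trans k≤c (<⇒≤ (<dual c<u))) = refl
      ... | inj₁ (_ , eq) rewrite eq with dual c <ᵇ k
      ...   | true  = refl
      ...   | false = refl

      partial-paired : ∀ k {b c} → c < u → b % t ≡ c ⊎ b % t ≡ dual c → t ≤ b → S (b % t) ≡ 1 →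
        partial k b ≡ (if c <ᵇ k then dual (b % t) else b % t)
      partial-paired k {b} {c} c<u cls t≤b S≡1 rewrite <ᵇ-false t≤b | S≡1 = cong (λ p → if p then dual (b % t) else b % t) (eq cls)
        where
        eq : b % t ≡ c ⊎ b % t ≡ dual c → swapped k (b % t) ≡ (c <ᵇ k)
        eq (inj₁ r≡) = trans (cong (swapped k) r≡) (swapped-lower k c<u)
        eq (inj₂ r≡) = trans (cong (swapped k) r≡) (swapped-upper k c<u)

      -- The stages before `k` only replace a residue by its dual inside the classes of `c < k`, and
      -- `p` does not distinguish such a pair.
      partial-pred : ∀ k (p : ℕ → Bool) → (∀ c → c < k → p c ≡ p (dual c)) → ∀ {b} → b ∈ bs → p (partial k b) ≡ p (b % t)
      partial-pred k p h {b} b∈ with stage k b∈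
      ... | kept eq _ = cong p eq
      ... | paired c c<u cls t≤b S≡1 with lt-case c k
      ...   | inj₂ (_ , eq) = cong p (trans (partial-paired k c<u cls t≤b S≡1) (cong (λ q → if q then dual (b % t) else b % t) eq))
      ...   | inj₁ (c<k , eq) = trans (cong p (trans (partial-paired k c<u cls t≤b S≡1) (cong (λ q → if q then dual (b % t) else b % t) eq)))
        (same cls)
        where
        same : b % t ≡ c ⊎ b % t ≡ dual c → p (dual (b % t)) ≡ p (b % t)
        same (inj₁ r≡) rewrite r≡ = sym (h c c<k)
        same (inj₂ r≡) rewrite r≡ | dual-involutive (<-≤-trans c<u u≤s) = h c c<k

      dual-anti : ∀ {c k} → c < k → k < u → dual k < dual c
      dual-anti {c} {k} c<k k<u = ∸-monoʳ-< (s≤s c<k) (<-≤-trans k<u u≤s)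

      partial-≡k : ∀ {k} → k < u → ∀ {b} → b ∈ bs → (partial k b ≡ᵇ k) ≡ (b % t ≡ᵇ k)
      partial-≡k {k} k<u = partial-pred k (_≡ᵇ k) (λ c c<k → trans (≡ᵇ-false (<⇒≢ c<k))
        (sym (≡ᵇ-false (<⇒≢ (<-trans (<dual k<u) (dual-anti c<k k<u)) ∘ sym))))

      partial-≡dual : ∀ {k} → k < u → ∀ {b} → b ∈ bs → (partial k b ≡ᵇ dual k) ≡ (b % t ≡ᵇ dual k)
      partial-≡dual {k} k<u = partial-pred k (_≡ᵇ dual k) (λ c c<k → trans (≡ᵇ-false (<⇒≢ (<-trans c<k (<dual k<u))))
        (sym (≡ᵇ-false (<⇒≢ (dual-anti c<k k<u) ∘ sym))))

      partial-between : ∀ {k} → k < u → ∀ {b} → b ∈ bs → between k (dual k) (partial k b) ≡ between k (dual k) (b % t)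
      partial-between {k} k<u = partial-pred k (between k (dual k)) (λ c c<k → trans (outside₁ c<k) (sym (outside₂ c<k)))
        where
        outside₁ : ∀ {c} → c < k → between k (dual k) c ≡ false
        outside₁ c<k rewrite <ᵇ-false (<⇒≤ c<k) = refl
        outside₂ : ∀ {c} → c < k → between k (dual k) (dual c) ≡ false
        outside₂ {c} c<k rewrite <ᵇ-false (<⇒≤ (dual-anti c<k k<u)) = ∧-zeroʳ (k <ᵇ dual c)

      partial-same : ∀ k {b} → k < u → b ∈ bs → b < t ⊎ S (b % t) ≡ 0 ⊎ (b % t ≢ k × b % t ≢ dual k) → partial (suc k) b ≡ partial k b
      partial-same k {b} k<u b∈ h with stage k b∈ | stage (suc k) b∈
      ... | kept eq _ | kept eq′ _ = trans eq′ (sym eq)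
      ... | kept _ (inj₁ b<t) | paired _ _ _ t≤b _ = ⊥-elim (1+n≰n (≤-trans b<t t≤b))
      ... | kept _ (inj₂ S≡0) | paired _ _ _ _ S≡1 = ⊥-elim (1+n≢0 (trans (sym S≡1) S≡0))
      ... | paired c c<u cls t≤b S≡1 | _ = trans (partial-paired (suc k) c<u cls t≤b S≡1)
        (trans (cong (λ q → if q then dual (b % t) else b % t) (bools (c≢k h cls))) (sym (partial-paired k c<u cls t≤b S≡1)))
        where
        c≢k : b < t ⊎ S (b % t) ≡ 0 ⊎ (b % t ≢ k × b % t ≢ dual k) → b % t ≡ c ⊎ b % t ≡ dual c → c ≢ k
        c≢k (inj₁ b<t)        _         = ⊥-elim (1+n≰n (≤-trans b<t t≤b))
        c≢k (inj₂ (inj₁ S≡0)) _         = ⊥-elim (1+n≢0 (trans (sym S≡1) S≡0))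
        c≢k (inj₂ (inj₂ (r≢k , _))) (inj₁ r≡) refl = r≢k r≡
        c≢k (inj₂ (inj₂ (_ , r≢d))) (inj₂ r≡) refl = r≢d r≡
        bools : c ≢ k → (c <ᵇ suc k) ≡ (c <ᵇ k)
        bools c≢k with lt-case c k
        ... | inj₁ (c<k , eq) rewrite eq = <ᵇ-true (m<n⇒m<1+n c<k)
        ... | inj₂ (k≤c , eq) rewrite eq = <ᵇ-false (≤∧≢⇒< k≤c (c≢k ∘ sym))

      partial-u : ∀ {b} → b ∈ bs → partial u b ≡ f b
      partial-u {b} b∈ with stage u b∈
      ... | paired c c<u cls t≤b S≡1 = trans (partial-paired u c<u cls t≤b S≡1)
        (trans (cong (λ q → if q then dual (b % t) else b % t) (<ᵇ-true c<u)) (sym (f-taken t≤b S≡1)))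
      ... | kept eq (inj₁ b<t) = trans eq (trans (m<n⇒m%n≡m b<t) (sym (f-small b<t)))
      ... | kept eq (inj₂ S≡0) with b <? t
      ...   | yes b<t = trans eq (trans (m<n⇒m%n≡m b<t) (sym (f-small b<t)))
      ...   | no b≮t  = trans eq (sym (f-free (≮⇒≥ b≮t) S≡0))

      stageInv : ℕ → Bool
      stageInv k = par (inversions (map (partial k) bs))

      -- The contribution of one pair to ε: a term of the binomial sum, and `e` times the number of
      -- doubled residues. Truncated subtraction makes `n − 1` equal to 1 for a doubled residue and
      -- 0 for a single or an empty one.
      κ : ℕ → ℕ
      κ k = ((n (dual k) + 1) C 2) + e * ((n k ∸ 1) + (n (dual k) ∸ 1))

      unchanged : ∀ {k} → k < u → (∀ {b} → b ∈ bs → b < t ⊎ S (b % t) ≡ 0 ⊎ (b % t ≢ k × b % t ≢ dual k)) →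
        stageInv (suc k) ≡ stageInv k
      unchanged k<u h = cong (par ∘ inversions) (map-cong-∈ bs (λ b∈ → partial-same _ k<u b∈ (h b∈)))

      -- The pair (k, dual k) has a doubled residue v; its big bead b₀ moves from v to w = dual v at stage k.
      module Change {k v : ℕ} (k<u : k < u) (v∈ : v ≡ k ⊎ v ≡ dual k) (S≡1 : S v ≡ 1) (B≡1 : B v ≡ 1) (n≡0 : n (dual v) ≡ 0) where
        b₀ = proj₁ (big-bead B≡1)
        b₀∈ = proj₁ (proj₂ (big-bead B≡1))
        t≤b₀ = proj₁ (proj₂ (proj₂ (big-bead B≡1)))
        r₀ : b₀ % t ≡ v
        r₀ = proj₂ (proj₂ (proj₂ (big-bead B≡1)))
        xs = proj₁ (∈-∃++ b₀∈)
        ys = proj₁ (proj₂ (∈-∃++ b₀∈))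
        bs≡ : bs ≡ xs ++ b₀ ∷ ys
        bs≡ = proj₂ (proj₂ (∈-∃++ b₀∈))
        k<s : k < s
        k<s = <-≤-trans k<u u≤s
        xs⊆ : ∀ {b} → b ∈ xs → b ∈ bs
        xs⊆ b∈ = subst (_ ∈_) (sym bs≡) (∈-++⁺ˡ b∈)
        ys⊆ : ∀ {b} → b ∈ ys → b ∈ bs
        ys⊆ b∈ = subst (_ ∈_) (sym bs≡) (∈-++⁺ʳ xs (there b∈))
        order = Desc-split xs (subst Desc bs≡ desc)
        absent : ∀ {b} → b ∈ bs → b % t ≢ dual v
        absent b∈ eq = 1+n≢0 (n≤0⇒n≡0 (≤-trans (∃-count bs b∈ (≡ᵇ-true eq)) (≤-reflexive n≡0)))
        other-small : ∀ {b} → b ∈ bs → b ≢ b₀ → b % t ≡ v → b < t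
        other-small {b} b∈ b≢ r≡ with b <? t
        ... | yes b<t = b<t
        ... | no b≮t = ⊥-elim (1+n≰n (≤-trans (∃₂-count bs b∈ b₀∈ b≢
          (cong₂ _∧_ (≥-big (≮⇒≥ b≮t)) (≡ᵇ-true r≡)) (cong₂ _∧_ (≥-big t≤b₀) (≡ᵇ-true r₀))) (≤-reflexive B≡1)))
        other-same : ∀ {b} → b ∈ bs → b ≢ b₀ → partial (suc k) b ≡ partial k b
        other-same {b} b∈ b≢ = partial-same k k<u b∈ (reason (b % t ≟ v))
          where
          reason : Dec (b % t ≡ v) → b < t ⊎ S (b % t) ≡ 0 ⊎ (b % t ≢ k × b % t ≢ dual k)
          reason (yes r≡) = inj₁ (other-small b∈ b≢ r≡)
          reason (no r≢) = inj₂ (inj₂ (cases v∈))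
            where
            cases : v ≡ k ⊎ v ≡ dual k → b % t ≢ k × b % t ≢ dual k
            cases (inj₁ refl) = r≢ , absent b∈
            cases (inj₂ refl) = (λ eq → absent b∈ (trans eq (sym (dual-involutive k<s)))) , r≢
        -- A bead to the left of `b₀` exceeds it and is therefore big, whereas `b₀` is the only big
        -- bead of residue `v`.
        xs-big : ∀ {b} → b ∈ xs → b % t ≢ v
        xs-big b∈ r≡ = 1+n≰n (≤-trans (other-small (xs⊆ b∈) (<⇒≢ b> ∘ sym) r≡) (≤-trans t≤b₀ (<⇒≤ b>)))
          where b> = All.lookup (proj₁ order) b∈
        image : ∀ m → partial m b₀ ≡ (if k <ᵇ m then dual v else v)
        image m = trans (partial-paired m k<u (subst (λ r → r ≡ k ⊎ r ≡ dual k) (sym r₀) v∈) t≤b₀ (trans (cong S r₀) S≡1))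
          (cong (λ r → if k <ᵇ m then dual r else r) r₀)
        Xs = map (partial k) xs
        Ys = map (partial k) ys
        before : map (partial k) bs ≡ Xs ++ v ∷ Ys
        before = trans (cong (map (partial k)) bs≡) (trans (map-++ (partial k) xs (b₀ ∷ ys))
          (cong (λ y → Xs ++ y ∷ Ys) (trans (image k) (cong (λ p → if p then dual v else v) (<ᵇ-false (≤-refl {k}))))))
        after : map (partial (suc k)) bs ≡ Xs ++ dual v ∷ Ys
        after = trans (cong (map (partial (suc k))) bs≡) (trans (map-++ (partial (suc k)) xs (b₀ ∷ ys))
          (cong₂ _++_ (map-cong-∈ xs (λ b∈ → other-same (xs⊆ b∈) (<⇒≢ (All.lookup (proj₁ order) b∈) ∘ sym)))
            (cong₂ _∷_ (trans (image (suc k)) (cong (λ p → if p then dual v else v) (<ᵇ-true (n<1+n k))))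
              (map-cong-∈ ys (λ b∈ → other-same (ys⊆ b∈) (<⇒≢ (All.lookup (proj₂ order) b∈)))))))
        count-partial : ∀ (p : ℕ → Bool) zs → (∀ {b} → b ∈ zs → b ∈ bs) → (∀ {b} → b ∈ bs → p (partial k b) ≡ p (b % t)) →
          countᵇ p (map (partial k) zs) ≡ countᵇ (λ b → p (b % t)) zs
        count-partial p zs zs⊆ h = trans (count-map p (partial k) zs) (count-cong zs (h ∘ zs⊆))
        not-between : between k (dual k) v ≡ false
        not-between = cases v∈
          where
          cases : v ≡ k ⊎ v ≡ dual k → between k (dual k) v ≡ false
          cases (inj₁ refl) rewrite <ᵇ-false (≤-refl {v}) = refl
          cases (inj₂ refl) rewrite <ᵇ-false (≤-refl {dual k}) = ∧-zeroʳ (k <ᵇ dual k)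
        -- The endpoints are excluded, so omitting `b₀` loses nothing, and the count is the number
        -- of beads in the classes strictly inside the current one.
        par-between : par (countᵇ (between k (dual k)) (Xs ++ Ys)) ≡ par e
        par-between = trans (cong par eq) (par-width (suc k) k<u)
          where
          p = between k (dual k)
          q : ℕ → Bool
          q b = p (b % t)
          eq : countᵇ p (Xs ++ Ys) ≡ width (suc k)
          eq = begin
            countᵇ p (Xs ++ Ys)  ≡⟨ count-++ p Xs Ys ⟩
            countᵇ p Xs + countᵇ p Ys  ≡⟨ cong₂ _+_ (count-partial p xs xs⊆ (partial-between k<u)) (count-partial p ys ys⊆ (partial-between k<u)) ⟩
            countᵇ q xs + countᵇ q ys  ≡⟨ cong (λ z → countᵇ q xs + (ind z + countᵇ q ys)) (sym (trans (cong p r₀) not-between)) ⟩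
            countᵇ q xs + (ind (q b₀) + countᵇ q ys)     ≡⟨ cong (countᵇ q xs +_) (sym (count-∷ q b₀ ys)) ⟩
            countᵇ q xs + countᵇ q (b₀ ∷ ys)  ≡⟨ sym (count-++ q xs (b₀ ∷ ys)) ⟩
            countᵇ q (xs ++ b₀ ∷ ys)  ≡⟨ cong (countᵇ q) (sym bs≡) ⟩
            countᵇ q bs  ≡⟨ count-cong bs (λ {b} _ → between-inner k (b % t)) ⟩
            width (suc k)  ∎
            where open ≡-Reasoning
        -- Of the two beads of residue `v`, the small one is less than `b₀` and so stands to its
        -- right.
        count-v-ys : countᵇ (λ b → b % t ≡ᵇ v) ys ≡ 1
        count-v-ys = suc-injective (begin
          1 + countᵇ p ys  ≡⟨ cong (λ z → ind z + countᵇ p ys) (sym (≡ᵇ-true r₀)) ⟩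
          ind (p b₀) + countᵇ p ys  ≡⟨ sym (count-∷ p b₀ ys) ⟩
          countᵇ p (b₀ ∷ ys)  ≡⟨ cong (_+ countᵇ p (b₀ ∷ ys)) (sym (count-zero xs (λ b∈ → ≡ᵇ-false (xs-big b∈)))) ⟩
          countᵇ p xs + countᵇ p (b₀ ∷ ys)  ≡⟨ sym (count-++ p xs (b₀ ∷ ys)) ⟩
          countᵇ p (xs ++ b₀ ∷ ys)  ≡⟨ cong (countᵇ p) (sym bs≡) ⟩
          n v  ≡⟨ n-split v v<t ⟩
          S v + B v  ≡⟨ cong₂ _+_ S≡1 B≡1 ⟩
          2  ∎)
          where
          open ≡-Reasoning
          p : ℕ → Bool
          p b = b % t ≡ᵇ v
          v<t : v < t
          v<t = subst (_< t) r₀ (m%n<n b₀ t)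

      drop₂ : ∀ a b p q → p ≡ 0 → q ≡ 0 → a xor (b xor (par p xor par q)) ≡ a xor b
      drop₂ a true  _ _ refl refl = refl
      drop₂ a false _ _ refl refl = refl

      n-pair : ∀ {k} → k < u → ∀ {a b a′ b′} → S k ≡ a → B k ≡ b → S (dual k) ≡ a′ → B (dual k) ≡ b′ → n k ≡ a + b × n (dual k) ≡ a′ + b′
      n-pair {k} k<u refl refl refl refl = n-split k (m<n⇒m<1+n k<s) , n-split (dual k) (m<n⇒m<1+n (dual<s k<s))
        where k<s = <-≤-trans k<u u≤s

      -- Only a doubled residue moves a bead. Going up from `k`, the bead passes the values in
      -- between and also leaves behind the equal value of its small partner on the right: parity
      -- `e + 1`. Going down from `dual k` there is no such extra inversion: parity `e`. Since
      -- `C(n (dual k) + 1, 2)` is 0, 1 or 3, the term `not (par (κ k))` expresses all cases.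
      stage-step : ∀ {k} → k < u → stageInv (suc k) ≡ stageInv k xor not (par (κ k))
      stage-step {k} k<u = go refl refl refl refl (lower-state good k<u)
        where
        k<s : k < s
        k<s = <-≤-trans k<u u≤s
        κ-value : ∀ {x y} → n k ≡ x → n (dual k) ≡ y → κ k ≡ ((y + 1) C 2) + e * ((x ∸ 1) + (y ∸ 1))
        κ-value refl refl = refl
        still : n k ≡ 1 → n (dual k) ≡ 1 → (∀ {b} → b ∈ bs → b < t ⊎ S (b % t) ≡ 0 ⊎ (b % t ≢ k × b % t ≢ dual k)) →
          stageInv (suc k) ≡ stageInv k xor not (par (κ k))
        still n₁ n₂ h = trans (unchanged k<u h) (trans (sym (xor-identityʳ _))
          (cong (λ m → stageInv k xor not (par m)) (sym (trans (κ-value n₁ n₂) (cong suc (*-zeroʳ e))))))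
        no-big : ∀ {b c} → b ∈ bs → t ≤ b → b % t ≡ c → B c ≡ 0 → ⊥
        no-big b∈ t≤b refl B≡0 = 1+n≰n (≤-trans (big-count b∈ t≤b) (≤-reflexive B≡0))
        idle : (B k ≡ 0 ⊎ S k ≡ 0) → (B (dual k) ≡ 0 ⊎ S (dual k) ≡ 0) →
          ∀ {b} → b ∈ bs → b < t ⊎ S (b % t) ≡ 0 ⊎ (b % t ≢ k × b % t ≢ dual k)
        idle h₁ h₂ {b} b∈ with b <? t
        ... | yes b<t = inj₁ b<t
        ... | no b≮t with b % t ≟ k | b % t ≟ dual k
        ...   | no r≢k | no r≢d = inj₂ (inj₂ (r≢k , r≢d))
        ...   | yes r≡ | _ = inj₂ (inj₁ (which h₁))
          where
          which : B k ≡ 0 ⊎ S k ≡ 0 → S (b % t) ≡ 0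
          which (inj₁ B≡0) = ⊥-elim (no-big b∈ (≮⇒≥ b≮t) r≡ B≡0)
          which (inj₂ S≡0) = trans (cong S r≡) S≡0
        ...   | no _ | yes r≡ = inj₂ (inj₁ (which h₂))
          where
          which : B (dual k) ≡ 0 ⊎ S (dual k) ≡ 0 → S (b % t) ≡ 0
          which (inj₁ B≡0) = ⊥-elim (no-big b∈ (≮⇒≥ b≮t) r≡ B≡0)
          which (inj₂ S≡0) = trans (cong S r≡) S≡0
        go : ∀ {a b a′ b′} → S k ≡ a → B k ≡ b → S (dual k) ≡ a′ → B (dual k) ≡ b′ → State a b a′ b′ →
          stageInv (suc k) ≡ stageInv k xor not (par (κ k))
        go h₁ h₂ h₃ h₄ small-small = still (proj₁ ns) (proj₂ ns) (idle (inj₁ h₂) (inj₁ h₄))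
          where ns = n-pair k<u h₁ h₂ h₃ h₄
        go h₁ h₂ h₃ h₄ small-big = still (proj₁ ns) (proj₂ ns) (idle (inj₁ h₂) (inj₂ h₃))
          where ns = n-pair k<u h₁ h₂ h₃ h₄
        go h₁ h₂ h₃ h₄ big-small = still (proj₁ ns) (proj₂ ns) (idle (inj₂ h₁) (inj₁ h₄))
          where ns = n-pair k<u h₁ h₂ h₃ h₄
        go h₁ h₂ h₃ h₄ double-left = begin
          stageInv (suc k)
            ≡⟨ cong (par ∘ inversions) after ⟩
          par (inversions (Xs ++ dual k ∷ Ys))
            ≡⟨ inversions-raise Xs Ys (<dual k<u) ⟩
          par (inversions (Xs ++ k ∷ Ys)) xor (par (countᵇ (between k (dual k)) (Xs ++ Ys)) xor (par (countᵇ (_≡ᵇ dual k) Xs) xor par (countᵇ (_≡ᵇ k) Ys)))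
            ≡⟨ cong₂ (λ x y → par x xor y) (cong inversions (sym before)) (cong₂ _xor_ par-between
                 (cong₂ (λ x y → par x xor par y)
                   (trans (count-partial (_≡ᵇ dual k) xs xs⊆ (partial-≡dual k<u)) (count-zero xs (λ b∈ → ≡ᵇ-false (absent (xs⊆ b∈)))))
                   (trans (count-partial (_≡ᵇ k) ys ys⊆ (partial-≡k k<u)) count-v-ys))) ⟩
          stageInv k xor (par e xor true)
            ≡⟨ cong (stageInv k xor_) (trans (xor-comm (par e) true) (cong (not ∘ par) (sym (trans (κ-value (proj₁ ns) (proj₂ ns)) (*-identityʳ e))))) ⟩
          stageInv k xor not (par (κ k)) ∎
          where
          open ≡-Reasoning
          ns = n-pair k<u h₁ h₂ h₃ h₄
          open Change k<u (inj₁ refl) h₁ h₂ (proj₂ ns) hiding (k<s)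
        go h₁ h₂ h₃ h₄ double-right = begin
          stageInv (suc k)
            ≡⟨ cong (par ∘ inversions) (trans after (cong (λ x → Xs ++ x ∷ Ys) (dual-involutive k<s))) ⟩
          par (inversions (Xs ++ k ∷ Ys))
            ≡⟨ xor-move (par (inversions (Xs ++ k ∷ Ys))) (par e) _ (sym raised) ⟩
          stageInv k xor par e
            ≡⟨ cong (stageInv k xor_) (sym (trans (cong (not ∘ par) (trans (κ-value (proj₁ ns) (proj₂ ns)) (cong (λ x → suc (suc (suc x))) (*-identityʳ e))))
                 (trans (not-involutive _) (not-involutive _)))) ⟩
          stageInv k xor not (par (κ k)) ∎
          where
          open ≡-Reasoning
          ns = n-pair k<u h₁ h₂ h₃ h₄
          open Change k<u (inj₂ refl) h₃ h₄ (trans (cong n (dual-involutive k<s)) (proj₁ ns)) hiding (k<s)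
          raised : stageInv k ≡ par (inversions (Xs ++ k ∷ Ys)) xor par e
          raised = begin
            stageInv k
              ≡⟨ cong (par ∘ inversions) before ⟩
            par (inversions (Xs ++ dual k ∷ Ys))
              ≡⟨ inversions-raise Xs Ys (<dual k<u) ⟩
            par (inversions (Xs ++ k ∷ Ys)) xor (par (countᵇ (between k (dual k)) (Xs ++ Ys)) xor (par (countᵇ (_≡ᵇ dual k) Xs) xor par (countᵇ (_≡ᵇ k) Ys)))
              ≡⟨ drop₂ (par (inversions (Xs ++ k ∷ Ys))) (par (countᵇ (between k (dual k)) (Xs ++ Ys))) _ _
                   (trans (count-partial (_≡ᵇ dual k) xs xs⊆ (partial-≡dual k<u)) (count-zero xs (λ b∈ → ≡ᵇ-false (xs-big b∈))))
                   (trans (count-partial (_≡ᵇ k) ys ys⊆ (partial-≡k k<u)) (count-zero ys (λ b∈ → ≡ᵇ-false (λ eq → absent (ys⊆ b∈) (trans eq (sym (dual-involutive k<s))))))) ⟩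
            par (inversions (Xs ++ k ∷ Ys)) xor par (countᵇ (between k (dual k)) (Xs ++ Ys))
              ≡⟨ cong (par (inversions (Xs ++ k ∷ Ys)) xor_) par-between ⟩
            par (inversions (Xs ++ k ∷ Ys)) xor par e ∎

      stages : ∀ k → k ≤ u → stageInv k ≡ par (inversions (map (_% t) bs)) xor (par (∑ k κ) xor par k)
      stages zero    _ = trans (cong (par ∘ inversions) (map-cong-∈ bs (λ {b} _ → partial-0 b))) (sym (xor-identityʳ _))
      stages (suc k) k<u = begin
        stageInv (suc k)
          ≡⟨ stage-step k<u ⟩
        stageInv k xor not (par (κ k))
          ≡⟨ cong (_xor not (par (κ k))) (stages k (<⇒≤ k<u)) ⟩
        (r xor (par (∑ k κ) xor par k)) xor not (par (κ k))
          ≡⟨ rearrange r (par (∑ k κ)) (par k) (par (κ k)) ⟩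
        r xor ((par (∑ k κ) xor par (κ k)) xor not (par k))
          ≡⟨ cong (λ x → r xor (x xor not (par k))) (sym (trans (cong par (∑-last k κ)) (par-+ (∑ k κ) (κ k)))) ⟩
        r xor (par (∑ (suc k) κ) xor par (suc k)) ∎
        where
        open ≡-Reasoning
        r = par (inversions (map (_% t) bs))
        rearrange : ∀ a b c d → (a xor (b xor c)) xor not d ≡ a xor ((b xor d) xor not c)
        rearrange a b c true  = solve 3 (λ a b c → (a :+ (b :+ c)) :+ con false := a :+ ((b :+ con true) :+ (con true :+ c))) refl a b c
          where open xor-∧-Solver
        rearrange a b c false = solve 3 (λ a b c → (a :+ (b :+ c)) :+ con true := a :+ ((b :+ con false) :+ (con true :+ c))) refl a b c
          where open xor-∧-Solver

      -- The reversed numbering of the columns contributes `t (t − 1) / 2`, of parity `u + e`; the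
      -- negations in the `u` stages contribute another `u`, and only `e` is left.
      parity : par (inversions (map (s ∸_) (map f bs))) ≡ par (inversions (map (_% t) bs)) xor (par (∑ u κ) xor par e)
      parity = begin
        par (inversions (map (s ∸_) (map f bs)))
          ≡⟨ xor-move _ (par (inversions (map f bs))) _ (trans (sym (par-+ (inversions (map (s ∸_) (map f bs))) (inversions (map f bs)))) (cong par reflected)) ⟩
        par (tri t) xor par (inversions (map f bs))
          ≡⟨ cong₂ _xor_ (trans (cong (par ∘ tri ∘ suc) s≡) (par-tri e u e≤1))
               (trans (cong (par ∘ inversions) (map-cong-∈ bs (sym ∘ partial-u))) (stages u ≤-refl)) ⟩
        (par u xor par e) xor (r xor (par (∑ u κ) xor par u))
          ≡⟨ solve 4 (λ u e r k → (u :+ e) :+ (r :+ (k :+ u)) := r :+ (k :+ e)) refl (par u) (par e) r (par (∑ u κ)) ⟩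
        r xor (par (∑ u κ) xor par e) ∎
        where
        open ≡-Reasoning
        open xor-∧-Solver
        r = par (inversions (map (_% t) bs))
        distinct : ∀ y → countᵇ (_≡ᵇ y) (map f bs) ≤ 1
        distinct y with y <? t
        ... | yes y<t = ≤-reflexive (proj₂ (perm good) y y<t)
        ... | no y≮t = ≤-trans (≤-reflexive (count-zero (map f bs) (λ x∈ → ≡ᵇ-false (<⇒≢ (<-≤-trans (IsPerm-< (perm good) x∈) (≮⇒≥ y≮t)))))) z≤n
        reflected : inversions (map (s ∸_) (map f bs)) + inversions (map f bs) ≡ tri t
        reflected = trans (inversions-reflect s (map f bs) (λ x∈ → ≤-pred (IsPerm-< (perm good) x∈)) distinct)
          (cong tri (proj₁ (perm good)))

  -- The core

  count-concat-applyUpTo : ∀ p (g : ℕ → List ℕ) (f : ℕ → ℕ) m →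
    countᵇ p (concat (map g (applyUpTo f m))) ≡ ∑ m (λ i → countᵇ p (g (f i)))
  count-concat-applyUpTo p g f zero    = refl
  count-concat-applyUpTo p g f (suc m) = trans (count-++ p (g (f 0)) _) (cong (countᵇ p (g (f 0)) +_) (count-concat-applyUpTo p g (f ∘ suc) m))

  count-applyUpTo : ∀ p (f : ℕ → ℕ) m → countᵇ p (applyUpTo f m) ≡ ∑ m (λ j → ind (p (f j)))
  count-applyUpTo p f zero    = refl
  count-applyUpTo p f (suc m) = trans (count-∷ p (f 0) _) (cong (ind (p (f 0)) +_) (count-applyUpTo p (f ∘ suc) m))

  count-map-upTo : ∀ p (g : ℕ → ℕ) m → countᵇ p (map g (upTo m)) ≡ ∑ m (λ j → ind (p (g j)))
  count-map-upTo p g m = trans (cong (countᵇ p) (map-upTo g m)) (count-applyUpTo p g m)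

  ∑-only : ∀ m {F : ℕ → ℕ} k → k < m → (∀ i → i < m → i ≢ k → F i ≡ 0) → ∑ m F ≡ F k
  ∑-only (suc m) {F} zero    _         h = trans (cong (F 0 +_) (∑-zero m (λ i i<m → h (suc i) (s≤s i<m) λ ()))) (+-identityʳ (F 0))
  ∑-only (suc m) {F} (suc k) (s≤s k<m) h = trans (cong (_+ ∑ m (F ∘ suc)) (h 0 (s≤s z≤n) λ ()))
    (∑-only m k k<m (λ i i<m i≢k → h (suc i) (s≤s i<m) (i≢k ∘ suc-injective)))

  ∑-ind-≡ : ∀ m c → ∑ m (λ j → ind (c ≡ᵇ j)) ≡ ind (c <ᵇ m)
  ∑-ind-≡ zero    zero    = refl
  ∑-ind-≡ zero    (suc c) = refl
  ∑-ind-≡ (suc m) zero    = cong suc (∑-zero m (λ _ _ → refl))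
  ∑-ind-≡ (suc m) (suc c) = ∑-ind-≡ m c

  ∑-prefix : ∀ m (P : ℕ → Bool) p → p ≤ m → (∀ j → j < p → P j ≡ true) → (∀ j → p ≤ j → j < m → P j ≡ false) →
    ∑ m (λ j → ind (P j)) ≡ p
  ∑-prefix m       P zero    _         yes′ no′ = ∑-zero m (λ j j<m → cong ind (no′ j z≤n j<m))
  ∑-prefix (suc m) P (suc p) (s≤s p≤m) yes′ no′ = cong₂ _+_ (cong ind (yes′ 0 (s≤s z≤n)))
    (∑-prefix m (P ∘ suc) p p≤m (λ j j<p → yes′ (suc j) (s≤s j<p)) (λ j p≤j j<m → no′ (suc j) (s≤s p≤j) (s≤s j<m)))

  Antitone : ℕ → (ℕ → Bool) → Set
  Antitone m P = ∀ i j → i ≤ j → j < m → P j ≡ true → P i ≡ true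

  ∑-prefix⁻¹ : ∀ m P → Antitone m P → ∀ j → j < m →
    (j < ∑ m (λ j → ind (P j)) × P j ≡ true) ⊎ (∑ m (λ j → ind (P j)) ≤ j × P j ≡ false)
  ∑-prefix⁻¹ (suc m) P anti j j<m with P 0 in eq
  ∑-prefix⁻¹ (suc m) P anti zero    _         | true = inj₁ (s≤s z≤n , eq)
  ∑-prefix⁻¹ (suc m) P anti (suc j) (s≤s j<m) | true with ∑-prefix⁻¹ m (P ∘ suc) (λ i j i≤j j<m → anti (suc i) (suc j) (s≤s i≤j) (s≤s j<m)) j j<m
  ... | inj₁ (h , Pj) = inj₁ (s≤s h , Pj)
  ... | inj₂ (h , Pj) = inj₂ (s≤s h , Pj)
  ∑-prefix⁻¹ (suc m) P anti j j<m | false = inj₂ (≤-trans (≤-reflexive (∑-zero m (λ i i<m → cong ind (none (suc i) (s≤s i<m))))) z≤n , none j j<m)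
    where
    none : ∀ i → i < suc m → P i ≡ false
    none i i<m with P i in eq′
    ... | false = refl
    ... | true with () ← trans (sym (anti 0 i z≤n i<m eq′)) eq

  ∑-ind≤ : ∀ m (P : ℕ → Bool) → ∑ m (λ j → ind (P j)) ≤ m
  ∑-ind≤ m P = ≤-trans (∑-mono m (λ j _ → ind≤1 (P j))) (≤-reflexive (trans (∑-const m 1) (*-identityʳ m)))

  max-upper : ∀ (g f : ℕ → ℕ) m N → (∀ k → k < m → g (f k) ≤ N) → foldr _⊔_ 0 (map g (applyUpTo f m)) ≤ N
  max-upper g f zero    N h = z≤n
  max-upper g f (suc m) N h = ⊔-lub (h 0 (s≤s z≤n)) (max-upper g (f ∘ suc) m N (λ k k<m → h (suc k) (s≤s k<m)))

  max-attained : ∀ (g f : ℕ → ℕ) m k → k < m → g (f k) ≤ foldr _⊔_ 0 (map g (applyUpTo f m))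
  max-attained g f (suc m) zero    _         = m≤m⊔n _ _
  max-attained g f (suc m) (suc k) (s≤s k<m) = ≤-trans (max-attained g (f ∘ suc) m k k<m) (m≤n⊔m (g (f 0)) _)

  atLeast : ℕ → List ℕ → ℕ
  atLeast x = countᵇ (λ y → not (y <ᵇ x))

  atLeast-step : ∀ x xs → atLeast x xs ≡ countᵇ (_≡ᵇ x) xs + atLeast (suc x) xs
  atLeast-step x xs = count-+ xs (λ {y} _ → pointwise y)
    where
    pointwise : ∀ y → ind (not (y <ᵇ x)) ≡ ind (y ≡ᵇ x) + ind (not (y <ᵇ suc x))
    pointwise y with <-cmp y x
    ... | tri< y<x y≢x _ rewrite <ᵇ-true y<x | <ᵇ-true (m<n⇒m<1+n y<x) | ≡ᵇ-false y≢x = refl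
    ... | tri≈ _ refl _  rewrite <ᵇ-false (≤-refl {y}) | <ᵇ-true (n<1+n y) | ≡ᵇ-refl y = refl
    ... | tri> _ y≢x x<y rewrite <ᵇ-false (<⇒≤ x<y) | <ᵇ-false x<y | ≡ᵇ-false y≢x = refl

  atLeast-at : ∀ {xs} → Desc xs → ∀ x j → j < length xs →
    (j < atLeast x xs × x ≤ at xs j) ⊎ (atLeast x xs ≤ j × at xs j < x)
  atLeast-at {y ∷ ys} (y> ∷ d) x j j<n with lt-case y x
  ... | inj₁ (y<x , eq) rewrite eq = inj₂ (≤-trans (≤-reflexive none) z≤n , below j j<n)
    where
    none : atLeast x ys ≡ 0
    none = count-zero ys (λ z∈ → cong not (<ᵇ-true (<-trans (All.lookup y> z∈) y<x)))
    below : ∀ j → j < suc (length ys) → at (y ∷ ys) j < x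
    below zero    _         = y<x
    below (suc j) (s≤s j<n) = <-trans (All.lookup y> (at-∈ ys j<n)) y<x
  atLeast-at {y ∷ ys} (y> ∷ d) x zero    j<n       | inj₂ (x≤y , eq) rewrite eq = inj₁ (s≤s z≤n , x≤y)
  atLeast-at {y ∷ ys} (y> ∷ d) x (suc j) (s≤s j<n) | inj₂ (x≤y , eq) rewrite eq with atLeast-at d x j j<n
  ... | inj₁ (h , h′) = inj₁ (s≤s h , h′)
  ... | inj₂ (h , h′) = inj₂ (s≤s h , h′)

  Desc-at-+ : ∀ {xs} → Desc xs → ∀ {i j} → i ≤ j → j < length xs → at xs j + j ≤ at xs i + i
  Desc-at-+ {xs} d {i} i≤j j<n = go j<n (≤⇒≤′ i≤j)
    where
    go : ∀ {j} → j < length xs → i ≤′ j → at xs j + j ≤ at xs i + i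
    go         j<n ≤′-refl       = ≤-refl
    go {suc j} j<n (≤′-step i≤j) = ≤-trans (≤-reflexive (+-suc (at xs (suc j)) j))
      (≤-trans (+-monoˡ-≤ j (Desc-at d (n<1+n j) j<n)) (go (<-trans (n<1+n j) j<n) i≤j))

  ∸-≤⇒ : ∀ {m n o} → suc m ≤ n ∸ o → o + suc m ≤ n
  ∸-≤⇒ {m} {n} {o} h with o ≤? n
  ... | yes o≤n = ≤-trans (+-monoʳ-≤ o h) (≤-reflexive (m+[n∸m]≡n o≤n))
  ... | no o≰n  = ⊥-elim (n≮0 (subst (suc m ≤_) (m≤n⇒m∸n≡0 (<⇒≤ (≰⇒> o≰n))) h))

  ⇒-∸-≤ : ∀ {m n o} → o + m ≤ n → m ≤ n ∸ o
  ⇒-∸-≤ {m} {n} {o} h = ≤-trans (≤-reflexive (sym (m+n∸m≡n o m))) (∸-monoˡ-≤ o h)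

  module Core (e u : ℕ) (e≤1 : e ≤ 1) (s : ℕ) (s≡ : s ≡ e + (u + u))
              (bs : List ℕ) (desc : Desc bs) (len≡ : length bs ≡ suc s) where

    open Beads e u e≤1 s s≡ bs desc len≡

    unsorted coreBeads ν : List ℕ
    unsorted  = concat (map (λ i → map (λ j → t * j + i) (upTo (n i))) (upTo t))
    coreBeads = sortD unsorted
    ν         = map (λ j → (at coreBeads j + suc j) ∸ t) (upTo (length coreBeads))

    count-core : ∀ p → countᵇ p coreBeads ≡ ∑ t (λ i → ∑ (n i) (λ j → ind (p (t * j + i))))
    count-core p = trans (sortD-count p unsorted)
      (trans (count-concat-applyUpTo p (λ i → map (λ j → t * j + i) (upTo (n i))) id t)
        (∑-cong t (λ i _ → count-map-upTo p (λ j → t * j + i) (n i))))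

    length-core : length coreBeads ≡ t
    length-core = trans (sym (count-all {λ _ → true} coreBeads (λ _ → refl)))
      (trans (count-core (λ _ → true)) (trans (∑-cong t (λ i _ → trans (∑-const (n i) 1) (*-identityʳ (n i)))) ∑n≡t))

    position-res : ∀ i j → i < t → (t * j + i) % t ≡ i
    position-res i j i<t = trans (cong (_% t) (trans (+-comm (t * j) i) (cong (i +_) (*-comm t j)))) (trans ([m+kn]%n≡m%n i j t) (m<n⇒m%n≡m i<t))

    position-≡ : ∀ {x} i j → i < t → x ≡ t * j + i → i ≡ x % t × j ≡ x / t
    position-≡ {x} i j i<t refl = sym r≡ , *-cancelˡ-≡ j (x / t) t (+-cancelʳ-≡ i (t * j) (t * (x / t)) (begin
      t * j + i  ≡⟨ m≡m%n+[m/n]*n x t ⟩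
      x % t + (x / t) * t  ≡⟨ cong₂ _+_ r≡ (*-comm (x / t) t) ⟩
      i + t * (x / t)  ≡⟨ +-comm i _ ⟩
      t * (x / t) + i  ∎))
      where
      open ≡-Reasoning
      r≡ : x % t ≡ i
      r≡ = position-res i j i<t

    -- On an abacus with `t` runners, `x` is position `x / t` of runner `x % t`, and the core
    -- occupies the first `n i` positions of runner `i`, each once.
    count-≡-core : ∀ x → countᵇ (_≡ᵇ x) coreBeads ≡ ind (x / t <ᵇ n (x % t))
    count-≡-core x = begin
      countᵇ (_≡ᵇ x) coreBeads
        ≡⟨ count-core (_≡ᵇ x) ⟩
      ∑ t (λ i → ∑ (n i) (λ j → ind (t * j + i ≡ᵇ x)))
        ≡⟨ ∑-only t {λ i → ∑ (n i) (λ j → ind (t * j + i ≡ᵇ x))} (x % t) (m%n<n x t) (λ i i<t i≢ → ∑-zero (n i) (λ j _ → cong ind (≡ᵇ-false (λ eq → i≢ (proj₁ (position-≡ i j i<t (sym eq))))))) ⟩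
      ∑ (n (x % t)) (λ j → ind (t * j + x % t ≡ᵇ x))
        ≡⟨ ∑-cong (n (x % t)) (λ j _ → cong ind (bool-iff {t * j + x % t ≡ᵇ x} {x / t ≡ᵇ j}
             (λ h → ≡ᵇ-true (sym (proj₂ (position-≡ (x % t) j (m%n<n x t) (sym (≡ᵇ-true⁻¹ {t * j + x % t} {x} h))))))
             (λ h → ≡ᵇ-true (trans (cong (λ q → t * q + x % t) (sym (≡ᵇ-true⁻¹ {x / t} {j} h)))
               (trans (+-comm (t * (x / t)) _) (trans (cong (x % t +_) (*-comm t (x / t))) (sym (m≡m%n+[m/n]*n x t)))))))) ⟩
      ∑ (n (x % t)) (λ j → ind (x / t ≡ᵇ j))
        ≡⟨ ∑-ind-≡ (n (x % t)) (x / t) ⟩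
      ind (x / t <ᵇ n (x % t)) ∎
      where open ≡-Reasoning

    desc-core : Desc coreBeads
    desc-core = sorted⇒Desc (sortD-sorted unsorted) (λ y → ≤-trans (≤-reflexive (count-≡-core y)) (ind≤1 _))

    ∈core : ∀ {x} → x / t < n (x % t) → x ∈ coreBeads
    ∈core {x} h with count-∃ {_≡ᵇ x} coreBeads (≤-reflexive (sym (trans (count-≡-core x) (cong ind (<ᵇ-true h)))))
    ... | y , y∈ , eq = subst (_∈ coreBeads) (≡ᵇ-true⁻¹ eq) y∈

    core∈ : ∀ {x} → x ∈ coreBeads → x / t < n (x % t)
    core∈ {x} x∈ with lt-case (x / t) (n (x % t))
    ... | inj₁ (h , _) = h
    ... | inj₂ (_ , eq) = ⊥-elim (1+n≰n (≤-trans (∃-count coreBeads x∈ (≡ᵇ-refl x)) (≤-reflexive (trans (count-≡-core x) (cong ind eq)))))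

    div-add : ∀ x → (t + x) / t ≡ suc (x / t)
    div-add x = sym (proj₂ (position-≡ (x % t) (suc (x / t)) (m%n<n x t)
      (trans (cong (t +_) (trans (m≡m%n+[m/n]*n x t) (trans (+-comm (x % t) _) (cong (_+ x % t) (*-comm (x / t) t)))))
        (trans (sym (+-assoc t _ _)) (cong (_+ x % t) (sym (*-suc t (x / t))))))))

    mod-add : ∀ x → (t + x) % t ≡ x % t
    mod-add x = trans (cong (_% t) (trans (+-comm t x) (cong (x +_) (sym (*-identityˡ t))))) ([m+kn]%n≡m%n x 1 t)

    low : ∀ {c} → c < t → 1 ≤ n c → c ∈ coreBeads
    low c<t h = ∈core (subst₂ _<_ (sym (m<n⇒m/n≡0 c<t)) (cong n (sym (m<n⇒m%n≡m c<t))) h)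

    high : ∀ {c} → c < t → 2 ≤ n c → t + c ∈ coreBeads
    high {c} c<t h = ∈core (subst₂ _<_ (sym (trans (div-add c) (cong suc (m<n⇒m/n≡0 c<t)))) (cong n (sym (trans (mod-add c) (m<n⇒m%n≡m c<t)))) h)

    higher : ∀ {c} → c < t → 3 ≤ n c → t + (t + c) ∈ coreBeads
    higher {c} c<t h = ∈core (subst₂ _<_ (sym (trans (div-add (t + c)) (cong suc (trans (div-add c) (cong suc (m<n⇒m/n≡0 c<t))))))
      (cong n (sym (trans (mod-add (t + c)) (trans (mod-add c) (m<n⇒m%n≡m c<t))))) h)

    N : ℕ → ℕ
    N x = atLeast x coreBeads

    N≤t : ∀ x → N x ≤ t
    N≤t x = ≤-trans (count≤length _ coreBeads) (≤-reflexive length-core)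

    <length : ∀ {j} → j < t → j < length coreBeads
    <length = subst (_ <_) (sym length-core)

    length-ν : length ν ≡ t
    length-ν = trans (length-map-upTo _ (length coreBeads)) length-core

    part-ν : ∀ {j} → j < t → at ν j ≡ (at coreBeads j + suc j) ∸ t
    part-ν j<t = at-map-upTo _ (length coreBeads) (<length j<t)

    -- With `b_j` the zero-based core beads, the part at `j` is `b_j + j + 1 − t`, so the diagonal
    -- condition on row `j + 1` is `b_j ≥ t`. The beads decrease, so these rows form an initial
    -- segment.
    rank-N : rank ν ≡ N t
    rank-N = trans (cong (λ m → foldr _⊔_ 0 (map g (upTo m))) length-ν) (≤-antisym (max-upper g id t (N t) upper′) (attained (N t) refl))
      where
      g : ℕ → ℕ
      g k = if part ν (suc k) <ᵇ suc k then 0 else suc k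
      upper′ : ∀ k → k < t → g k ≤ N t
      upper′ k k<t with lt-case (at ν k) (suc k)
      ... | inj₁ (_ , eq) rewrite eq = z≤n
      ... | inj₂ (h , eq) rewrite eq with atLeast-at desc-core t k (<length k<t)
      ...   | inj₁ (k<N , _) = k<N
      ...   | inj₂ (_ , b<t) = ⊥-elim (<-irrefl refl (≤-trans (+-monoˡ-≤ (suc k) b<t) (∸-≤⇒ {k} {at coreBeads k + suc k} {t} (subst (suc k ≤_) (part-ν k<t) h))))
      attained : ∀ M → N t ≡ M → M ≤ foldr _⊔_ 0 (map g (upTo t))
      attained zero    _ = z≤n
      attained (suc k) eq = ≤-trans (≤-reflexive (sym g≡)) (max-attained g id t k k<t)
        where
        k<t : k < t
        k<t = subst (_≤ t) eq (N≤t t)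
        big-k : t ≤ at coreBeads k
        big-k with atLeast-at desc-core t k (<length k<t)
        ... | inj₁ (_ , h) = h
        ... | inj₂ (h , _) = ⊥-elim (1+n≰n (subst (_≤ k) eq h))
        g≡ : g k ≡ suc k
        g≡ rewrite <ᵇ-false {at ν k} {suc k} (subst (suc k ≤_) (sym (part-ν k<t)) (⇒-∸-≤ {suc k} {_} {t} (+-monoˡ-≤ (suc k) big-k))) = refl

    -- On each runner of the core, only the bead in position 0 is below `t`.
    rank-formula : rank ν ≡ ∑ t (λ i → n i ∸ 1)
    rank-formula = trans rank-N (trans (count-core (λ y → not (y <ᵇ t))) (∑-cong t (λ i i<t → block i i<t (n i))))
      where
      block : ∀ i → i < t → ∀ m → ∑ m (λ j → ind (not (t * j + i <ᵇ t))) ≡ m ∸ 1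
      block i i<t zero    = refl
      block i i<t (suc m) = trans (cong₂ _+_ (cong (λ p → ind (not p)) (<ᵇ-true (subst (λ k → k + i < t) (sym (*-zeroʳ t)) i<t)))
        (∑-cong m (λ j _ → cong (λ p → ind (not p)) (<ᵇ-false {t * suc j + i} {t} (≤-trans (≤-trans (m≤m+n t (t * j)) (≤-reflexive (sym (*-suc t j)))) (m≤m+n _ i))))))
        (trans (∑-const m 1) (*-identityʳ m))

    Long : ℕ → ℕ → Bool
    Long i j = not ((at coreBeads j + suc j) ∸ t <ᵇ i)

    conj-∑ : ∀ i → conj ν i ≡ ∑ t (λ j → ind (Long i j))
    conj-∑ i = trans (count-map-upTo (λ x → not (x <ᵇ i)) _ (length coreBeads)) (cong (λ m → ∑ m (λ j → ind (Long i j))) length-core)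

    Long-true : ∀ {i j} → t + suc i ≤ at coreBeads j + suc j → Long (suc i) j ≡ true
    Long-true {i} {j} h = cong not (<ᵇ-false (⇒-∸-≤ {suc i} {_} {t} h))

    Long-true⁻¹ : ∀ {i j} → Long (suc i) j ≡ true → t + suc i ≤ at coreBeads j + suc j
    Long-true⁻¹ {i} {j} h with lt-case ((at coreBeads j + suc j) ∸ t) (suc i)
    ... | inj₂ (h′ , _) = ∸-≤⇒ {i} {at coreBeads j + suc j} {t} h′
    ... | inj₁ (_ , eq) with () ← trans (sym h) (cong not eq)

    Long-false : ∀ {i j} → at coreBeads j + suc j < t + suc i → Long (suc i) j ≡ false
    Long-false {i} {j} h with Long (suc i) j in eq
    ... | false = refl
    ... | true  = ⊥-elim (<-irrefl refl (<-≤-trans h (Long-true⁻¹ {i} {j} eq)))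

    Long-antitone : ∀ i → Antitone t (Long (suc i))
    Long-antitone i a b a≤b b<t h = Long-true {i} {a} (≤-trans (Long-true⁻¹ {i} {b} h)
      (≤-trans (≤-reflexive (+-suc _ b)) (≤-trans (s≤s (Desc-at-+ desc-core a≤b (<length b<t))) (≤-reflexive (sym (+-suc _ a))))))

    symplectic-eq : ∀ {x y} i → (ℤ.+ x) ℤ.- (ℤ.+ i) ≡ ((ℤ.+ y) ℤ.- (ℤ.+ i)) ℤ.+ ℤ.1ℤ → x ≡ y + 1
    symplectic-eq {x} {y} i eq = ℤ.+-injective (trans (solve 2 (λ x i → x := (x :- i) :+ i) refl (ℤ.+ x) (ℤ.+ i))
      (trans (cong (ℤ._+ (ℤ.+ i)) eq) (solve 2 (λ y i → ((y :- i) :+ con ℤ.1ℤ) :+ i := y :+ con ℤ.1ℤ) refl (ℤ.+ y) (ℤ.+ i))))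
      where open ℤ.+-*-Solver

    symplectic-eq⁻¹ : ∀ {x y} i → x ≡ y + 1 → (ℤ.+ x) ℤ.- (ℤ.+ i) ≡ ((ℤ.+ y) ℤ.- (ℤ.+ i)) ℤ.+ ℤ.1ℤ
    symplectic-eq⁻¹ {y = y} i refl = solve 2 (λ y i → (y :+ con ℤ.1ℤ) :- i := (y :- i) :+ con ℤ.1ℤ) refl (ℤ.+ y) (ℤ.+ i)
      where open ℤ.+-*-Solver

    module FromSymplectic (symp : Symplectic ν) where

      -- Let `t + a` be bead number `j`. The symplectic condition says that `Long (suc j) q` holds
      -- for exactly `p = a + j + 2` indices, hence precisely for `q < p`. If `dual a` were bead
      -- number `q`, the same inequality would read `q ≥ p`.
      gap : ∀ {a} → t + a ∈ coreBeads → a < s × ¬ dual a ∈ coreBeads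
      gap {a} b∈ with ∈-at b∈
      ... | j , j<len , at≡ = a<s , no-gap
        where
        j<t : j < t
        j<t = subst (j <_) length-core j<len
        j<N : j < N t
        j<N with atLeast-at desc-core t j j<len
        ... | inj₁ (h , _) = h
        ... | inj₂ (_ , h) = ⊥-elim (<-irrefl refl (<-≤-trans (subst (_< t) at≡ h) (m≤m+n t a)))
        p : ℕ
        p = a + suc j + 1
        conj≡ : ∑ t (λ q → ind (Long (suc j) q)) ≡ p
        conj≡ = trans (sym (conj-∑ (suc j))) (trans (symplectic-eq (suc j) (symp (suc j) (s≤s z≤n) (subst (suc j ≤_) (sym rank-N) j<N)))
          (cong (_+ 1) (trans (part-ν j<t) (trans (cong (λ b → b + suc j ∸ t) at≡) (trans (cong (_∸ t) (+-assoc t a (suc j))) (m+n∸m≡n t _))))))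
        p≡ : p ≡ suc (suc (a + j))
        p≡ = solve 2 (λ a j → a :+ (con 1 :+ j) :+ con 1 := con 2 :+ (a :+ j)) refl a j
          where open +-*-Solver
        a<s : a < s
        a<s = ≤-trans (s≤s (m≤m+n a j)) (≤-pred (≤-trans (≤-reflexive (trans (sym p≡) (sym conj≡))) (∑-ind≤ t (Long (suc j)))))
        shift : ∀ q → dual a + suc q + suc a ≡ s + suc q
        shift q = trans (solve 3 (λ d q a → d :+ q :+ a := (a :+ d) :+ q) refl (dual a) (suc q) (suc a)) (cong (_+ suc q) (dual-sum a<s))
          where open +-*-Solver
        target : t + suc j + suc a ≡ s + suc p
        target = trans (solve 3 (λ s j a → con 1 :+ s :+ (con 1 :+ j) :+ (con 1 :+ a) := s :+ (con 1 :+ (con 2 :+ (a :+ j)))) refl s j a)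
          (cong (λ k → s + suc k) (sym p≡))
          where open +-*-Solver
        no-gap : ¬ dual a ∈ coreBeads
        no-gap d∈ with ∈-at d∈
        ... | q , q<len , at≡′ with ∑-prefix⁻¹ t (Long (suc j)) (Long-antitone j) q (subst (q <_) length-core q<len)
        ...   | inj₁ (q<p , long) = 1+n≰n (≤-trans (s≤s (≤-pred (+-cancelˡ-≤ s (suc p) (suc q) (begin
          s + suc p  ≡⟨ sym target ⟩
          t + suc j + suc a  ≤⟨ +-monoˡ-≤ (suc a) (Long-true⁻¹ {j} {q} long) ⟩
          at coreBeads q + suc q + suc a ≡⟨ cong (λ b → b + suc q + suc a) at≡′ ⟩
          dual a + suc q + suc a  ≡⟨ shift q ⟩
          s + suc q  ∎)))) (subst (q <_) conj≡ q<p))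
          where open ≤-Reasoning
        ...   | inj₂ (p≤q , short) with t + suc j ≤? dual a + suc q
        ...     | yes h with () ← trans (sym short) (Long-true {j} {q} (subst (λ b → t + suc j ≤ b + suc q) (sym at≡′) h))
        ...     | no h = 1+n≰n (≤-trans (≤-pred (+-cancelˡ-≤ s (suc (suc q)) (suc p) (begin
          s + suc (suc q)  ≡⟨ +-suc s (suc q) ⟩
          suc (s + suc q)  ≡⟨ cong suc (sym (shift q)) ⟩
          suc (dual a + suc q) + suc a   ≤⟨ +-monoˡ-≤ (suc a) (≰⇒> h) ⟩
          t + suc j + suc a  ≡⟨ target ⟩
          s + suc p  ∎))) (subst (_≤ q) conj≡ p≤q))
          where open ≤-Reasoning

      double⇒ : ∀ {c} → c < t → 2 ≤ n c → c < s × n (dual c) ≡ 0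
      double⇒ {c} c<t h = c<s , n<1⇒n≡0 (≰⇒> (λ 1≤ → proj₂ (gap (high c<t h)) (low (m<n⇒m<1+n (dual<s c<s)) 1≤)))
        where
        c<s : c < s
        c<s = proj₁ (gap (high c<t h))

      n≤2 : ∀ {c} → c < t → n c ≤ 2
      n≤2 {c} c<t with n c ≤? 2
      ... | yes h = h
      -- A third bead would put `t + (t + c)` into the core, while `gap` allows `t + a` only for
      -- `a < s`.
      ... | no h = ⊥-elim (1+n≰n (≤-trans (s≤s (≤-trans (n≤1+n s) (m≤m+n t c))) (proj₁ (gap (higher c<t (≰⇒> h))))))

      counts : Counts
      counts = counts-from-≤ last≤ pair≤ mid≤
        where
        last≤ : n s ≤ 1
        last≤ with n s ≤? 1
        ... | yes h = h
        ... | no h = ⊥-elim (<-irrefl refl (proj₁ (double⇒ (n<1+n s) (≰⇒> h))))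
        pair≤ : ∀ c → c < u → n c + n (dual c) ≤ 2
        pair≤ c c<u with n c ≤? 1 | n (dual c) ≤? 1
        ... | yes h | yes h′ = +-mono-≤ h h′
        ... | no h  | _ = ≤-trans (≤-reflexive (trans (cong (n c +_) (proj₂ (double⇒ c<t (≰⇒> h)))) (+-identityʳ (n c)))) (n≤2 c<t)
          where c<t = m<n⇒m<1+n (<-≤-trans c<u u≤s)
        ... | yes _ | no h = ≤-trans (≤-reflexive (cong (_+ n (dual c)) (trans (cong n (sym (dual-involutive c<s))) (proj₂ (double⇒ d<t (≰⇒> h)))))) (n≤2 d<t)
          where
          c<s = <-≤-trans c<u u≤s
          d<t = m<n⇒m<1+n (dual<s c<s)
        mid≤ : e * n u ≤ e
        mid≤ = go e refl e≤1
          where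
          go : ∀ e′ → e′ ≡ e → e′ ≤ 1 → e′ * n u ≤ e′
          go zero          _ _ = z≤n
          go (suc (suc _)) _ (s≤s ())
          go (suc zero) eq _ with n u ≤? 1
          ... | yes h = ≤-trans (≤-reflexive (+-identityʳ (n u))) h
          ... | no h = ⊥-elim (h (≤-trans (≤-reflexive (trans (cong n (sym (dual-mid (sym eq)))) (proj₂ (double⇒ (s≤s u≤s) (≰⇒> h))))) z≤n))

    module FromCounts (counts : Counts) where
      open Counts counts

      n-dual : ∀ {c} → c < s → n c + n (dual c) ≡ 2
      n-dual {c} c<s with residue c (m<n⇒m<1+n c<s)
      ... | last c≡s = ⊥-elim (<⇒≢ c<s c≡s)
      ... | lower c<u = pair-count c c<u
      ... | upper _ c′<u = trans (+-comm (n c) _) (trans (cong (λ k → n (dual c) + n k) (sym (dual-involutive c<s))) (pair-count (dual c) c′<u))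
      ... | mid refl e≡1 = cong₂ _+_ (n-mid e≡1) (trans (cong n (dual-mid e≡1)) (n-mid e≡1))

      n≤2 : ∀ {c} → c < t → n c ≤ 2
      n≤2 {c} (s≤s c≤s) with c ≟ s
      ... | yes refl = ≤-trans (≤-reflexive last-count) (s≤s z≤n)
      ... | no c≢s = ≤-trans (m≤m+n (n c) _) (≤-reflexive (n-dual (≤∧≢⇒< c≤s c≢s)))

      one-of : ∀ {c} → c < s → ind (0 <ᵇ n (dual c)) + ind (1 <ᵇ n c) ≡ 1
      one-of {c} c<s = go (n c) (n (dual c)) (n-dual c<s)
        where
        go : ∀ x y → x + y ≡ 2 → ind (0 <ᵇ y) + ind (1 <ᵇ x) ≡ 1
        go 0 2 refl = refl
        go 1 1 refl = refl
        go 2 0 refl = refl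
        go (suc (suc (suc _))) y ()

      -- Exactly one of `dual a` and `t + a`, which are reflections of each other about `s`, is a
      -- core bead. So the interval around `s` gains one bead each time it grows at both ends,
      -- starting with the bead `s` itself.
      N-symmetric : ∀ a → a ≤ s → N (s ∸ a) ≡ suc a + N (t + a)
      N-symmetric zero _ = trans (atLeast-step s coreBeads) (cong₂ _+_
        (trans (count-≡-core s) (cong ind (trans (cong₂ (λ q r → q <ᵇ n r) (m<n⇒m/n≡0 (n<1+n s)) (m<n⇒m%n≡m (n<1+n s))) (cong (0 <ᵇ_) last-count))))
        (cong N (sym (+-identityʳ t))))
      N-symmetric (suc a) a<s = begin
        N (dual a)
          ≡⟨ atLeast-step (dual a) coreBeads ⟩
        countᵇ (_≡ᵇ dual a) coreBeads + N (suc (dual a))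
          ≡⟨ cong₂ _+_ (trans (count-≡-core (dual a)) (cong ind (cong₂ (λ q r → q <ᵇ n r) (m<n⇒m/n≡0 d<t) (m<n⇒m%n≡m d<t)))) (cong N (sym (+-∸-assoc 1 a<s))) ⟩
        x + N (s ∸ a)
          ≡⟨ cong (x +_) (N-symmetric a (<⇒≤ a<s)) ⟩
        x + (suc a + N (t + a))
          ≡⟨ cong (λ k → x + (suc a + k)) (trans (atLeast-step (t + a) coreBeads) (cong₂ _+_
               (trans (count-≡-core (t + a)) (cong ind (cong₂ (λ q r → q <ᵇ n r) (trans (div-add a) (cong suc (m<n⇒m/n≡0 a<t))) (trans (mod-add a) (m<n⇒m%n≡m a<t)))))
               (cong N (sym (+-suc t a))))) ⟩
        x + (suc a + (y + N (t + suc a)))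
          ≡⟨ solve 4 (λ x a y z → x :+ (a :+ (y :+ z)) := (x :+ y) :+ (a :+ z)) refl x (suc a) y (N (t + suc a)) ⟩
        (x + y) + (suc a + N (t + suc a))
          ≡⟨ cong (_+ (suc a + N (t + suc a))) (one-of a<s) ⟩
        suc (suc a) + N (t + suc a) ∎
        where
        open ≡-Reasoning
        open +-*-Solver
        d<t = m<n⇒m<1+n (dual<s a<s)
        a<t = m<n⇒m<1+n a<s
        x = ind (0 <ᵇ n (dual a))
        y = ind (1 <ᵇ n a)

      -- By `N-symmetric`, exactly `p` core beads are at least `s − a`. As `b_q + q` decreases
      -- weakly, the conjugate part is found by testing the inequality only at the beads numbered
      -- `p − 1` and `p`, on the two sides of the gap at `dual a`.
      symplectic : Symplectic ν
      symplectic (suc j) _ 1+j≤rank = symplectic-eq⁻¹ (suc j) (trans (conj-∑ (suc j)) (trans (∑-prefix t (Long (suc j)) p p≤t long short) p≡))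
        where
        j<N : j < N t
        j<N = subst (suc j ≤_) rank-N 1+j≤rank
        j<t : j < t
        j<t = ≤-trans j<N (N≤t t)
        b = at coreBeads j
        b∈ : b ∈ coreBeads
        b∈ = at-∈ coreBeads (<length j<t)
        t≤b : t ≤ b
        t≤b with atLeast-at desc-core t j (<length j<t)
        ... | inj₁ (_ , h) = h
        ... | inj₂ (h , _) = ⊥-elim (1+n≰n (≤-trans j<N h))
        a = b % t
        b/t≡1 : b / t ≡ 1
        b/t≡1 = ≤-antisym (≤-pred (≤-trans (core∈ b∈) (n≤2 (m%n<n b t)))) (m≥n⇒m/n>0 t≤b)
        b≡ : b ≡ t + a
        b≡ = trans (m≡m%n+[m/n]*n b t) (trans (cong (λ q → a + q * t) b/t≡1) (trans (cong (a +_) (*-identityˡ t)) (+-comm a t)))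
        2≤n : 2 ≤ n a
        2≤n = subst (_< n a) b/t≡1 (core∈ b∈)
        a<s : a < s
        a<s = ≤∧≢⇒< (≤-pred (m%n<n b t)) (λ a≡s → 1+n≰n (≤-trans 2≤n (≤-reflexive (trans (cong n a≡s) last-count))))
        n-dual≡0 : n (dual a) ≡ 0
        n-dual≡0 = n≤0⇒n≡0 (+-cancelˡ-≤ 2 _ _ (≤-trans (+-monoˡ-≤ _ 2≤n) (≤-reflexive (n-dual a<s))))
        N-b : N (t + a) ≡ suc j
        N-b = trans (cong N (sym b≡)) (≤-antisym upper′ lower′)
          where
          lower′ : suc j ≤ N b
          lower′ with atLeast-at desc-core b j (<length j<t)
          ... | inj₁ (h , _) = h
          ... | inj₂ (_ , h) = ⊥-elim (<-irrefl refl h)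
          upper′ : N b ≤ suc j
          upper′ with suc j <? N b
          ... | no h = ≮⇒≥ h
          ... | yes h with atLeast-at desc-core b (suc j) (<length (≤-trans h (N≤t b)))
          ...   | inj₁ (_ , h′) = ⊥-elim (<-irrefl refl (<-≤-trans (Desc-at desc-core (n<1+n j) (<length (≤-trans h (N≤t b)))) h′))
          ...   | inj₂ (h′ , _) = ⊥-elim (1+n≰n (≤-trans h h′))
        p = suc a + suc j
        N-gap : N (s ∸ a) ≡ p
        N-gap = trans (N-symmetric a (<⇒≤ a<s)) (cong (suc a +_) N-b)
        p≤t : p ≤ t
        p≤t = subst (_≤ t) N-gap (N≤t (s ∸ a))
        p≡ : p ≡ part ν (suc j) + 1
        p≡ = sym (trans (cong (_+ 1) (trans (part-ν j<t) (trans (cong (λ b → b + suc j ∸ t) b≡) (trans (cong (_∸ t) (+-assoc t a (suc j))) (m+n∸m≡n t _)))))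
          (+-comm (a + suc j) 1))
        long : ∀ q → q < p → Long (suc j) q ≡ true
        long q q<p = Long-true {j} {q} (begin
          t + suc j  ≡⟨ cong (λ k → suc (k + suc j)) (sym (m∸n+n≡m (<⇒≤ a<s))) ⟩
          suc (s ∸ a + a + suc j)  ≡⟨ cong suc (+-assoc (s ∸ a) a (suc j)) ⟩
          suc (s ∸ a + (a + suc j))  ≤⟨ s≤s (+-monoˡ-≤ (a + suc j) last-long) ⟩
          suc (at coreBeads (a + suc j) + (a + suc j))  ≤⟨ s≤s (Desc-at-+ desc-core (≤-pred q<p) (<length p≤t)) ⟩
          suc (at coreBeads q + q)  ≡⟨ sym (+-suc _ q) ⟩
          at coreBeads q + suc q  ∎)
          where
          open ≤-Reasoning
          last-long : s ∸ a ≤ at coreBeads (a + suc j)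
          last-long with atLeast-at desc-core (s ∸ a) (a + suc j) (<length p≤t)
          ... | inj₁ (_ , h) = h
          ... | inj₂ (h , _) = ⊥-elim (1+n≰n (subst (_≤ a + suc j) N-gap h))
        short : ∀ q → p ≤ q → q < t → Long (suc j) q ≡ false
        short q p≤q q<t = Long-false {j} {q} (begin-strict
          at coreBeads q + suc q  ≡⟨ +-suc _ q ⟩
          suc (at coreBeads q + q)  ≤⟨ s≤s (Desc-at-+ desc-core p≤q (<length q<t)) ⟩
          suc (at coreBeads p + p)  <⟨ s≤s (+-monoˡ-< p first-short) ⟩
          suc (dual a + (suc a + suc j))  ≡⟨ cong suc (sym (+-assoc (dual a) (suc a) (suc j))) ⟩
          suc (dual a + suc a + suc j)  ≡⟨ cong (λ k → suc (k + suc j)) (m∸n+n≡m a<s) ⟩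
          t + suc j  ∎)
          where
          open ≤-Reasoning
          p<t : p < t
          p<t = ≤-<-trans p≤q q<t
          d<t : dual a < t
          d<t = m<n⇒m<1+n (dual<s a<s)
          first-short : at coreBeads p < dual a
          first-short with atLeast-at desc-core (s ∸ a) p (<length p<t)
          ... | inj₁ (h , _) = ⊥-elim (1+n≰n (subst (p <_) N-gap h))
          -- Strictness is essential: a bead equal to `dual a` would make row `p` long as well, and
          -- it is excluded because runner `dual a` is empty.
          ... | inj₂ (_ , h) = ≤∧≢⇒< (≤-pred (subst (at coreBeads p <_) (+-∸-assoc 1 a<s) h)) λ at≡ →
            n≮0 (subst₂ _<_ (m<n⇒m/n≡0 d<t) (trans (cong n (m<n⇒m%n≡m d<t)) n-dual≡0)
              (core∈ (subst (_∈ coreBeads) at≡ (at-∈ coreBeads (<length p<t)))))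

  -- The sorting permutation

  ascents : List ℕ → ℕ
  ascents []       = 0
  ascents (x ∷ xs) = countᵇ (x <ᵇ_) xs + ascents xs

  ascents-insert-max : ∀ xs v ys → (∀ {y} → y ∈ xs ++ ys → y < v) → ascents (xs ++ v ∷ ys) ≡ length xs + ascents (xs ++ ys)
  ascents-insert-max []       v ys h = cong (_+ ascents ys) (count-zero ys (λ y∈ → <ᵇ-false (<⇒≤ (h y∈))))
  ascents-insert-max (x ∷ xs) v ys h
    rewrite count-++ (x <ᵇ_) xs (v ∷ ys) | count-++ (x <ᵇ_) xs ys | count-∷ (x <ᵇ_) v ys | <ᵇ-true (h (here refl))
          | ascents-insert-max xs v ys (h ∘ there) =
    solve 4 (λ a b c d → (a :+ (con 1 :+ b)) :+ (c :+ d) := con 1 :+ (c :+ ((a :+ b) :+ d))) refl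
      (countᵇ (x <ᵇ_) xs) (countᵇ (x <ᵇ_) ys) (length xs) (ascents (xs ++ ys))
    where open +-*-Solver

  inversions-reverse : ∀ (g : ℕ → ℕ) xs → (∀ {x y} → x ∈ xs → y ∈ xs → (g y <ᵇ g x) ≡ (x <ᵇ y)) →
    inversions (map g xs) ≡ ascents xs
  inversions-reverse g []       h = refl
  inversions-reverse g (x ∷ xs) h = cong₂ _+_
    (trans (count-map (_<ᵇ g x) g xs) (count-cong xs (λ y∈ → h (here refl) (there y∈))))
    (inversions-reverse g xs (λ x∈ y∈ → h (there x∈) (there y∈)))

  module Sorting (s : ℕ) where
    private t = suc s

    -- Positions are counted along a decreasing list, so the inversions of `sigma` are the ascents
    -- among the beads it lists.
    indexOf-reverses : ∀ {bs} → Desc bs → ∀ {x y} → x ∈ bs → y ∈ bs → (indexOf t bs y <ᵇ indexOf t bs x) ≡ (x <ᵇ y)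
    indexOf-reverses {z ∷ zs} (z> ∷ d) (here refl) (here refl) rewrite ≡ᵇ-refl z = sym (<ᵇ-false (≤-refl {z}))
    indexOf-reverses {z ∷ zs} (z> ∷ d) (here refl) (there y∈)
      rewrite ≡ᵇ-refl z = sym (<ᵇ-false (<⇒≤ (All.lookup z> y∈)))
    indexOf-reverses {z ∷ zs} (z> ∷ d) {x} (there x∈) (here refl)
      rewrite ≡ᵇ-refl z | ≡ᵇ-false {z} {x} (<⇒≢ (All.lookup z> x∈) ∘ sym) = sym (<ᵇ-true (All.lookup z> x∈))
    indexOf-reverses {z ∷ zs} (z> ∷ d) {x} {y} (there x∈) (there y∈)
      rewrite ≡ᵇ-false {z} {x} (<⇒≢ (All.lookup z> x∈) ∘ sym) | ≡ᵇ-false {z} {y} (<⇒≢ (All.lookup z> y∈) ∘ sym) = indexOf-reverses d x∈ y∈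

    block : List ℕ → ℕ → List ℕ
    block xs i = filterᵇ (λ x → x % t ≡ᵇ i) xs

    blocks : (ℕ → ℕ) → ℕ → List ℕ → List ℕ
    blocks f m xs = concat (map (block xs) (applyUpTo f m))

    ∈-blocks : ∀ f m {xs y} → y ∈ blocks f m xs → y ∈ xs
    ∈-blocks f (suc m) {xs} y∈ with ∈-++⁻ (block xs (f 0)) y∈
    ... | inj₁ y∈′ = proj₁ (∈-filter (λ x → x % t ≡ᵇ f 0) xs y∈′)
    ... | inj₂ y∈′ = ∈-blocks (f ∘ suc) m y∈′

    block-hit : ∀ x xs i → x % t ≡ i → block (x ∷ xs) i ≡ x ∷ block xs i
    block-hit x xs i eq rewrite ≡ᵇ-true eq = refl

    block-miss : ∀ x xs i → x % t ≢ i → block (x ∷ xs) i ≡ block xs i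
    block-miss x xs i neq rewrite ≡ᵇ-false neq = refl

    blocks-miss : ∀ f m x xs → (∀ i → i < m → x % t ≢ f i) → blocks f m (x ∷ xs) ≡ blocks f m xs
    blocks-miss f zero    x xs h = refl
    blocks-miss f (suc m) x xs h = cong₂ _++_ (block-miss x xs (f 0) (h 0 (s≤s z≤n))) (blocks-miss (f ∘ suc) m x xs (λ i i<m → h (suc i) (s≤s i<m)))

    length-blocks : ∀ f m xs → length (blocks f m xs) ≡ ∑ m (λ i → countᵇ (λ x → x % t ≡ᵇ f i) xs)
    length-blocks f m xs = trans (sym (count-all {λ _ → true} (blocks f m xs) (λ _ → refl)))
      (trans (count-concat-applyUpTo (λ _ → true) (block xs) f m) (∑-cong m (λ i _ → count-all (block xs (f i)) (λ _ → refl))))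

    blocks-insert : ∀ f m k x xs → k < m → x % t ≡ f k → (∀ i → i < m → i ≢ k → x % t ≢ f i) →
      ∃ λ B → blocks f m (x ∷ xs) ≡ blocks f k xs ++ x ∷ B × blocks f m xs ≡ blocks f k xs ++ B
    blocks-insert f (suc m) zero x xs _ hit miss = block xs (f 0) ++ blocks (f ∘ suc) m xs ,
      cong₂ _++_ (block-hit x xs (f 0) hit) (blocks-miss (f ∘ suc) m x xs (λ i i<m → miss (suc i) (s≤s i<m) λ ())) , refl
    blocks-insert f (suc m) (suc k) x xs (s≤s k<m) hit miss
      with blocks-insert (f ∘ suc) m k x xs k<m hit (λ i i<m i≢k → miss (suc i) (s≤s i<m) (i≢k ∘ suc-injective))
    ... | B , eq , eq′ = B ,
      trans (cong₂ _++_ (block-miss x xs (f 0) (miss 0 (s≤s z≤n) λ ())) eq) (sym (++-assoc (block xs (f 0)) _ _)) ,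
      trans (cong (block xs (f 0) ++_) eq′) (sym (++-assoc (block xs (f 0)) _ _))

    -- The largest bead `x` enters at the head of its block. It forms an ascent with every bead of
    -- smaller residue and with no other, and these beads are also what its residue is inverted with
    -- in the list of residues.
    ascents-blocks : ∀ {bs} → Desc bs → ascents (blocks id t bs) ≡ inversions (map (_% t) bs)
    ascents-blocks {[]}     []       = cong ascents (none t {id})
      where
      none : ∀ m {f} → blocks f m [] ≡ []
      none zero    = refl
      none (suc m) = none m
    ascents-blocks {x ∷ xs} (x> ∷ d) with blocks-insert id t (x % t) x xs (m%n<n x t) refl (λ i _ i≢ → i≢ ∘ sym)
    ... | B , eq , eq′ = begin
      ascents (blocks id t (x ∷ xs))  ≡⟨ cong ascents eq ⟩
      ascents (A ++ x ∷ B)  ≡⟨ ascents-insert-max A x B (λ y∈ → All.lookup x> (∈-blocks id t (subst (_ ∈_) (sym eq′) y∈))) ⟩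
      length A + ascents (A ++ B)  ≡⟨ cong₂ _+_ (trans (length-blocks id (x % t) xs) (sym (count-<-∑ (_% t) (x % t) xs))) (trans (cong ascents (sym eq′)) (ascents-blocks d)) ⟩
      countᵇ (λ y → y % t <ᵇ x % t) xs + inversions (map (_% t) xs) ≡⟨ cong (_+ inversions (map (_% t) xs)) (sym (count-map (_<ᵇ x % t) (_% t) xs)) ⟩
      inversions (map (_% t) (x ∷ xs))  ∎
      where
      open ≡-Reasoning
      A = blocks id (x % t) xs

    map-sortD-block : ∀ {bs} → Desc bs → ∀ is → map (λ i → sortD (block bs i)) is ≡ map (block bs) is
    map-sortD-block d []       = refl
    map-sortD-block d (i ∷ is) = cong₂ _∷_ (sortD-Desc (filter-Desc (λ x → x % t ≡ᵇ i) d)) (map-sortD-block d is)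

    inversions-sorting : ∀ {bs} → Desc bs →
      inversions (map (indexOf t bs) (concat (map (λ i → sortD (block bs i)) (upTo t)))) ≡ inversions (map (_% t) bs)
    inversions-sorting {bs} d = trans (cong (λ l → inversions (map (indexOf t bs) (concat l))) (map-sortD-block d (upTo t)))
      (trans (inversions-reverse (indexOf t bs) (blocks id t bs) (λ x∈ y∈ → indexOf-reverses d (∈-blocks id t x∈) (∈-blocks id t y∈)))
        (ascents-blocks d))

  module QuotientPair (s : ℕ) where
    open Quotient s
    private t = suc s

    SameResidue : List ℕ → Set
    SameResidue es = ∀ {x y} → x ∈ es → y ∈ es → x % t ≡ y % t

    pair-lengths : ∀ es es′ → Desc es → Desc es′ → SameResidue es → SameResidue es′ → length es + length es′ ≡ 2 →
      (quotLen es + quotLen es′ ≤ 1 → bigs es + bigs es′ ≤ 1) × (bigs es + bigs es′ ≤ 1 → quotLen es + quotLen es′ ≤ 1)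
    pair-lengths []           (x ∷ y ∷ []) _ ((x>y ∷ _) ∷ _) _ same refl with quotLen-2 x>y (same (here refl) (there (here refl)))
    ... | inj₁ (h , h′) = (λ _ → h′) , (λ _ → h)
    ... | inj₂ (h , h′) = (λ q → ⊥-elim (1+n≰n (subst (_≤ 1) h q))) , (λ q → ⊥-elim (1+n≰n (subst (_≤ 1) h′ q)))
    pair-lengths (x ∷ [])     (y ∷ [])     _ _ _ _ refl = subst (_≤ 1) eq , subst (_≤ 1) (sym eq)
      where
      eq : quotLen (x ∷ []) + quotLen (y ∷ []) ≡ bigs (x ∷ []) + bigs (y ∷ [])
      eq = cong₂ _+_ (quotLen-1 x) (quotLen-1 y)
    pair-lengths (x ∷ y ∷ []) [] ((x>y ∷ _) ∷ _) _ same _ refl with quotLen-2 x>y (same (here refl) (there (here refl)))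
    ... | inj₁ (h , h′) = (λ _ → ≤-trans (≤-reflexive (+-identityʳ _)) h′) , (λ _ → ≤-trans (≤-reflexive (+-identityʳ _)) h)
    ... | inj₂ (h , h′) = (λ q → ⊥-elim (1+n≰n (subst (_≤ 1) (trans (+-identityʳ _) h) q))) , (λ q → ⊥-elim (1+n≰n (subst (_≤ 1) (trans (+-identityʳ _) h′) q)))
    pair-lengths [] [] _ _ _ _ ()
    pair-lengths [] (_ ∷ []) _ _ _ _ ()
    pair-lengths [] (_ ∷ _ ∷ _ ∷ _) _ _ _ _ ()
    pair-lengths (_ ∷ []) [] _ _ _ _ ()
    pair-lengths (_ ∷ []) (_ ∷ _ ∷ _) _ _ _ _ ()
    pair-lengths (_ ∷ _ ∷ []) (_ ∷ _) _ _ _ _ ()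
    pair-lengths (_ ∷ _ ∷ _ ∷ _) _ _ _ _ _ ()

  -- Translation of the conditions and of ε into bead counts

  sum-filter-applyUpTo : ∀ (g : ℕ → ℕ) (q : ℕ → Bool) (f : ℕ → ℕ) m →
    sum (map g (filterᵇ q (applyUpTo f m))) ≡ ∑ m (λ i → if q (f i) then g (f i) else 0)
  sum-filter-applyUpTo g q f zero    = refl
  sum-filter-applyUpTo g q f (suc m) with q (f 0)
  ... | true  = cong (g (f 0) +_) (sum-filter-applyUpTo g q (f ∘ suc) m)
  ... | false = sum-filter-applyUpTo g q (f ∘ suc) m

  par-∣⊖∣ : ∀ a b → par ∣ b ⊖ a ∣ ≡ par a xor par b
  par-∣⊖∣ zero    b       = refl
  par-∣⊖∣ (suc a) zero    = sym (xor-identityʳ (par (suc a)))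
  par-∣⊖∣ (suc a) (suc b) = trans (cong (par ∘ ∣_∣) (ℤ.[1+m]⊖[1+n]≡m⊖n b a)) (trans (par-∣⊖∣ a b) (sym (xor-annihilates-not (par a) (par b))))

  par-∣-+∣ : ∀ a b → par ∣ ℤ.- (ℤ.+ a) ℤ.+ (ℤ.+ b) ∣ ≡ par a xor par b
  par-∣-+∣ a b = trans (cong (par ∘ ∣_∣) (trans (ℤ.+-comm (ℤ.- (ℤ.+ a)) (ℤ.+ b)) (ℤ.m-n≡m⊖n b a))) (par-∣⊖∣ a b)

  binary : ∀ s → ∃₂ λ e u → e ≤ 1 × s ≡ e + (u + u)
  binary zero          = 0 , 0 , z≤n , refl
  binary (suc zero)    = 1 , 0 , s≤s z≤n , refl
  binary (suc (suc s)) with binary s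
  ... | e , u , e≤1 , refl = e , suc u , e≤1 , sym (trans (cong (e +_) (cong suc (+-suc u u))) (trans (+-suc e _) (cong suc (+-suc e _))))

  sorted-at : ∀ {xs} → AllPairs _≥_ xs → ∀ {i j} → i < j → j < length xs → at xs j ≤ at xs i
  sorted-at {x ∷ xs} (x≥ ∷ d) {zero}  {suc j} _         (s≤s j<n) = All.lookup x≥ (at-∈ xs j<n)
  sorted-at {x ∷ xs} (x≥ ∷ d) {suc i} {suc j} (s≤s i<j) (s≤s j<n) = sorted-at d i<j j<n

  beta-Desc : ∀ lam t → length lam ≡ t → Linked _≥_ lam → Desc (beta lam t)
  beta-Desc lam t len≡ linked = subst Desc (sym (map-upTo _ t)) (applyUpTo⁺₁ _ t (λ i<j j<t →
    +-mono-≤-< (sorted-at (Linked⇒AllPairs (λ p q → ≤-trans q p) linked) i<j (subst (_ <_) (sym len≡) j<t))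
      (∸-monoʳ-< (s≤s i<j) j<t)))

  module Assembly (e u : ℕ) (e≤1 : e ≤ 1) (s : ℕ) (s≡ : s ≡ e + (u + u))
                  (lam : List ℕ) (desc : Desc (beta lam (suc s))) where

    bs : List ℕ
    bs = beta lam (suc s)

    len≡ : length bs ≡ suc s
    len≡ = length-map-upTo _ (suc s)

    open Beads e u e≤1 s s≡ bs desc len≡
    open Core e u e≤1 s s≡ bs desc len≡ using (module FromSymplectic; module FromCounts; rank-formula)
    open Parity e u e≤1 s s≡ bs desc len≡
    open Quotient s
    open QuotientPair s
    open Sorting s

    len-quot : ∀ i → len (quot t lam i) ≡ quotLen (block bs i)
    len-quot i = cong quotLen (sortD-Desc (filter-Desc (λ x → x % t ≡ᵇ i) desc))

    bigs-block : ∀ i → bigs (block bs i) ≡ B i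
    bigs-block i = count-filter big (λ x → x % t ≡ᵇ i) bs

    same-residue : ∀ i → SameResidue (block bs i)
    same-residue i x∈ y∈ = trans (residue-of x∈) (sym (residue-of y∈))
      where
      residue-of : ∀ {x} → x ∈ block bs i → x % t ≡ i
      residue-of x∈ = ≡ᵇ-true⁻¹ (proj₂ (∈-filter (λ x → x % t ≡ᵇ i) bs x∈))

    -- The class sizes are assumed because the comparison of quotient lengths with big beads is made
    -- for exactly two beads in the pair.
    quot-big : Counts → ∀ c → c < u →
      (len (quot t lam c) + len (quot t lam (dual c)) ≤ 1 → B c + B (dual c) ≤ 1) ×
      (B c + B (dual c) ≤ 1 → len (quot t lam c) + len (quot t lam (dual c)) ≤ 1)
    quot-big counts c c<u =
      (λ h → subst (_≤ 1) big≡ (proj₁ pair (subst (_≤ 1) len≡′ h))) ,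
      (λ h → subst (_≤ 1) (sym len≡′) (proj₂ pair (subst (_≤ 1) (sym big≡) h)))
      where
      big≡ : bigs (block bs c) + bigs (block bs (dual c)) ≡ B c + B (dual c)
      big≡ = cong₂ _+_ (bigs-block c) (bigs-block (dual c))
      len≡′ : len (quot t lam c) + len (quot t lam (dual c)) ≡ quotLen (block bs c) + quotLen (block bs (dual c))
      len≡′ = cong₂ _+_ (len-quot c) (len-quot (dual c))
      pair = pair-lengths (block bs c) (block bs (dual c)) (filter-Desc (λ x → x % t ≡ᵇ c) desc) (filter-Desc (λ x → x % t ≡ᵇ dual c) desc)
        (same-residue c) (same-residue (dual c)) (Counts.pair-count counts c c<u)

    double≡ : ∀ i → 2 * i + 3 ≡ suc (suc i + suc i)
    double≡ = solve 1 (λ i → con 2 :* i :+ con 3 := con 1 :+ ((con 1 :+ i) :+ (con 1 :+ i))) refl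
      where open +-*-Solver

    <u⇒ : ∀ {i} → i < u → 2 * i + 3 ≤ t
    <u⇒ {i} i<u = subst (_≤ t) (sym (double≡ i)) (s≤s (double<s i<u))

    ⇒<u : ∀ {i} → 2 * i + 3 ≤ t → i < u
    ⇒<u {i} h with i <? u
    ... | yes i<u = i<u
    ... | no i≮u = ⊥-elim (1+n≰n (≤-trans (≤-trans (≤-pred (subst (_≤ t) (double≡ i) h)) (≤-trans (≤-reflexive s≡) (+-monoˡ-≤ (u + u) e≤1)))
      (≤-trans (s≤s (+-mono-≤ (≮⇒≥ i≮u) (≮⇒≥ i≮u))) (≤-reflexive (sym (+-suc i i))))))

    Cond⇒Good : Cond t lam → Good
    Cond⇒Good (symp , quots) = mkGood counts λ c c<u →
      proj₁ (quot-big counts c c<u) (subst (λ d → len (quot t lam c) + len (quot t lam d) ≤ 1) (∸-+-assoc s 1 c) (quots c (<u⇒ c<u)))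
      where counts = FromSymplectic.counts symp

    Good⇒Cond : Good → Cond t lam
    Good⇒Cond good = FromCounts.symplectic counts , λ i h →
      subst (λ d → len (quot t lam i) + len (quot t lam d) ≤ 1) (sym (∸-+-assoc s 1 i)) (proj₂ (quot-big counts i (⇒<u h)) (pair-big i (⇒<u h)))
      where open Good good

    -- Supplies the case distinction that the ring cannot: whether the determinant vanishes need not
    -- be decidable.
    Counts? : Dec Counts
    Counts? with n s ≟ 1 | allUpTo? (λ c → n c + n (dual c) ≟ 2) u | e * n u ≟ e
    ... | yes h₁ | yes h₂ | yes h₃ = yes (mkCounts h₁ (λ c c<u → h₂ c<u) h₃)
    ... | no h₁  | _      | _      = no (h₁ ∘ Counts.last-count)
    ... | yes _  | no h₂  | _      = no (λ counts → h₂ (λ {c} → Counts.pair-count counts c))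
    ... | yes _  | yes _  | no h₃  = no (h₃ ∘ Counts.mid-count)

    t/2 : t / 2 ≡ e + u
    t/2 = begin
      t / 2  ≡⟨ cong (λ k → suc k / 2) s≡ ⟩
      (suc e + (u + u)) / 2      ≡⟨ cong (λ k → (suc e + k) / 2) (solve 1 (λ u → u :+ u := u :* con 2) refl u) ⟩
      (suc e + u * 2) / 2        ≡⟨ +-distrib-/-∣ʳ (suc e) (divides u refl) ⟩
      suc e / 2 + u * 2 / 2      ≡⟨ cong₂ _+_ (small e e≤1) (m*n/n≡m u 2) ⟩
      e + u  ∎
      where
      open ≡-Reasoning
      open +-*-Solver
      small : ∀ e → e ≤ 1 → suc e / 2 ≡ e
      small zero          _ = refl
      small (suc zero)    _ = refl
      small (suc (suc _)) (s≤s ())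

    even-t : isEven t ≡ par e
    even-t = trans (isEven-par t) (trans (not-involutive (par s)) (trans (cong par s≡) (par-double e u)))

    binomials : ℕ
    binomials = sum (map (λ i → (n i + 1) C 2) (filterᵇ (λ i → not (i <ᵇ t / 2) ∧ not (t <ᵇ i + 2)) (upTo t)))

    -- As `t / 2 = e + u`, the range from `t / 2` to `t − 2` consists of the larger members `dual c`
    -- of the pairs, the smallest being `dual (u − 1) = e + u`.
    binomials-formula : binomials ≡ ∑ u (λ c → (n (dual c) + 1) C 2)
    binomials-formula = begin
      binomials
        ≡⟨ sum-filter-applyUpTo (λ i → (n i + 1) C 2) (λ i → not (i <ᵇ t / 2) ∧ not (t <ᵇ i + 2)) id t ⟩
      ∑ t F
        ≡⟨ ∑-dual F ⟩
      ∑ u (λ c → F c + F (dual c)) + e * F u + F s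
        ≡⟨ cong₂ _+_ (cong₂ _+_ (∑-cong u (λ c c<u → cong₂ _+_ (F-low c<u) (F-high c<u))) (F-mid e refl e≤1)) F-last ⟩
      ∑ u (λ c → (n (dual c) + 1) C 2) + 0 + 0
        ≡⟨ trans (+-identityʳ _) (+-identityʳ _) ⟩
      ∑ u (λ c → (n (dual c) + 1) C 2) ∎
      where
      open ≡-Reasoning
      F : ℕ → ℕ
      F i = if not (i <ᵇ t / 2) ∧ not (t <ᵇ i + 2) then (n i + 1) C 2 else 0
      below : ∀ {i} → i < e + u → F i ≡ 0
      below {i} h rewrite <ᵇ-true (subst (i <_) (sym t/2) h) = refl
      F-low : ∀ {c} → c < u → F c ≡ 0
      F-low c<u = below (≤-trans c<u (m≤n+m u e))
      F-mid : ∀ e′ → e′ ≡ e → e′ ≤ 1 → e′ * F u ≡ 0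
      F-mid zero          _ _ = refl
      F-mid (suc zero)    eq _ = trans (+-identityʳ _) (below (subst (λ k → u < k + u) eq (n<1+n u)))
      F-mid (suc (suc _)) _ (s≤s ())
      F-last : F s ≡ 0
      F-last rewrite <ᵇ-true {t} {s + 2} (≤-reflexive (+-comm 2 s)) | ∧-zeroʳ (not (s <ᵇ t / 2)) = refl
      ≤t : ∀ {c} → c < u → dual c + 2 ≤ t
      ≤t {c} c<u = ≤-trans (≤-reflexive (+-comm (dual c) 2)) (s≤s (dual<s (<-≤-trans c<u u≤s)))
      t/2≤ : ∀ {c} → c < u → t / 2 ≤ dual c
      t/2≤ {c} c<u = subst (_≤ dual c) (sym t/2) (≤-trans (≤-reflexive (sym (trans (cong (_∸ u) (trans s≡ (sym (+-assoc e u u)))) (m+n∸n≡m (e + u) u)))) (∸-monoʳ-≤ s c<u))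
      F-high : ∀ {c} → c < u → F (dual c) ≡ (n (dual c) + 1) C 2
      F-high {c} c<u rewrite <ᵇ-false {dual c} {t / 2} (t/2≤ c<u) | <ᵇ-false {t} {dual c + 2} (≤t c<u) = refl

    module _ (good : Good) where
      open Good good

      -- The residue `s`, and for even `t` the self-dual residue, carry a single bead each and add
      -- nothing to the rank.
      rank≡ : rank (core t lam) ≡ ∑ u (λ c → (n c ∸ 1) + (n (dual c) ∸ 1))
      rank≡ = begin
        rank (core t lam)  ≡⟨ rank-formula ⟩
        ∑ t (λ i → n i ∸ 1)  ≡⟨ ∑-dual (λ i → n i ∸ 1) ⟩
        pairs + e * (n u ∸ 1) + (n s ∸ 1)  ≡⟨ cong₂ (λ x y → pairs + x + (y ∸ 1)) (middle e refl e≤1) last-count ⟩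
        pairs + 0 + 0  ≡⟨ trans (+-identityʳ _) (+-identityʳ _) ⟩
        pairs  ∎
        where
        open ≡-Reasoning
        pairs = ∑ u (λ c → (n c ∸ 1) + (n (dual c) ∸ 1))
        middle : ∀ e′ → e′ ≡ e → e′ ≤ 1 → e′ * (n u ∸ 1) ≡ 0
        middle zero          _ _ = refl
        middle (suc zero)    eq _ = trans (+-identityʳ _) (cong (_∸ 1) (n-mid (sym eq)))
        middle (suc (suc _)) _ (s≤s ())

      ∑κ : ∑ u (κ good) ≡ binomials + e * rank (core t lam)
      ∑κ = trans (∑-+ u (λ c → (n (dual c) + 1) C 2) (λ c → e * ((n c ∸ 1) + (n (dual c) ∸ 1))))
        (cong₂ _+_ (sym binomials-formula) (trans (∑-* u) (cong (e *_) (sym rank≡))))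
        where
        ∑-* : ∀ m {g : ℕ → ℕ} → ∑ m (λ c → e * g c) ≡ e * ∑ m g
        ∑-* zero    = sym (*-zeroʳ e)
        ∑-* (suc m) = trans (cong (e * _ +_) (∑-* m)) (sym (*-distribˡ-+ e _ _))

      sign-parity : par ∣ epsilon t lam ∣ xor par (inversions (sigma t lam)) ≡ par (inversions (map (s ∸_) (map f bs)))
      sign-parity = begin
        par ∣ epsilon t lam ∣ xor par (inversions (sigma t lam))
          ≡⟨ cong₂ (λ x y → x xor par y) ε-parity (inversions-sorting desc) ⟩
        (par binomials xor par (e * suc (rank (core t lam)))) xor par r
          ≡⟨ cong (λ x → (par binomials xor x) xor par r) (trans (cong par (*-suc e (rank (core t lam)))) (par-+ e _)) ⟩
        (par binomials xor (par e xor par (e * rank (core t lam)))) xor par r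
          ≡⟨ solve 4 (λ b e k r → (b :+ (e :+ k)) :+ r := r :+ ((b :+ k) :+ e)) refl (par binomials) (par e) (par (e * rank (core t lam))) (par r) ⟩
        par r xor ((par binomials xor par (e * rank (core t lam))) xor par e)
          ≡⟨ cong (λ x → par r xor (x xor par e)) (sym (trans (cong par ∑κ) (par-+ binomials _))) ⟩
        par r xor (par (∑ u (κ good)) xor par e)
          ≡⟨ sym (parity good) ⟩
        par (inversions (map (s ∸_) (map f bs))) ∎
        where
        open ≡-Reasoning
        open xor-∧-Solver
        r = inversions (map (_% t) bs)
        branch : ∀ e′ k → e′ ≤ 1 → (if par e′ then ℤ.+ k else ℤ.+ 0) ≡ ℤ.+ (e′ * k)
        branch zero          k _ = refl
        branch (suc zero)    k _ = cong ℤ.+_ (sym (+-identityʳ k))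
        branch (suc (suc _)) k (s≤s ())
        ε-parity : par ∣ epsilon t lam ∣ ≡ par binomials xor par (e * suc (rank (core t lam)))
        ε-parity = trans (cong (λ x → par ∣ ℤ.- (ℤ.+ binomials) ℤ.+ x ∣)
          (trans (cong (λ p → if p then ℤ.+ (1 + rank (core t lam)) else ℤ.+ 0) even-t) (branch e _ e≤1)))
          (par-∣-+∣ binomials (e * suc (rank (core t lam))))

  -- The character value and its nonvanishing

  module Main {c ℓ : Level} (R : CommutativeRing c ℓ) where
    open RingNames R
    open RingDefs R
    open Determinant R
    open Homogeneous R
    open import Relation.Binary.Reasoning.Setoid setoid

    module _
      (domain : ∀ x y → x *ᴿ y ≈ 0# → x ≈ 0# ⊎ y ≈ 0#)
      (char0 : ∀ n → ¬ n ≡ 0 → ¬ natR n ≈ 0#)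
      (half : Carrier) (half-two : half *ᴿ (1# +ᴿ 1#) ≈ 1#)
      (s : ℕ) (ω : Carrier) (ω^t≈1 : pow ω (suc s) ≈ 1#) (prim : ∀ k → 1 ≤ k → k < suc s → ¬ pow ω k ≈ 1#)
      (lam : List ℕ) (desc : Desc (beta lam (suc s)))
      (e u : ℕ) (e≤1 : e ≤ 1) (s≡ : s ≡ e + (u + u)) where

      open Assembly e u e≤1 s s≡ lam desc
      open Beads e u e≤1 s s≡ bs desc len≡
      open Evaluation R e u e≤1 s s≡ bs desc len≡
      open Roots domain s ω ω^t≈1 prim using (hList-roots)
      open Entries (roots ω t) hList-roots

      spλ : Carrier
      spλ = sp half (roots ω t) lam t

      halve : ∀ x → x +ᴿ x ≈ 0# → x ≈ 0#
      halve x eq = begin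
        x  ≈⟨ ≈-sym (*-identityˡᴿ x) ⟩
        1# *ᴿ x  ≈⟨ ≈-sym half-two ⟨*⟩ ≈-refl ⟩
        (half *ᴿ two) *ᴿ x  ≈⟨ *-assocᴿ half two x ⟩
        half *ᴿ (two *ᴿ x)  ≈⟨ ≈-refl ⟨*⟩ ≈-trans (distribʳ x 1# 1#) (*-identityˡᴿ x ⟨+⟩ *-identityˡᴿ x) ⟩
        half *ᴿ (x +ᴿ x)  ≈⟨ ≈-refl ⟨*⟩ eq ⟩
        half *ᴿ 0#  ≈⟨ zeroʳ half ⟩
        0#  ∎

      sp≈D : spλ ≈ half *ᴿ D t Mx
      sp≈D = ≈-refl ⟨*⟩ det-D t {M′ = Mx} λ i j → ≈-trans
        (entry (part lam (suc (toℕ i))) (toℕ i) (toℕ j) (≤-pred (toℕ<n i)) (≤-pred (toℕ<n j)))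
        (reflexive (cong (λ b → ent b (s ∸ toℕ j)) (sym (at-map-upTo _ t (toℕ<n i)))))

      vanish : D t Mx ≈ 0# → spλ ≈ 0#
      vanish eq = ≈-trans sp≈D (≈-trans (≈-refl ⟨*⟩ eq) (zeroʳ half))

      nonzero⇒Good : ¬ spλ ≈ 0# → Good
      nonzero⇒Good nz with Counts?
      ... | no ¬counts = ⊥-elim (nz (vanish (vanish-counts ¬counts)))
      ... | yes counts = mkGood counts pair-big
        where
        pair-big : ∀ c → c < u → B c + B (dual c) ≤ 1
        pair-big c c<u with B c + B (dual c) ≤? 1
        ... | yes h = h
        ... | no h  = ⊥-elim (nz (vanish (vanish-big halve counts c c<u h)))

      module _ (good : Good) where
        open Good good

        -- For even `t` the residue `t / 2 − 1 = u` has exactly one bead, so its quotient partition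
        -- has at most one nonzero part, and has one precisely when the bead is big.
        factor≈ : factor R t lam ≈ pow two (e * B u)
        factor≈ = go e refl e≤1
          where
          go : ∀ e′ → e ≡ e′ → e′ ≤ 1 → factor R t lam ≈ pow two (e′ * B u)
          go zero e≡0 _ rewrite trans even-t (cong par e≡0) = ≈-refl
          go (suc (suc _)) _ (s≤s ())
          go (suc zero) e≡1 _ rewrite trans even-t (cong par e≡1) = ≈-trans (reflexive (cong (λ m → if m ≡ᵇ 0 then 1# else 1# +ᴿ 1#) len≡B)) (choose (S≤B (single (s≤s u≤s) (n-mid e≡1))))
            where
            mid≡ : t / 2 ∸ 1 ≡ u
            mid≡ = cong (_∸ 1) (trans t/2 (cong (_+ u) e≡1))
            one : ∀ es → length es ≡ 1 → Quotient.quotLen s es ≡ Quotient.bigs s es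
            one (x ∷ []) _ = Quotient.quotLen-1 s x
            len≡B : len (quot t lam (t / 2 ∸ 1)) ≡ B u
            len≡B = trans (cong (λ i → len (quot t lam i)) mid≡) (trans (len-quot u) (trans (one (Sorting.block s bs u) (n-mid e≡1)) (bigs-block u)))
            S≤B : (S u ≡ 1 × B u ≡ 0) ⊎ (S u ≡ 0 × B u ≡ 1) → B u ≡ 0 ⊎ B u ≡ 1
            S≤B (inj₁ (_ , h)) = inj₁ h
            S≤B (inj₂ (_ , h)) = inj₂ h
            choose : B u ≡ 0 ⊎ B u ≡ 1 → (if B u ≡ᵇ 0 then 1# else 1# +ᴿ 1#) ≈ pow two (1 * B u)
            choose (inj₁ h) rewrite h = ≈-refl
            choose (inj₂ h) rewrite h = ≈-sym (*-identityʳᴿ two)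

        signs≈ : signZ (epsilon t lam) *ᴿ signN (inversions (sigma t lam)) ≈ sg (par (inversions (map (s ∸_) (map f bs))))
        signs≈ = begin
          signN ∣ epsilon t lam ∣ *ᴿ signN (inversions (sigma t lam))
            ≡⟨ cong₂ _*ᴿ_ (signN-sg ∣ epsilon t lam ∣) (signN-sg (inversions (sigma t lam))) ⟩
          sg (par ∣ epsilon t lam ∣) *ᴿ sg (par (inversions (sigma t lam)))
            ≈⟨ ≈-sym (sg-xor (par ∣ epsilon t lam ∣) (par (inversions (sigma t lam)))) ⟩
          sg (par ∣ epsilon t lam ∣ xor par (inversions (sigma t lam)))
            ≡⟨ cong sg (sign-parity good) ⟩
          sg (par (inversions (map (s ∸_) (map f bs)))) ∎

        sp≈value : spλ ≈ value R t lam
        sp≈value = begin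
          spλ
            ≈⟨ sp≈D ⟩
          half *ᴿ D t Mx
            ≈⟨ ≈-refl ⟨*⟩ evaluate good ⟩
          half *ᴿ ((two *ᴿ pow two (e * B u)) *ᴿ σ)
            ≈⟨ ≈-trans (≈-refl ⟨*⟩ *-assocᴿ two _ σ) (≈-sym (*-assocᴿ half two _)) ⟩
          (half *ᴿ two) *ᴿ (pow two (e * B u) *ᴿ σ)
            ≈⟨ ≈-trans (half-two ⟨*⟩ ≈-refl) (*-identityˡᴿ _) ⟩
          pow two (e * B u) *ᴿ σ
            ≈⟨ *-commᴿ _ σ ⟩
          σ *ᴿ pow two (e * B u)
            ≈⟨ ≈-sym signs≈ ⟨*⟩ ≈-sym factor≈ ⟩
          value R t lam ∎
          where σ = sg (par (inversions (map (s ∸_) (map f bs))))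

        -- The value is a sign times a power of 2, and neither can vanish in a domain of
        -- characteristic 0.
        sp≉0 : ¬ spλ ≈ 0#
        sp≉0 eq = split (domain (pow two (e * B u)) (sg p) (begin
          pow two (e * B u) *ᴿ sg p     ≈⟨ *-commᴿ _ _ ⟩
          sg p *ᴿ pow two (e * B u)     ≈⟨ ≈-sym signs≈ ⟨*⟩ ≈-sym factor≈ ⟩
          value R t lam  ≈⟨ ≈-sym sp≈value ⟩
          spλ  ≈⟨ eq ⟩
          0#  ∎))
          where
          p = par (inversions (map (s ∸_) (map f bs)))
          1≉0 : ¬ 1# ≈ 0#
          1≉0 h = char0 1 (λ ()) (≈-trans (+-identityʳᴿ 1#) h)
          two≉0 : ¬ two ≈ 0#
          two≉0 h = char0 2 (λ ()) (≈-trans (≈-refl ⟨+⟩ +-identityʳᴿ 1#) h)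
          pow≉0 : ∀ m → ¬ pow two m ≈ 0#
          pow≉0 zero    h = 1≉0 h
          pow≉0 (suc m) h with domain two (pow two m) h
          ... | inj₁ h′ = two≉0 h′
          ... | inj₂ h′ = pow≉0 m h′
          sg≉0 : ∀ p → ¬ sg p ≈ 0#
          sg≉0 false h = 1≉0 h
          sg≉0 true  h = 1≉0 (≈-trans (≈-sym (-‿involutive 1#)) (≈-trans (-‿cong h) -0#≈0#))
          split : pow two (e * B u) ≈ 0# ⊎ sg p ≈ 0# → ⊥
          split (inj₁ h) = pow≉0 (e * B u) h
          split (inj₂ h) = sg≉0 p h

      main : ((¬ spλ ≈ 0#) ⇔ Cond t lam) × (Cond t lam → spλ ≈ value R t lam)
      main = mk⇔ (Good⇒Cond ∘ nonzero⇒Good) (sp≉0 ∘ Cond⇒Good) , sp≈value ∘ Cond⇒Good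

open import Data.Nat using (suc)
open import Data.Product using (_,_)

theorem6p1 : {c ℓ : Level} (R : CommutativeRing c ℓ) →
    let open CommutativeRing R in let open RingDefs R in
    (∀ x y → x * y ≈ 0# → x ≈ 0# ⊎ y ≈ 0#) →
    (∀ n → ¬ n ≡ 0 → ¬ natR n ≈ 0#) →
    (half : Carrier) → half * (1# + 1#) ≈ 1# →
    (t : ℕ) .{{_ : NonZero t}} → 2 ≤ t →
    (ω : Carrier) → pow ω t ≈ 1# → (∀ k → 1 ≤ k → k < t → ¬ pow ω k ≈ 1#) →
    (lam : List ℕ) → length lam ≡ t → Linked _≥_ lam →
    ((¬ sp half (roots ω t) lam t ≈ 0#) ⇔ Cond t lam)
    × (Cond t lam → sp half (roots ω t) lam t ≈ value R t lam)
theorem6p1 R domain char0 half half-two (suc s) 2≤t ω ω^t≈1 prim lam len≡ linked with Development.binary s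
... | e , u , e≤1 , s≡ = Development.Main.main R domain char0 half half-two s ω ω^t≈1 prim lam (Development.beta-Desc lam (suc s) len≡ linked) e u e≤1 s≡
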